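{- For any admissible $v>1$ (that is, any $v>1$ such that a $(K_v,P_5)$-design exists), $$\mathcal{L}_1P_5(v)=\{n\geq v-1\mid n\equiv 0,1\pmod 3\}$$ and $$\{n\geq v+2\mid n\equiv 0,1\pmod 3\}\subseteq\mathcal{L}_2P_5(v)\subseteq\{n\geq v\mid n\equiv 0,1\pmod 3\}.$$
   Context: Graphs are finite and simple; $\Gamma'\leq\Gamma$ means that $\Gamma'$ is (isomorphic to) a subgraph of $\Gamma$. $K_n$ is the complete graph on $n$ vertices and $P_k$ is the path with $k$ vertices and $k-1$ edges. For graphs $\Gamma\leq K$, a $(K,\Gamma)$-design is a set of subgraphs of $K$, called blocks, each isomorphic to $\Gamma$, whose edge sets partition $E(K)$. A $(K_v,\Gamma)$-design is also called a $\Gamma$-design of order $v$. Given a $(K,\Gamma)$-design $\mathcal B$ and a $(K',\Gamma')$-design $\mathcal B'$ with $\Gamma'\leq\Gamma$, a down-link from $\mathcal B$ to $\mathcal B'$ is a function $f:\mathcal B\to\mathcal B'$ such that, for every $B\in\mathcal B$, $f(B)$ is a subgraph of $B$ (as an actual graph on the given vertices, not merely up to isomorphism). The complete graphs $K=K_v$ and $K'=K_n$ may have different vertex sets. When such an $f$ exists, $\mathcal B$ is said to be down-linked to $\mathcal B'$. Throughout, the target graph is $\Gamma'=P_4$. $\mathcal{L}_1\Gamma(v)$ is the set of all integers $n$ such that there exists some $\Gamma$-design of order $v$ that can be down-linked to some $P_4$-design of order $n$. $\mathcal{L}_2\Gamma(v)$ is the set of all integers $n$ such that every $\Gamma$-design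 of order $v$ can be down-linked to some $P_4$-design of order $n$. Here these are used with $\Gamma=P_5$. -}

module Defs where

open import Level using (0ℓ; suc)
open import Data.Nat as ℕ using (ℕ; _<_; _≟_; _<?_)
open import Data.Nat.Properties using (<-trans; n<1+n; 1+n≢n)
open import Data.Fin using (Fin)
open import Data.List using (List; length; upTo)
open import Data.List.Membership.Propositional using (_∈_)
open import Data.List.Membership.Propositional.Properties using (∈-upTo⁺)
open import Data.List.Relation.Unary.Unique.Propositional using (Unique)
open import Data.List.Relation.Unary.Unique.Propositional.Properties using (upTo⁺)
open import Data.Product using (∃; ∃!; _×_; _,_; proj₁; Σ-syntax)
open import Data.Sum using (_⊎_; inj₁; inj₂; swap)
open import Function.Bundles using (_↔_; _⇔_; module Inverse)
open import Relation.Binary using (Rel; Decidable; Symmetric; Irreflexive)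
open import Relation.Binary.PropositionalEquality using (_≡_; _≢_; refl)
open import Relation.Nullary.Decidable using (_×-dec_; _⊎-dec_)
open import Relation.Unary using (Pred)

-- Finite simple graphs. All vertices are drawn from the common infinite
-- universe ℕ, so that graphs with different vertex sets can be compared
-- as actual graphs, not merely up to isomorphism.
record Graph : Set₁ where
  infix 4 _~_
  field
    vertices : List ℕ
    unique   : Unique vertices
    _~_      : Rel ℕ 0ℓ
    _~?_     : Decidable _~_
    ~-sym    : Symmetric _~_
    ~-irrefl : Irreflexive _≡_ _~_
    ~⇒∈      : ∀ {x y} → x ~ y → x ∈ vertices

  order : ℕ
  order = length vertices

  -- As `vertices` has no repetitions, membership proofs are unique, so
  -- propositional equality on this type is equality of vertices.
  Vertex : Set
  Vertex = ∃ (_∈ vertices)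

open Graph using (vertices; order; Vertex)

infix 4 _⊢_~_ _⊑_ _≅_

_⊢_~_ : Graph → ℕ → ℕ → Set
G ⊢ x ~ y = Graph._~_ G x y

_⊑_ : Graph → Graph → Set
G ⊑ H = (∀ {x} → x ∈ vertices G → x ∈ vertices H)
      × (∀ {x y} → G ⊢ x ~ y → H ⊢ x ~ y)

record _≅_ (G H : Graph) : Set where
  field
    bijection : Vertex G ↔ Vertex H
  open Inverse bijection using (to) public
  field
    adjacency : ∀ x y →
      (G ⊢ proj₁ x ~ proj₁ y) ⇔ (H ⊢ proj₁ (to x) ~ proj₁ (to y))

IsComplete : Graph → Set
IsComplete G =
  ∀ {x y} → x ∈ vertices G → y ∈ vertices G → x ≢ y → G ⊢ x ~ y

-- The path 0 – 1 – ⋯ – (k − 1), with k vertices.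
path : ℕ → Graph
path k = record
  { vertices = upTo k
  ; unique   = upTo⁺ k
  ; _~_      = λ x y → Step x y ⊎ Step y x
  ; _~?_     = λ x y → step? x y ⊎-dec step? y x
  ; ~-sym    = swap
  ; ~-irrefl = λ { {x} refl (inj₁ (e , _)) → 1+n≢n e
                 ; {x} refl (inj₂ (e , _)) → 1+n≢n e }
  ; ~⇒∈      = λ { {x} (inj₁ (refl , y<k)) → ∈-upTo⁺ (<-trans (n<1+n x) y<k)
                 ; (inj₂ (_ , x<k)) → ∈-upTo⁺ x<k }
  }
  where
  Step : ℕ → ℕ → Set
  Step x y = ℕ.suc x ≡ y × y < k

  step? : Decidable Step
  step? x y = (ℕ.suc x ≟ y) ×-dec (y <? k)

-- A (K, Γ)-design. The blocks are given as a finite indexed family; when Γ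
-- has an edge, `partition` makes the blocks pairwise distinct, so this is the
-- same as a set of blocks.
record Design (K Γ : Graph) : Set₁ where
  field
    size      : ℕ
    block     : Fin size → Graph
    block-⊑   : ∀ i → block i ⊑ K
    block-≅   : ∀ i → block i ≅ Γ
    partition : ∀ {x y} → K ⊢ x ~ y → ∃! _≡_ (λ i → block i ⊢ x ~ y)

-- A Γ-design of order v; the complete graph on v vertices that it decomposes
-- may have any v-element vertex set.
record DesignOfOrder (v : ℕ) (Γ : Graph) : Set₁ where
  field
    K          : Graph
    K-order    : order K ≡ v
    K-complete : IsComplete K
    design     : Design K Γ

DownLink : ∀ {K Γ K′ Γ′} → Design K Γ → Design K′ Γ′ → Set
DownLink 𝓑 𝓑′ =
  Σ[ f ∈ (Fin 𝓑.size → Fin 𝓑′.size) ] (∀ i → 𝓑′.block (f i) ⊑ 𝓑.block i)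
  where
  module 𝓑  = Design 𝓑
  module 𝓑′ = Design 𝓑′

Admissible : Graph → ℕ → Set₁
Admissible Γ v = DesignOfOrder v Γ

DownLinkedTo-P₄ : ∀ {v Γ} → DesignOfOrder v Γ → ℕ → Set₁
DownLinkedTo-P₄ 𝓑 n =
  Σ[ 𝓑′ ∈ DesignOfOrder n (path 4) ]
    DownLink (DesignOfOrder.design 𝓑) (DesignOfOrder.design 𝓑′)

𝓛₁ : Graph → ℕ → Pred ℕ (suc 0ℓ)
𝓛₁ Γ v n = Σ[ 𝓑 ∈ DesignOfOrder v Γ ] DownLinkedTo-P₄ 𝓑 n

𝓛₂ : Graph → ℕ → Pred ℕ (suc 0ℓ)
𝓛₂ Γ v n = (𝓑 : DesignOfOrder v Γ) → DownLinkedTo-P₄ 𝓑 n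

{-# OPTIONS --safe #-}
module Submission where

-- Bounds. A vertex pair missing from the target would force a block to contain six vertices, so n ≥ v ∸ 1; and if
-- every vertex is an inner vertex of some block, no vertex at all can be missing. The congruences come from counting
-- darts.
--
-- n ≥ v + 2. Remove an end edge from every block, keep the remaining copies of P₄, and pack all edges that are left
-- over, except those at two new vertices a and b, greedily into further copies of P₄. What resists is a disjoint
-- union of stars and triangles, and its cone over a and b is decomposed by hand: counting edges, the number of
-- stars is 1 modulo 3; three stars cooperate, and the last one absorbs the edge a b.
--
-- n = v ∸ 1, v, v + 1. Small explicit designs are glued along complete bipartite graphs. For v ∸ 1 and v + 1 some
-- vertex u is an end of every block through it, so that u can be deleted, or take the role of a.

import Algebra.Solver.CommutativeMonoid as CommutativeMonoidSolver
open import Data.Bool using (Bool; true; false) renaming (T to Holds)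
open import Data.Empty using (⊥-elim)
open import Data.Fin using (Fin; zero; suc; toℕ; fromℕ<)
open import Data.Fin.Properties using (toℕ<n; toℕ-fromℕ<; fromℕ<-toℕ; toℕ-injective)
open import Data.List using (List; []; _∷_; _++_; [_]; map; concatMap; length; upTo; applyUpTo; downFrom; tabulate; lookup)
open import Data.List.Membership.DecPropositional using () renaming (_∈?_ to decide-∈)
open import Data.List.Membership.Propositional using (_∈_; _∉_; find)
open import Data.List.Membership.Propositional.Properties
  using (∈-++⁺ˡ; ∈-++⁺ʳ; ∈-++⁻; ∈-∃++; ∈-concat⁺′; ∈-concatMap⁺; ∈-concatMap⁻; ∈-upTo⁺; ∈-upTo⁻; ∈-lookup; ∈-map⁺; ∈-map⁻; ∈-tabulate⁺)
open import Data.List.Membership.Propositional.Properties.WithK using (unique⇒irrelevant; unique∧set⇒bag)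
open import Data.List.Properties
  using (length-++; ++-assoc; ++-identityʳ; concatMap-++; map-++; map-upTo; length-downFrom)
open import Data.List.Relation.Binary.BagAndSetEquality using (∼bag⇒↭)
import Data.List.Relation.Binary.Permutation.Propositional as Perm
open Perm using (_↭_; ↭-refl; ↭-sym; ↭-trans; ↭-prep; ↭-reflexive)
open import Data.List.Relation.Binary.Permutation.Propositional.Properties
  using (∈-resp-↭; All-resp-↭; ↭-length; shift; ++-commutativeMonoid; ++-comm; ++⁺; ++⁺ˡ; ++⁺ʳ; map⁺; ¬x∷xs↭[])
open import Data.List.Relation.Binary.Permutation.Setoid.Properties using (Unique-resp-↭)
open import Data.List.Relation.Binary.Subset.Propositional using () renaming (_⊆_ to _⊆ₗ_)
open import Data.List.Relation.Unary.All as All using (All; []; _∷_)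
import Data.List.Relation.Unary.All.Properties as All
open import Data.List.Relation.Unary.All.Properties using (All¬⇒¬Any; ¬Any⇒All¬)
open import Data.List.Relation.Unary.AllPairs using ([]; _∷_)
import Data.List.Relation.Unary.AllPairs.Properties as AllPairs
open import Data.List.Relation.Unary.Any as Any using (Any; here; there; index; any?)
open import Data.List.Relation.Unary.Any.Properties using (lookup-index; tabulate⁺; tabulate⁻)
  renaming (map⁺ to any-map⁺; ++⁺ˡ to any-++⁺ˡ; ++⁺ʳ to any-++⁺ʳ)
open import Data.List.Relation.Unary.Unique.Propositional using (Unique)
import Data.List.Relation.Unary.Unique.Propositional.Properties as Unique
open import Data.Maybe as Maybe using (Maybe; just; nothing; is-just)
open import Data.Nat using (ℕ; zero; suc; NonZero; _+_; _*_; _∸_; _/_; _%_; _≤_; _<_; _>_; _≥_; z≤n; s≤s; _≟_)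
open import Data.Nat.Divisibility using (_∣_; divides; ∣m+n∣m⇒∣n; m∣m*n; m%n≡0⇒n∣m; n∣m⇒m%n≡0; ∣m⇒∣m*n; ∣n⇒∣m*n)
open import Data.Nat.DivMod using (m%n<n; %-distribˡ-*; [m+kn]%n≡m%n; m≡m%n+[m/n]*n)
open import Data.Nat.ListAction using (sum)
open import Data.Nat.Properties
  using (≤-trans; ≤-reflexive; <-irrefl; suc-injective; +-comm; +-cancelˡ-≡; +-cancelʳ-≡; m≤m+n; m≤n+m; m∸n≤m; m+[n∸m]≡n; m≤n⇒m<n∨m≡n; allUpTo?)
open import Data.Nat.Tactic.RingSolver using (solve-∀)
open import Data.Product using (∃; ∃₂; ∃!; _×_; _,_; proj₁; proj₂)
open import Data.Product.Properties using (≡-dec)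
open import Data.Sum using (_⊎_; inj₁; inj₂)
open import Data.Unit using (⊤; tt)
open import Data.Vec as Vec using (Vec; []; _∷_; toList)
open import Data.Vec.Properties using (lookup∘tabulate; length-toList)
import Data.Vec.Relation.Unary.All as VecAll
import Data.Vec.Relation.Unary.AllPairs as VecAllPairs
open import Data.Vec.Relation.Unary.Unique.Propositional renaming (Unique to Distinct)
import Data.Vec.Relation.Unary.Unique.Propositional.Properties as Distinct
open import Function using (_∘_; mk⇔; mk↔ₛ′; Inverse; Equivalence)
open import Relation.Binary.PropositionalEquality
  using (_≡_; _≢_; refl; sym; trans; cong; cong₂; subst; subst₂; setoid; ≢-sym; module ≡-Reasoning)
open import Relation.Nullary using (¬_; Dec; yes; no)
open import Relation.Nullary.Decidable using (True; toWitness; map′; from-yes; ¬?; _×-dec_; _⊎-dec_; _→-dec_)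
open import Relation.Unary using (_≐_; _⊆_)
open import Data.List.Relation.Unary.Unique.DecPropositional _≟_ using (unique?)
open import Defs
open Graph using (vertices; Vertex)

-- Lists of darts

-- When n ≥ v + 2 the source design is arbitrary, so nothing is known about the graph formed by the
-- removed edges. The greedy packing serves to replace it by a graph whose components are
-- classified, at the price of an uncontrolled number of them; the divisibility of the edge count is
-- the only global information left. It enters as follows: the cone over a star with l leaves has l
-- + 2(l + 1) = 3l + 2 edges, the cone over a triangle has 9, and a b is one more, so s stars give
-- 2s + 1 modulo 3. Isolated vertices count as stars with l = 0. The designs built there are
-- therefore such that the removed edges split into copies of P₄ by themselves. This property has to
-- survive gluing, and a complete bipartite graph K(m,8) has 2m blocks, hence 2m removed edges, so m
-- must be a multiple of 3. Together with the condition modulo 8 on v this leads to constructions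
-- with period 24. For n = v + 1 one spare vertex is enough, because the other apex is taken from
-- the source, and only parity matters in the gluing.

module ++-Solver {A : Set} = CommutativeMonoidSolver (++-commutativeMonoid {A = A})
open ++-Solver using (solve; _⊜_) renaming (_⊕_ to _∙_; id to ε)

unique-↭ : {A : Set} {xs ys : List A} → xs ↭ ys → Unique xs → Unique ys
unique-↭ {A} p u = Unique-resp-↭ (setoid A) (Perm.↭⇒↭ₛ p) u

∈⇒↭ : {A : Set} {x : A} {xs : List A} → x ∈ xs → ∃ λ ys → xs ↭ x ∷ ys
∈⇒↭ {x = x} x∈ with ys , zs , refl ← ∈-∃++ x∈ = ys ++ zs , shift x ys zs

unique-⊆-length : {A : Set} {xs ys : List A} → Unique xs → xs ⊆ₗ ys → length xs ≤ length ys
unique-⊆-length {xs = []} [] _ = z≤n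
unique-⊆-length {xs = x ∷ xs} (x∉ ∷ u) xs⊆ with zs , p ← ∈⇒↭ (xs⊆ (here refl)) =
  ≤-trans (s≤s (unique-⊆-length u xs⊆zs)) (≤-reflexive (sym (↭-length p)))
  where
  xs⊆zs : xs ⊆ₗ zs
  xs⊆zs y∈ with ∈-resp-↭ p (xs⊆ (there y∈))
  ... | here refl = ⊥-elim (All¬⇒¬Any x∉ y∈)
  ... | there y∈zs = y∈zs

unique-set⇒↭ : {A : Set} {xs ys : List A} → Unique xs → Unique ys → xs ⊆ₗ ys → ys ⊆ₗ xs → xs ↭ ys
unique-set⇒↭ u w f g = ∼bag⇒↭ (unique∧set⇒bag u w (mk⇔ f g))

-- An undirected edge is listed as its two darts (x , y) and (y , x); two lists of
-- darts describe the same multigraph when they are permutations of each other.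
Dart : Set
Dart = ℕ × ℕ

star : {A : Set} → A → List A → List (A × A)
star x []       = []
star x (y ∷ ys) = (x , y) ∷ (y , x) ∷ star x ys

bip : {A : Set} → List A → List A → List (A × A)
bip []       ys = []
bip (x ∷ xs) ys = star x ys ++ bip xs ys

complete : {A : Set} → List A → List (A × A)
complete []       = []
complete (x ∷ xs) = star x xs ++ complete xs

darts : {A : Set} {n : ℕ} → Vec A n → List (A × A)
darts []          = []
darts (x ∷ [])    = []
darts (x ∷ y ∷ p) = (x , y) ∷ (y , x) ∷ darts (y ∷ p)

star-++ : {A : Set} (x : A) (ys zs : List A) → star x (ys ++ zs) ≡ star x ys ++ star x zs
star-++ x []       zs = refl
star-++ x (y ∷ ys) zs = cong (λ E → _ ∷ _ ∷ E) (star-++ x ys zs)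

bip-++ˡ : {A : Set} (ws xs ys : List A) → bip (ws ++ xs) ys ↭ bip ws ys ++ bip xs ys
bip-++ˡ []       xs ys = ↭-refl
bip-++ˡ (w ∷ ws) xs ys = ↭-trans (++⁺ˡ (star w ys) (bip-++ˡ ws xs ys))
  (solve 3 (λ a b c → a ∙ (b ∙ c) ⊜ (a ∙ b) ∙ c) ↭-refl (star w ys) (bip ws ys) (bip xs ys))

bip-++ʳ : {A : Set} (xs ys zs : List A) → bip xs (ys ++ zs) ↭ bip xs ys ++ bip xs zs
bip-++ʳ []       ys zs = ↭-refl
bip-++ʳ (x ∷ xs) ys zs rewrite star-++ x ys zs = ↭-trans (++⁺ˡ (star x ys ++ star x zs) (bip-++ʳ xs ys zs))
  (solve 4 (λ a b c d → (a ∙ b) ∙ (c ∙ d) ⊜ (a ∙ c) ∙ (b ∙ d)) ↭-refl (star x ys) (star x zs) (bip xs ys) (bip xs zs))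

bip-[]ʳ : {A : Set} (xs : List A) → bip xs [] ≡ []
bip-[]ʳ []       = refl
bip-[]ʳ (x ∷ xs) = bip-[]ʳ xs

bip-∷ʳ : {A : Set} (xs : List A) (y : A) (ys : List A) → bip xs (y ∷ ys) ↭ star y xs ++ bip xs ys
bip-∷ʳ []       y ys = ↭-refl
bip-∷ʳ (x ∷ xs) y ys = ↭-trans (++⁺ˡ ((x , y) ∷ (y , x) ∷ star x ys) (bip-∷ʳ xs y ys))
  (solve 5 (λ a b c d e → (a ∙ (b ∙ c)) ∙ (d ∙ e) ⊜ (b ∙ (a ∙ d)) ∙ (c ∙ e)) ↭-refl
    [ (x , y) ] [ (y , x) ] (star x ys) (star y xs) (bip xs ys))

bip-comm : {A : Set} (xs ys : List A) → bip xs ys ↭ bip ys xs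
bip-comm []       ys rewrite bip-[]ʳ ys = ↭-refl
bip-comm (x ∷ xs) ys = ↭-trans (++⁺ˡ (star x ys) (bip-comm xs ys)) (↭-sym (bip-∷ʳ ys x xs))

complete-++ : {A : Set} (xs ys : List A) → complete (xs ++ ys) ↭ complete xs ++ bip xs ys ++ complete ys
complete-++ []       ys = ↭-refl
complete-++ (x ∷ xs) ys rewrite star-++ x xs ys = ↭-trans (++⁺ˡ (star x xs ++ star x ys) (complete-++ xs ys))
  (solve 5 (λ a b c d e → (a ∙ b) ∙ (c ∙ (d ∙ e)) ⊜ (a ∙ c) ∙ ((b ∙ d) ∙ e)) ↭-refl
    (star x xs) (star x ys) (complete xs) (bip xs ys) (complete ys))

star-↭ : {A : Set} (x : A) {ys zs : List A} → ys ↭ zs → star x ys ↭ star x zs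
star-↭ x Perm.refl = ↭-refl
star-↭ x (Perm.prep y p) = ↭-prep _ (↭-prep _ (star-↭ x p))
star-↭ x (Perm.swap {xs} {ys} y z p) = ↭-trans (++⁺ˡ ((x , y) ∷ (y , x) ∷ (x , z) ∷ (z , x) ∷ []) (star-↭ x p))
  (solve 3 (λ a b c → a ∙ (b ∙ c) ⊜ b ∙ (a ∙ c)) ↭-refl
    ((x , y) ∷ (y , x) ∷ []) ((x , z) ∷ (z , x) ∷ []) (star x ys))
star-↭ x (Perm.trans p q) = ↭-trans (star-↭ x p) (star-↭ x q)

bip-↭ʳ : {A : Set} (xs : List A) {ys zs : List A} → ys ↭ zs → bip xs ys ↭ bip xs zs
bip-↭ʳ []       p = ↭-refl
bip-↭ʳ (x ∷ xs) p = ++⁺ (star-↭ x p) (bip-↭ʳ xs p)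

bip-↭ˡ : {A : Set} {ws xs : List A} (ys : List A) → ws ↭ xs → bip ws ys ↭ bip xs ys
bip-↭ˡ {ws = ws} {xs} ys p = ↭-trans (bip-comm ws ys) (↭-trans (bip-↭ʳ ys p) (bip-comm ys xs))

complete-↭ : {A : Set} {ys zs : List A} → ys ↭ zs → complete ys ↭ complete zs
complete-↭ Perm.refl = ↭-refl
complete-↭ (Perm.prep y p) = ++⁺ (star-↭ y p) (complete-↭ p)
complete-↭ (Perm.swap {xs} {ys} y z p) = ↭-trans
  (++⁺ˡ ((y , z) ∷ (z , y) ∷ []) (++⁺ (star-↭ y p) (++⁺ (star-↭ z p) (complete-↭ p))))
  (solve 5 (λ a b c d e → (a ∙ b) ∙ (c ∙ (d ∙ e)) ⊜ (b ∙ a) ∙ (d ∙ (c ∙ e))) ↭-refl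
    [ (y , z) ] [ (z , y) ] (star y ys) (star z ys) (complete ys))
complete-↭ (Perm.trans p q) = ↭-trans (complete-↭ p) (complete-↭ q)

∈-star⁻ : {A : Set} {x u v : A} (ys : List A) → (u , v) ∈ star x ys → (u ≡ x × v ∈ ys) ⊎ (v ≡ x × u ∈ ys)
∈-star⁻ (y ∷ ys) (here refl)         = inj₁ (refl , here refl)
∈-star⁻ (y ∷ ys) (there (here refl)) = inj₂ (refl , here refl)
∈-star⁻ (y ∷ ys) (there (there e)) with ∈-star⁻ ys e
... | inj₁ (p , q) = inj₁ (p , there q)
... | inj₂ (p , q) = inj₂ (p , there q)

∈-star⁺ : {A : Set} {x y : A} {ys : List A} → y ∈ ys → (x , y) ∈ star x ys × (y , x) ∈ star x ys
∈-star⁺ (here refl) = here refl , there (here refl)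
∈-star⁺ (there y∈) with e , e′ ← ∈-star⁺ y∈ = there (there e) , there (there e′)

∈-complete⁻ : {A : Set} {u v : A} (xs : List A) → (u , v) ∈ complete xs → u ∈ xs × v ∈ xs
∈-complete⁻ (x ∷ xs) e with ∈-++⁻ (star x xs) e
... | inj₁ e′ with ∈-star⁻ xs e′
...   | inj₁ (refl , q) = here refl , there q
...   | inj₂ (refl , q) = there q , here refl
∈-complete⁻ (x ∷ xs) e | inj₂ e′ with p , q ← ∈-complete⁻ xs e′ = there p , there q

complete-irreflexive : {A : Set} {x : A} (xs : List A) → Unique xs → (x , x) ∉ complete xs
complete-irreflexive (y ∷ xs) (y∉ ∷ u) e with ∈-++⁻ (star y xs) e
... | inj₂ e′ = complete-irreflexive xs u e′
... | inj₁ e′ with ∈-star⁻ xs e′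
...   | inj₁ (refl , q) = All¬⇒¬Any y∉ q
...   | inj₂ (refl , q) = All¬⇒¬Any y∉ q

∈-complete⁺ : {A : Set} {u v : A} {xs : List A} → u ∈ xs → v ∈ xs → u ≢ v → (u , v) ∈ complete xs
∈-complete⁺ (here refl) (here refl) u≢v = ⊥-elim (u≢v refl)
∈-complete⁺ (here refl) (there v∈)  _   = ∈-++⁺ˡ (proj₁ (∈-star⁺ v∈))
∈-complete⁺ (there u∈)  (here refl) _   = ∈-++⁺ˡ (proj₂ (∈-star⁺ u∈))
∈-complete⁺ (there u∈)  (there v∈)  u≢v = ∈-++⁺ʳ _ (∈-complete⁺ u∈ v∈ u≢v)

star-unique : {A : Set} {x : A} {ys : List A} → x ∉ ys → Unique ys → Unique (star x ys)
star-unique {ys = []} _ _ = []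
star-unique {x = x} {ys = y ∷ ys} x∉ (y∉ ∷ u) =
  (( λ { refl → x∉ (here refl) }) ∷ ¬Any⇒All¬ _ first) ∷ ¬Any⇒All¬ _ second ∷ star-unique (x∉ ∘ there) u
  where
  first : (x , y) ∉ star x ys
  first e with ∈-star⁻ ys e
  ... | inj₁ (_ , q) = All¬⇒¬Any y∉ q
  ... | inj₂ (refl , q) = x∉ (here refl)
  second : (y , x) ∉ star x ys
  second e with ∈-star⁻ ys e
  ... | inj₁ (refl , q) = x∉ (here refl)
  ... | inj₂ (_ , q) = All¬⇒¬Any y∉ q

complete-unique : {A : Set} {xs : List A} → Unique xs → Unique (complete xs)
complete-unique [] = []
complete-unique {xs = x ∷ xs} (x∉ ∷ u) =
  Unique.++⁺ (star-unique (All¬⇒¬Any x∉) u) (complete-unique u) λ (e , e′) → disjoint e (∈-complete⁻ xs e′)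
  where
  disjoint : ∀ {a b} → (a , b) ∈ star x xs → ¬ (a ∈ xs × b ∈ xs)
  disjoint e (a∈ , b∈) with ∈-star⁻ xs e
  ... | inj₁ (refl , _) = All¬⇒¬Any x∉ a∈
  ... | inj₂ (refl , _) = All¬⇒¬Any x∉ b∈

length-star : {A : Set} (x : A) (ys : List A) → length (star x ys) ≡ 2 * length ys
length-star x []       = refl
length-star x (y ∷ ys) = trans (cong (2 +_) (length-star x ys)) (lemma (length ys))
  where
  lemma : ∀ n → 2 + 2 * n ≡ 2 * suc n
  lemma = solve-∀

length-complete : {A : Set} (xs : List A) → length (complete xs) + length xs ≡ length xs * length xs
length-complete []       = refl
length-complete (x ∷ xs) = begin
  length (star x xs ++ complete xs) + suc n        ≡⟨ cong (_+ suc n) (length-++ (star x xs)) ⟩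
  length (star x xs) + c + suc n                   ≡⟨ cong (λ m → m + c + suc n) (length-star x xs) ⟩
  2 * n + c + suc n                                ≡⟨ lemma₁ n c ⟩
  1 + 2 * n + (c + n)                              ≡⟨ cong (1 + 2 * n +_) (length-complete xs) ⟩
  1 + 2 * n + n * n                                ≡⟨ lemma₂ n ⟩
  suc n * suc n                                    ∎
  where
  open ≡-Reasoning
  n = length xs
  c = length (complete xs)
  lemma₁ : ∀ n c → 2 * n + c + suc n ≡ 1 + 2 * n + (c + n)
  lemma₁ = solve-∀
  lemma₂ : ∀ n → 1 + 2 * n + n * n ≡ suc n * suc n
  lemma₂ = solve-∀

length-darts : {A : Set} {n : ℕ} (p : Vec A (suc n)) → length (darts p) ≡ 2 * n
length-darts (x ∷ [])    = refl
length-darts {n = suc n} (x ∷ y ∷ p) = trans (cong (2 +_) (length-darts (y ∷ p))) (lemma n)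
  where
  lemma : ∀ n → 2 + 2 * n ≡ 2 * suc n
  lemma = solve-∀

length-concatMap-darts : {A : Set} {n : ℕ} (ps : List (Vec A (suc n))) →
  length (concatMap darts ps) ≡ length ps * (2 * n)
length-concatMap-darts []       = refl
length-concatMap-darts (p ∷ ps) =
  trans (length-++ (darts p)) (cong₂ _+_ (length-darts p) (length-concatMap-darts ps))

-- Paths, decompositions and designs

distinct⇒unique : {n : ℕ} {p : Vec ℕ n} → Distinct p → Unique (toList p)
distinct⇒unique VecAllPairs.[] = []
distinct⇒unique (x∉ VecAllPairs.∷ d) = all x∉ ∷ distinct⇒unique d
  where
  all : ∀ {x n} {p : Vec ℕ n} → VecAll.All (x ≢_) p → All (x ≢_) (toList p)
  all VecAll.[] = []
  all (h VecAll.∷ t) = h ∷ all t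

unique⇒distinct : {n : ℕ} {p : Vec ℕ n} → Unique (toList p) → Distinct p
unique⇒distinct {p = []} _ = VecAllPairs.[]
unique⇒distinct {p = x ∷ p} (x∉ ∷ u) = all p x∉ VecAllPairs.∷ unique⇒distinct u
  where
  all : ∀ {x n} (p : Vec ℕ n) → All (x ≢_) (toList p) → VecAll.All (x ≢_) p
  all [] [] = VecAll.[]
  all (_ ∷ p) (h ∷ t) = h VecAll.∷ all p t

lookup-∈ : {n : ℕ} (p : Vec ℕ n) (i : Fin n) → Vec.lookup p i ∈ toList p
lookup-∈ (x ∷ p) zero    = here refl
lookup-∈ (x ∷ p) (suc i) = there (lookup-∈ p i)

locate : {x n : ℕ} (p : Vec ℕ n) → x ∈ toList p → ∃ λ i → Vec.lookup p i ≡ x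
locate (_ ∷ p) (here refl) = zero , refl
locate (_ ∷ p) (there x∈) with i , eq ← locate p x∈ = suc i , eq

Consecutive : {n : ℕ} → Fin n → Fin n → Set
Consecutive i j = suc (toℕ i) ≡ toℕ j ⊎ suc (toℕ j) ≡ toℕ i

darts-sym : {n x y : ℕ} (p : Vec ℕ n) → (x , y) ∈ darts p → (y , x) ∈ darts p
darts-sym (x ∷ y ∷ p) (here refl)         = there (here refl)
darts-sym (x ∷ y ∷ p) (there (here refl)) = here refl
darts-sym (x ∷ y ∷ p) (there (there e))   = there (there (darts-sym (y ∷ p) e))

∈-darts⁺ : {n : ℕ} (p : Vec ℕ n) (i j : Fin n) → Consecutive i j → (Vec.lookup p i , Vec.lookup p j) ∈ darts p
∈-darts⁺ p i j (inj₁ e) = forward p i j e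
  where
  forward : {n : ℕ} (p : Vec ℕ n) (i j : Fin n) → suc (toℕ i) ≡ toℕ j → (Vec.lookup p i , Vec.lookup p j) ∈ darts p
  forward (x ∷ y ∷ p) zero    (suc zero) _ = here refl
  forward (x ∷ y ∷ p) (suc i) (suc j)    e = there (there (forward (y ∷ p) i j (suc-injective e)))
∈-darts⁺ p i j (inj₂ e) = darts-sym p (∈-darts⁺ p j i (inj₁ e))

∈-darts⁻ : {n x y : ℕ} (p : Vec ℕ n) → (x , y) ∈ darts p →
  ∃₂ λ i j → Vec.lookup p i ≡ x × Vec.lookup p j ≡ y × Consecutive i j
∈-darts⁻ (x ∷ y ∷ p) (here refl)         = zero , suc zero , refl , refl , inj₁ refl
∈-darts⁻ (x ∷ y ∷ p) (there (here refl)) = suc zero , zero , refl , refl , inj₂ refl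
∈-darts⁻ (x ∷ y ∷ p) (there (there e)) with ∈-darts⁻ (y ∷ p) e
... | i , j , l , r , inj₁ c = suc i , suc j , l , r , inj₁ (cong suc c)
... | i , j , l , r , inj₂ c = suc i , suc j , l , r , inj₂ (cong suc c)

darts⇒∈ : {n x y : ℕ} (p : Vec ℕ n) → (x , y) ∈ darts p → x ∈ toList p
darts⇒∈ (x ∷ y ∷ p) (here refl)         = here refl
darts⇒∈ (x ∷ y ∷ p) (there (here refl)) = there (here refl)
darts⇒∈ (x ∷ y ∷ p) (there (there e))   = there (darts⇒∈ (y ∷ p) e)

darts-total : {n x : ℕ} (p : Vec ℕ (2 + n)) → x ∈ toList p → ∃ λ y → (x , y) ∈ darts p
darts-total (x ∷ y ∷ p)     (here refl)         = y , here refl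
darts-total (x ∷ y ∷ p)     (there (here refl)) = x , there (here refl)
darts-total (x ∷ y ∷ z ∷ p) (there (there x∈)) with w , e ← darts-total (y ∷ z ∷ p) (there x∈) =
  w , there (there e)

darts-irreflexive : {n x y : ℕ} {p : Vec ℕ n} → Distinct p → (x , y) ∈ darts p → x ≢ y
darts-irreflexive {p = x ∷ y ∷ p} ((x≢y VecAll.∷ _) VecAllPairs.∷ d) (here refl)         = x≢y
darts-irreflexive {p = x ∷ y ∷ p} ((x≢y VecAll.∷ _) VecAllPairs.∷ d) (there (here refl)) = ≢-sym x≢y
darts-irreflexive {p = x ∷ y ∷ p} (_ VecAllPairs.∷ d) (there (there e)) = darts-irreflexive d e

darts-unique : {n : ℕ} {p : Vec ℕ n} → Distinct p → Unique (darts p)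
darts-unique {p = []} _ = []
darts-unique {p = x ∷ []} _ = []
darts-unique {p = x ∷ y ∷ p} (x∉ VecAllPairs.∷ d) with (x∉′ ∷ _) ← distinct⇒unique (x∉ VecAllPairs.∷ d) =
  ((λ { refl → darts-irreflexive {p = x ∷ y ∷ p} (x∉ VecAllPairs.∷ d) (here refl) refl })
    ∷ ¬Any⇒All¬ _ (All¬⇒¬Any x∉′ ∘ darts⇒∈ (y ∷ p)))
  ∷ ¬Any⇒All¬ _ (All¬⇒¬Any x∉′ ∘ darts⇒∈ (y ∷ p) ∘ darts-sym (y ∷ p))
  ∷ darts-unique d

pathGraph : {n : ℕ} (p : Vec ℕ n) → Distinct p → Graph
pathGraph p d = record
  { vertices = toList p
  ; unique   = distinct⇒unique d
  ; _~_      = λ x y → (x , y) ∈ darts p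
  ; _~?_     = λ x y → decide-∈ (≡-dec _≟_ _≟_) (x , y) (darts p)
  ; ~-sym    = darts-sym p
  ; ~-irrefl = λ x≡y e → darts-irreflexive d e x≡y
  ; ~⇒∈      = darts⇒∈ p
  }

completeGraph : (V : List ℕ) → Unique V → Graph
completeGraph V u = record
  { vertices = V
  ; unique   = u
  ; _~_      = λ x y → x ∈ V × y ∈ V × x ≢ y
  ; _~?_     = λ x y → decide-∈ _≟_ x V ×-dec (decide-∈ _≟_ y V ×-dec ¬? (x ≟ y))
  ; ~-sym    = λ (x∈ , y∈ , x≢y) → y∈ , x∈ , ≢-sym x≢y
  ; ~-irrefl = λ x≡y (_ , _ , x≢y) → x≢y x≡y
  ; ~⇒∈      = proj₁
  }

vertex-≡ : (G : Graph) {a b : Vertex G} → proj₁ a ≡ proj₁ b → a ≡ b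
vertex-≡ G {x , x∈} {.x , x∈′} refl = cong (x ,_) (unique⇒irrelevant (Graph.unique G) x∈ x∈′)

pathGraph-≅ : {n : ℕ} (p : Vec ℕ n) (d : Distinct p) → pathGraph p d ≅ path n
pathGraph-≅ {n} p d = record
  { bijection = mk↔ₛ′ to from to∘from from∘to
  ; adjacency = λ x y → mk⇔ (adj⁺ x y) (adj⁻ x y)
  }
  where
  G = pathGraph p d
  to : Vertex G → Vertex (path n)
  to (x , x∈) with i , _ ← locate p x∈ = toℕ i , ∈-upTo⁺ (toℕ<n i)
  from : Vertex (path n) → Vertex G
  from (m , m∈) = _ , lookup-∈ p (fromℕ< (∈-upTo⁻ m∈))
  to∘from : ∀ v → to (from v) ≡ v
  to∘from (m , m∈) with i , eq ← locate p (lookup-∈ p (fromℕ< (∈-upTo⁻ m∈)))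
    with refl ← Distinct.lookup-injective d i _ eq = vertex-≡ (path n) (toℕ-fromℕ< _)
  from∘to : ∀ v → from (to v) ≡ v
  from∘to (x , x∈) with i , eq ← locate p x∈ =
    vertex-≡ G (trans (cong (Vec.lookup p) (fromℕ<-toℕ i (∈-upTo⁻ (∈-upTo⁺ (toℕ<n i))))) eq)
  adj⁺ : ∀ x y → G ⊢ proj₁ x ~ proj₁ y → path n ⊢ proj₁ (to x) ~ proj₁ (to y)
  adj⁺ (x , x∈) (y , y∈) e
    with i , eqᵢ ← locate p x∈ | j , eqⱼ ← locate p y∈ | i′ , j′ , l , r , c ← ∈-darts⁻ p e
    with refl ← Distinct.lookup-injective d i i′ (trans eqᵢ (sym l))
       | refl ← Distinct.lookup-injective d j j′ (trans eqⱼ (sym r))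
    with c
  ... | inj₁ q = inj₁ (q , toℕ<n j)
  ... | inj₂ q = inj₂ (q , toℕ<n i)
  adj⁻ : ∀ x y → path n ⊢ proj₁ (to x) ~ proj₁ (to y) → G ⊢ proj₁ x ~ proj₁ y
  adj⁻ (x , x∈) (y , y∈) c with locate p x∈ | locate p y∈
  adj⁻ _ _ (inj₁ (q , _)) | i , refl | j , refl = ∈-darts⁺ p i j (inj₁ q)
  adj⁻ _ _ (inj₂ (q , _)) | i , refl | j , refl = ∈-darts⁺ p i j (inj₂ q)

-- A partition of edges is expressed as a permutation of dart lists: decompositions then combine by
-- concatenation, and every regrouping of edges becomes an identity in a commutative monoid.
record Decomposition (k : ℕ) (E : List Dart) : Set where
  constructor decomposition
  field
    paths    : List (Vec ℕ k)
    distinct : All Distinct paths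
    covers   : concatMap darts paths ↭ E

open Decomposition public

unique-++⁻ : {A : Set} (xs : List A) {ys : List A} → Unique (xs ++ ys) → Unique ys × (∀ {e} → e ∈ xs → e ∉ ys)
unique-++⁻ []       u = u , λ ()
unique-++⁻ (x ∷ xs) (x∉ ∷ u) with w , f ← unique-++⁻ xs u = w , λ
  { (here refl) e∈ → All¬⇒¬Any x∉ (∈-++⁺ʳ xs e∈)
  ; (there e∈)     → f e∈ }

-- Supplies the uniqueness half of `partition`: in a list without repetitions a dart cannot come
-- from two blocks.
unique-concatMap : {A B : Set} (f : A → List B) {xs : List A} → Unique (concatMap f xs) →
  ∀ {e} (i j : Fin (length xs)) → e ∈ f (lookup xs i) → e ∈ f (lookup xs j) → i ≡ j
unique-concatMap f {x ∷ xs} u zero zero _ _ = refl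
unique-concatMap f {x ∷ xs} u zero (suc j) e e′ =
  ⊥-elim (proj₂ (unique-++⁻ (f x) u) e (∈-concat⁺′ e′ (∈-map⁺ f (∈-lookup {xs = xs} j))))
unique-concatMap f {x ∷ xs} u (suc i) zero e e′ =
  ⊥-elim (proj₂ (unique-++⁻ (f x) u) e′ (∈-concat⁺′ e (∈-map⁺ f (∈-lookup {xs = xs} i))))
unique-concatMap f {x ∷ xs} u (suc i) (suc j) e e′ =
  cong suc (unique-concatMap f {xs} (proj₁ (unique-++⁻ (f x) u)) i j e e′)

∈-concatMap : {A B : Set} (f : A → List B) {x : A} {xs : List A} {e : B} → x ∈ xs → e ∈ f x → e ∈ concatMap f xs
∈-concatMap f (here refl) e = ∈-++⁺ˡ e
∈-concatMap f (there {y} x∈) e = ∈-++⁺ʳ (f y) (∈-concatMap f x∈ e)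

-- With at least two vertices a path has no isolated vertex, so each vertex of a block lies on one
-- of its darts and hence in `V`.
designOf : {k : ℕ} {V : List ℕ} (u : Unique V) → Decomposition (2 + k) (complete V) →
  DesignOfOrder (length V) (path (2 + k))
designOf {k} {V} u D = record
  { K = completeGraph V u
  ; K-order = refl
  ; K-complete = λ x∈ y∈ x≢y → x∈ , y∈ , x≢y
  ; design = record
    { size = length (paths D)
    ; block = λ i → pathGraph (lookup (paths D) i) (All.lookup (distinct D) (∈-lookup i))
    ; block-⊑ = λ i → (λ x∈ → proj₁ (inside i (proj₂ (darts-total (lookup (paths D) i) x∈))))
        , λ e → proj₁ (inside i e) , proj₂ (inside i e)
            , darts-irreflexive (All.lookup (distinct D) (∈-lookup i)) e
    ; block-≅ = λ i → pathGraph-≅ _ _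
    ; partition = λ (x∈ , y∈ , x≢y) → unique! (∈-concatMap⁻ darts (∈-resp-↭ (↭-sym (covers D)) (∈-complete⁺ x∈ y∈ x≢y)))
    }
  }
  where
  inside : ∀ i {x y} → (x , y) ∈ darts (lookup (paths D) i) → x ∈ V × y ∈ V
  inside i e = ∈-complete⁻ V (∈-resp-↭ (covers D) (∈-concatMap darts (∈-lookup {xs = paths D} i) e))
  unique! : ∀ {e} → Any (λ p → e ∈ darts p) (paths D) → ∃! _≡_ (λ i → e ∈ darts (lookup (paths D) i))
  unique! e = index e , lookup-index e ,
    unique-concatMap darts {paths D} (unique-↭ (↭-sym (covers D)) (complete-unique u)) _ _ (lookup-index e)

-- A block of a given design is known only up to isomorphism; the walk makes it concrete, with the
-- same vertices and the same edges.
record PathIn (G : Graph) (k : ℕ) : Set where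
  field
    walk          : Vec ℕ k
    walk-distinct : Distinct walk
    vertices⁺     : toList walk ⊆ₗ vertices G
    vertices⁻     : vertices G ⊆ₗ toList walk
    edges⁺        : ∀ {x y} → (x , y) ∈ darts walk → G ⊢ x ~ y
    edges⁻        : ∀ {x y} → G ⊢ x ~ y → (x , y) ∈ darts walk

open PathIn public

pathIn : {k : ℕ} (G : Graph) → G ≅ path k → PathIn G k
pathIn {k} G iso = record
  { walk = w
  ; walk-distinct = Distinct.tabulate⁺ λ {i} {j} eq → toℕ-injective
      (trans (sym (cong proj₁ (strictlyInverseˡ (ix i))))
        (trans (cong (proj₁ ∘ to) (vertex-≡ G eq)) (cong proj₁ (strictlyInverseˡ (ix j)))))
  ; vertices⁺ = λ x∈ → v⁺ (locate w x∈)
  ; vertices⁻ = λ x∈ → subst (_∈ toList w) (at (_ , x∈)) (lookup-∈ w (pos (_ , x∈)))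
  ; edges⁺ = λ e → e⁺ (∈-darts⁻ w e)
  ; edges⁻ = λ {x} {y} e → e⁻ (x , Graph.~⇒∈ G e) (y , Graph.~⇒∈ G (Graph.~-sym G e)) e
  }
  where
  open _≅_ iso using (bijection; adjacency; to)
  open Inverse bijection using (from; strictlyInverseˡ; strictlyInverseʳ)
  ix : Fin k → Vertex (path k)
  ix i = toℕ i , ∈-upTo⁺ (toℕ<n i)
  w = Vec.tabulate (proj₁ ∘ from ∘ ix)
  v⁺ : ∀ {x} → (∃ λ i → Vec.lookup w i ≡ x) → x ∈ vertices G
  v⁺ (i , refl) rewrite lookup∘tabulate (proj₁ ∘ from ∘ ix) i = proj₂ (from (ix i))
  pos : Vertex G → Fin k
  pos v = fromℕ< (∈-upTo⁻ (proj₂ (to v)))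
  ix-pos : ∀ v → ix (pos v) ≡ to v
  ix-pos v = vertex-≡ (path k) (toℕ-fromℕ< _)
  at : ∀ v → Vec.lookup w (pos v) ≡ proj₁ v
  at v = trans (lookup∘tabulate (proj₁ ∘ from ∘ ix) (pos v))
    (cong proj₁ (trans (cong from (ix-pos v)) (strictlyInverseʳ v)))
  step : ∀ {i j} → Consecutive i j → path k ⊢ toℕ i ~ toℕ j
  step {i} {j} (inj₁ e) = inj₁ (e , toℕ<n j)
  step {i} {j} (inj₂ e) = inj₂ (e , toℕ<n i)
  step⁻ : ∀ {m n} → path k ⊢ m ~ n → suc m ≡ n ⊎ suc n ≡ m
  step⁻ (inj₁ (e , _)) = inj₁ e
  step⁻ (inj₂ (e , _)) = inj₂ e
  e⁺ : ∀ {x y} → (∃₂ λ i j → Vec.lookup w i ≡ x × Vec.lookup w j ≡ y × Consecutive i j) → G ⊢ x ~ y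
  e⁺ (i , j , refl , refl , c)
    rewrite lookup∘tabulate (proj₁ ∘ from ∘ ix) i | lookup∘tabulate (proj₁ ∘ from ∘ ix) j =
    Equivalence.from (adjacency (from (ix i)) (from (ix j)))
      (subst₂ (path k ⊢_~_) (cong proj₁ (sym (strictlyInverseˡ (ix i)))) (cong proj₁ (sym (strictlyInverseˡ (ix j))))
        (step c))
  e⁻ : ∀ a b → G ⊢ proj₁ a ~ proj₁ b → (proj₁ a , proj₁ b) ∈ darts w
  e⁻ a b e = subst₂ (λ x y → (x , y) ∈ darts w) (at a) (at b) (∈-darts⁺ w (pos a) (pos b)
    (subst₂ (λ m n → suc m ≡ n ⊎ suc n ≡ m) (sym (toℕ-fromℕ< _)) (sym (toℕ-fromℕ< _))
      (step⁻ (Equivalence.to (adjacency a b) e))))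

module Extract {v k : ℕ} (𝓑 : DesignOfOrder v (path k)) where
  open DesignOfOrder 𝓑 public
  open Design design public

  pathOf : ∀ i → PathIn (block i) k
  pathOf i = pathIn (block i) (block-≅ i)

  V : List ℕ
  V = vertices K

  -- Converse of `designOf`. Both dart lists are free of repetitions, so it is enough to compare
  -- them as sets. The walks stay in the order of the block indices.
  decomposed : Decomposition k (complete V)
  decomposed = decomposition (tabulate (walk ∘ pathOf)) (All.tabulate⁺ (walk-distinct ∘ pathOf))
    (unique-set⇒↭ unique (complete-unique (Graph.unique K)) inside outside)
    where
    unique : Unique (concatMap darts (tabulate (walk ∘ pathOf)))
    unique = Unique.concat⁺ (All.map⁺ (All.tabulate⁺ (darts-unique ∘ walk-distinct ∘ pathOf)))
      (AllPairs.map⁺ (AllPairs.tabulate⁺ λ i≢j {e} (e∈ , e∈′) → i≢j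
        (let i , _ , same = partition (proj₂ (block-⊑ _) (edges⁺ (pathOf _) e∈))
         in trans (sym (same (edges⁺ (pathOf _) e∈))) (same (edges⁺ (pathOf _) e∈′)))))
    inside : concatMap darts (tabulate (walk ∘ pathOf)) ⊆ₗ complete V
    inside e with i , e∈ ← tabulate⁻ (∈-concatMap⁻ darts e)
      with e′ ← proj₂ (block-⊑ i) (edges⁺ (pathOf i) e∈) =
      ∈-complete⁺ (Graph.~⇒∈ K e′) (Graph.~⇒∈ K (Graph.~-sym K e′)) (λ eq → Graph.~-irrefl K eq e′)
    outside : complete V ⊆ₗ concatMap darts (tabulate (walk ∘ pathOf))
    outside {x , y} e with x∈ , y∈ ← ∈-complete⁻ V e
      with i , e∈ , _ ← partition (K-complete x∈ y∈ λ { refl → complete-irreflexive V (Graph.unique K) e }) =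
      ∈-concatMap⁺ darts (tabulate⁺ i (edges⁻ (pathOf i) e∈))

downLinked : {v n : ℕ} (𝓑 : DesignOfOrder v (path 5)) {N : List ℕ} → length N ≡ n → (u : Unique N) (D : Decomposition 4 (complete N)) →
  (let open DesignOfOrder 𝓑; open Design design) →
  (∀ i → ∃ λ q → q ∈ paths D × toList q ⊆ₗ vertices (block i) × (∀ {x y} → (x , y) ∈ darts q → block i ⊢ x ~ y)) →
  DownLinkedTo-P₄ 𝓑 n
downLinked 𝓑 refl u D links = designOf u D , (λ i → index (proj₁ (proj₂ (links i)))) , sub
  where
  sub : ∀ i → Design.block (DesignOfOrder.design (designOf u D)) (index (proj₁ (proj₂ (links i))))
    ⊑ Design.block (DesignOfOrder.design 𝓑) i
  sub i with q , q∈ , vs , es ← links i =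
    (λ {x} x∈ → vs (subst (λ p → x ∈ toList p) (sym (lookup-index q∈)) x∈)) ,
    (λ {x} {y} e → es (subst (λ p → (x , y) ∈ darts p) (sym (lookup-index q∈)) e))

-- Greedy packing of paths on four vertices

infixr 5 _⊕_
_⊕_ : ∀ {k E F} → Decomposition k E → Decomposition k F → Decomposition k (E ++ F)
D ⊕ D′ = decomposition (paths D ++ paths D′) (All.++⁺ (distinct D) (distinct D′))
  (subst (_↭ _) (sym (concatMap-++ darts (paths D) (paths D′))) (++⁺ (covers D) (covers D′)))

recover : ∀ {k E F} → E ↭ F → Decomposition k E → Decomposition k F
recover p D = decomposition (paths D) (distinct D) (↭-trans (covers D) p)

empty : ∀ {k} → Decomposition k []
empty = decomposition [] [] ↭-refl

single : ∀ {k} {p : Vec ℕ k} → Distinct p → Decomposition k (darts p)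
single {p = p} d = decomposition (p ∷ []) (d ∷ []) (↭-reflexive (++-identityʳ (darts p)))

remove : (e : Dart) (es : List Dart) → Maybe (∃ λ fs → es ↭ e ∷ fs)
remove e []       = nothing
remove e (f ∷ es) with ≡-dec _≟_ _≟_ f e
... | yes refl = just (es , ↭-refl)
... | no _     = Maybe.map (λ (fs , p) → f ∷ fs , ↭-trans (Perm.prep f p) (Perm.swap f e ↭-refl)) (remove e es)

-- Failure carries no certificate: the uses are on closed lists for which evaluation arrives at
-- `just`.
permutation? : (es fs : List Dart) → Maybe (es ↭ fs)
permutation? []       []      = just ↭-refl
permutation? []       (_ ∷ _) = nothing
permutation? (e ∷ es) fs with remove e fs
... | nothing        = nothing
... | just (gs , p) = Maybe.map (λ q → ↭-trans (Perm.prep e q) (↭-sym p)) (permutation? es gs)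

nth : List ℕ → ℕ → ℕ
-- A dummy value; every position that occurs below lies within its list.
nth []       _       = 0
nth (v ∷ _)  zero    = v
nth (_ ∷ vs) (suc i) = nth vs i

relabelDart : List ℕ → Dart → Dart
relabelDart vs (i , j) = nth vs i , nth vs j

-- Equality of darts computes on numerals but not on variables. Identities between small edge lists
-- are therefore checked on numerals and transported to the vertices `vs`; the images unfold to the
-- lists wanted.
relabel : (vs : List ℕ) (es fs : List Dart) → {Holds (is-just (permutation? es fs))} →
  map (relabelDart vs) es ↭ map (relabelDart vs) fs
relabel vs es fs {t} with just p ← permutation? es fs = map⁺ (relabelDart vs) p

distinct₄ : {a b c d : ℕ} → a ≢ b → a ≢ c → a ≢ d → b ≢ c → b ≢ d → c ≢ d → Distinct (a ∷ b ∷ c ∷ d ∷ [])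
distinct₄ ab ac ad bc bd cd = unique⇒distinct ((ab ∷ ac ∷ ad ∷ []) ∷ (bc ∷ bd ∷ []) ∷ (cd ∷ []) ∷ [] ∷ [])

concatMap-↭ : {A B : Set} (f : A → List B) {xs ys : List A} → xs ↭ ys → concatMap f xs ↭ concatMap f ys
concatMap-↭ f Perm.refl = ↭-refl
concatMap-↭ f (Perm.prep x p) = ++⁺ˡ (f x) (concatMap-↭ f p)
concatMap-↭ f (Perm.swap {xs} {ys} x y p) = ↭-trans (++⁺ˡ (f x) (++⁺ˡ (f y) (concatMap-↭ f p)))
  (solve 3 (λ a b c → a ∙ (b ∙ c) ⊜ b ∙ (a ∙ c)) ↭-refl (f x) (f y) (concatMap f ys))
concatMap-↭ f (Perm.trans p q) = ↭-trans (concatMap-↭ f p) (concatMap-↭ f q)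

-- In a graph without a path on four vertices every component is a star (possibly a single vertex) or a triangle.
record Components : Set where
  constructor components
  field
    stars     : List (ℕ × List ℕ)
    triangles : List (ℕ × ℕ × ℕ)

open Components

starVertices : ℕ × List ℕ → List ℕ
starVertices (c , ls) = c ∷ ls

starDarts : ℕ × List ℕ → List Dart
starDarts (c , ls) = star c ls

triangleVertices : ℕ × ℕ × ℕ → List ℕ
triangleVertices (p , q , r) = p ∷ q ∷ r ∷ []

triangleDarts : ℕ × ℕ × ℕ → List Dart
triangleDarts t = complete (triangleVertices t)

verticesOf : Components → List ℕ
verticesOf C = concatMap starVertices (stars C) ++ concatMap triangleVertices (triangles C)

dartsOf : Components → List Dart
dartsOf C = concatMap starDarts (stars C) ++ concatMap triangleDarts (triangles C)

addStars : List (ℕ × List ℕ) → Components → Components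
addStars ss C = components (ss ++ stars C) (triangles C)

addTriangle : ℕ → ℕ → ℕ → Components → Components
addTriangle p q r C = components (stars C) ((p , q , r) ∷ triangles C)

concatMap-++-++ : {A B : Set} (f : A → List B) (xs ys : List A) (zs : List B) →
  concatMap f (xs ++ ys) ++ zs ≡ concatMap f xs ++ concatMap f ys ++ zs
concatMap-++-++ f xs ys zs = trans (cong (_++ zs) (concatMap-++ f xs ys)) (++-assoc (concatMap f xs) (concatMap f ys) zs)

vertices-addStars : ∀ ss C → verticesOf (addStars ss C) ≡ concatMap starVertices ss ++ verticesOf C
vertices-addStars ss C = concatMap-++-++ starVertices ss (stars C) _

darts-addStars : ∀ ss C → dartsOf (addStars ss C) ≡ concatMap starDarts ss ++ dartsOf C
darts-addStars ss C = concatMap-++-++ starDarts ss (stars C) _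

vertices-addTriangle : ∀ p q r C → verticesOf (addTriangle p q r C) ↭ p ∷ q ∷ r ∷ verticesOf C
vertices-addTriangle p q r C = solve 3 (λ b d e → b ∙ (d ∙ e) ⊜ d ∙ (b ∙ e)) ↭-refl
  (concatMap starVertices (stars C)) (p ∷ q ∷ r ∷ []) (concatMap triangleVertices (triangles C))

darts-addTriangle : ∀ p q r C → dartsOf (addTriangle p q r C) ↭ complete (p ∷ q ∷ r ∷ []) ++ dartsOf C
darts-addTriangle p q r C = solve 3 (λ b d e → b ∙ (d ∙ e) ⊜ d ∙ (b ∙ e)) ↭-refl
  (concatMap starDarts (stars C)) (complete (p ∷ q ∷ r ∷ [])) (concatMap triangleDarts (triangles C))

-- A star with a single leaf can be centred at either end, which is why `leaf` comes with a second
-- leaf `z`.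
data View (x : ℕ) (C : Components) : Set where
  center : ∀ ls C′ → verticesOf C ↭ x ∷ ls ++ verticesOf C′ → dartsOf C ↭ star x ls ++ dartsOf C′ → View x C
  leaf   : ∀ c z ls C′ → verticesOf C ↭ c ∷ x ∷ z ∷ ls ++ verticesOf C′ →
           dartsOf C ↭ star c (x ∷ z ∷ ls) ++ dartsOf C′ → View x C
  corner : ∀ p q C′ → verticesOf C ↭ x ∷ p ∷ q ∷ verticesOf C′ →
           dartsOf C ↭ complete (x ∷ p ∷ q ∷ []) ++ dartsOf C′ → View x C

view : ∀ {x} C → x ∈ verticesOf C → View x C
view {x} C x∈ with ∈-++⁻ (concatMap starVertices (stars C)) x∈
... | inj₁ x∈′ = inStar (find (∈-concatMap⁻ starVertices x∈′))
  where
  inStar : (∃ λ s → s ∈ stars C × x ∈ starVertices s) → View x C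
  inStar ((c , ls) , s∈ , x∈s) with ss , p ← ∈⇒↭ s∈ = at x∈s
    where
    C′ = components ss (triangles C)
    vs : verticesOf C ↭ c ∷ ls ++ verticesOf C′
    vs = ↭-trans (++⁺ʳ _ (concatMap-↭ starVertices p)) (↭-reflexive (cong (c ∷_) (++-assoc ls _ _)))
    es : dartsOf C ↭ star c ls ++ dartsOf C′
    es = ↭-trans (++⁺ʳ _ (concatMap-↭ starDarts p)) (↭-reflexive (++-assoc (star c ls) _ _))
    at : x ∈ c ∷ ls → View x C
    at (here refl) = center ls C′ vs es
    at (there x∈ls) with ∈⇒↭ x∈ls
    ... | [] , q = center [ c ] C′
      (↭-trans vs (↭-trans (++⁺ʳ (verticesOf C′) (Perm.prep c q)) (Perm.swap c x ↭-refl)))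
      (↭-trans es (↭-trans (++⁺ʳ (dartsOf C′) (star-↭ c q)) (Perm.swap (c , x) (x , c) ↭-refl)))
    ... | z ∷ ls′ , q = leaf c z ls′ C′ (↭-trans vs (++⁺ʳ (verticesOf C′) (Perm.prep c q)))
      (↭-trans es (++⁺ʳ (dartsOf C′) (star-↭ c q)))
... | inj₂ x∈′ = inTriangle (find (∈-concatMap⁻ triangleVertices x∈′))
  where
  inTriangle : (∃ λ t → t ∈ triangles C × x ∈ triangleVertices t) → View x C
  inTriangle ((p , q , r) , t∈ , x∈t) with ts , π ← ∈⇒↭ t∈ = at x∈t
    where
    C′ = components (stars C) ts
    vs : verticesOf C ↭ p ∷ q ∷ r ∷ verticesOf C′
    vs = ↭-trans (++⁺ˡ _ (concatMap-↭ triangleVertices π)) (vertices-addTriangle p q r C′)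
    es : dartsOf C ↭ complete (p ∷ q ∷ r ∷ []) ++ dartsOf C′
    es = ↭-trans (++⁺ˡ _ (concatMap-↭ triangleDarts π)) (darts-addTriangle p q r C′)
    rotated : ∀ y z → p ∷ q ∷ r ∷ [] ↭ x ∷ y ∷ z ∷ [] → View x C
    rotated y z σ = corner y z C′ (↭-trans vs (++⁺ʳ (verticesOf C′) σ))
      (↭-trans es (++⁺ʳ (dartsOf C′) (complete-↭ σ)))
    at : x ∈ p ∷ q ∷ r ∷ [] → View x C
    at (here refl) = rotated q r ↭-refl
    at (there (here refl)) = rotated p r (Perm.swap p q ↭-refl)
    at (there (there (here refl))) = rotated p q (shift r (p ∷ q ∷ []) [])

-- One step of the greedy packing: the edge `x y` either joins the components or completes a path,
-- which moves to `new`. Vertices cut off by that path stay behind as stars without leaves, so the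
-- vertices do not change.
record Inserted (x y : ℕ) (C : Components) : Set where
  constructor inserted
  field
    result       : Components
    new          : List (Vec ℕ 4)
    new-distinct : All Distinct new
    same         : verticesOf result ↭ verticesOf C
    more         : dartsOf result ++ concatMap darts new ↭ (x , y) ∷ (y , x) ∷ dartsOf C

turn : ∀ {x y C} → Inserted x y C → Inserted y x C
turn (inserted C′ ps d vs es) = inserted C′ ps d vs (↭-trans es (Perm.swap _ _ ↭-refl))

-- The path `y x p q` is split off, and `x q` is all that remains of the triangle. Since `x y` is a
-- new edge, `y` differs from `p` and `q`.
insertAtCorner : ∀ {x y C} p q C′ → x ≢ y → (x , y) ∉ dartsOf C → Unique (verticesOf C) →
  verticesOf C ↭ x ∷ p ∷ q ∷ verticesOf C′ → dartsOf C ↭ complete (x ∷ p ∷ q ∷ []) ++ dartsOf C′ → Inserted x y C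
insertAtCorner {x} {y} {C} p q C′ x≢y e∉ u vs es
  with (x≢p ∷ x≢q ∷ _) ∷ (p≢q ∷ _) ∷ _ ← unique-↭ vs u =
  inserted (addStars ss C′) ((y ∷ x ∷ p ∷ q ∷ []) ∷ [])
    (distinct₄ (≢-sym x≢y)
      (λ { refl → e∉ (∈-resp-↭ (↭-sym es) (here refl)) })
      (λ { refl → e∉ (∈-resp-↭ (↭-sym es) (there (there (here refl)))) })
      x≢p x≢q p≢q ∷ [])
    (↭-trans (↭-reflexive (vertices-addStars ss C′)) (↭-trans (Perm.prep x (Perm.swap q p ↭-refl)) (↭-sym vs)))
    (↭-trans (++⁺ʳ _ (↭-reflexive (darts-addStars ss C′)))
      (↭-trans (solve 5 (λ xq r xp yx pq → (xq ∙ r) ∙ (yx ∙ (xp ∙ pq)) ⊜ yx ∙ ((xp ∙ (xq ∙ pq)) ∙ r)) ↭-refl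
        (darts (x ∷ q ∷ [])) (dartsOf C′) (darts (x ∷ p ∷ [])) (darts (y ∷ x ∷ [])) (darts (p ∷ q ∷ [])))
      (↭-trans (Perm.swap _ _ ↭-refl) (Perm.prep _ (Perm.prep _ (↭-sym es))))))
  where
  ss = (x , [ q ]) ∷ (p , []) ∷ []

-- In general the path `y x c z` is split off. This fails for `y = z`: then the star closes to a
-- triangle if it has no further leaf, and otherwise a third leaf `t` gives the path `z x c t`.
insertAtLeaf : ∀ {x y C} c z ls C′ → x ≢ y → (x , y) ∉ dartsOf C → Unique (verticesOf C) →
  verticesOf C ↭ c ∷ x ∷ z ∷ ls ++ verticesOf C′ → dartsOf C ↭ star c (x ∷ z ∷ ls) ++ dartsOf C′ → Inserted x y C
insertAtLeaf {x} {y} {C} c z ls C′ x≢y e∉ u vs es with y ≟ z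
insertAtLeaf {x} {y} {C} c z [] C′ x≢y e∉ u vs es | yes refl =
  inserted (addTriangle c x z C′) [] []
    (↭-trans (vertices-addTriangle c x z C′) (↭-sym vs))
    (↭-trans (++⁺ʳ [] (darts-addTriangle c x z C′))
      (↭-trans (solve 3 (λ cs xz r → ((cs ∙ xz) ∙ r) ∙ ε ⊜ xz ∙ (cs ∙ r)) ↭-refl
        (star c (x ∷ z ∷ [])) (darts (x ∷ z ∷ [])) (dartsOf C′))
      (Perm.prep _ (Perm.prep _ (↭-sym es)))))
insertAtLeaf {x} {y} {C} c z (t ∷ ls) C′ x≢y e∉ u vs es | yes refl
  with (c≢x ∷ c≢z ∷ c≢t ∷ _) ∷ (x≢z ∷ x≢t ∷ _) ∷ (z≢t ∷ _) ∷ _ ← unique-↭ vs u =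
  inserted (addStars ss C′) ((z ∷ x ∷ c ∷ t ∷ []) ∷ [])
    (distinct₄ (≢-sym x≢z) (≢-sym c≢z) z≢t (≢-sym c≢x) x≢t c≢t ∷ [])
    (↭-trans (↭-reflexive (vertices-addStars ss C′))
      (↭-trans (solve 6 (λ c z ls x t r → (c ∙ (z ∙ (ls ∙ (x ∙ t)))) ∙ r ⊜ c ∙ (x ∙ (z ∙ (t ∙ (ls ∙ r))))) ↭-refl
        [ c ] [ z ] ls [ x ] [ t ] (verticesOf C′))
      (↭-sym vs)))
    (↭-trans (++⁺ʳ _ (↭-reflexive (darts-addStars ss C′)))
      (↭-trans (solve 9 (λ cz s r zx xz xc cx ct tc →
          (((cz ∙ s) ∙ ε) ∙ r) ∙ (zx ∙ (xz ∙ (xc ∙ (cx ∙ (ct ∙ tc)))))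
          ⊜ xz ∙ (zx ∙ ((cx ∙ (xc ∙ (cz ∙ (ct ∙ (tc ∙ s))))) ∙ r))) ↭-refl
        (darts (c ∷ z ∷ [])) (star c ls) (dartsOf C′)
        [ (z , x) ] [ (x , z) ] [ (x , c) ] [ (c , x) ] [ (c , t) ] [ (t , c) ])
      (Perm.prep _ (Perm.prep _ (↭-sym es)))))
  where
  ss = (c , z ∷ ls) ∷ (x , []) ∷ (t , []) ∷ []
insertAtLeaf {x} {y} {C} c z ls C′ x≢y e∉ u vs es | no y≢z
  with (c≢x ∷ c≢z ∷ _) ∷ (x≢z ∷ _) ∷ _ ← unique-↭ vs u =
  inserted (addStars ss C′) ((y ∷ x ∷ c ∷ z ∷ []) ∷ [])
    (distinct₄ (≢-sym x≢y) (λ { refl → e∉ (∈-resp-↭ (↭-sym es) (there (here refl))) }) y≢z (≢-sym c≢x) x≢z c≢z ∷ [])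
    (↭-trans (↭-reflexive (vertices-addStars ss C′))
      (↭-trans (solve 5 (λ c z ls x r → (c ∙ (ls ∙ (x ∙ z))) ∙ r ⊜ c ∙ (x ∙ (z ∙ (ls ∙ r)))) ↭-refl
        [ c ] [ z ] ls [ x ] (verticesOf C′))
      (↭-sym vs)))
    (↭-trans (++⁺ʳ _ (↭-reflexive (darts-addStars ss C′)))
      (↭-trans (solve 7 (λ s r yx xy xc cx cz →
          ((s ∙ ε) ∙ r) ∙ (yx ∙ (xy ∙ (xc ∙ (cx ∙ cz))))
          ⊜ xy ∙ (yx ∙ ((cx ∙ (xc ∙ (cz ∙ s))) ∙ r))) ↭-refl
        (star c ls) (dartsOf C′)
        [ (y , x) ] [ (x , y) ] [ (x , c) ] [ (c , x) ] (darts (c ∷ z ∷ [])))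
      (Perm.prep _ (Perm.prep _ (↭-sym es)))))
  where
  ss = (c , ls) ∷ (x , []) ∷ (z , []) ∷ []

bringLeavesForward : (x l : ℕ) (ls : List ℕ) (y m : ℕ) (ms r : List ℕ) →
  x ∷ l ∷ ls ++ y ∷ m ∷ ms ++ r ↭ x ∷ l ∷ y ∷ m ∷ ls ++ ms ++ r
bringLeavesForward x l ls y m ms r =
  solve 7 (λ x l ls y m ms r → x ∙ (l ∙ (ls ∙ (y ∙ (m ∙ (ms ∙ r))))) ⊜ x ∙ (l ∙ (y ∙ (m ∙ (ls ∙ (ms ∙ r))))))
    ↭-refl [ x ] [ l ] ls [ y ] [ m ] ms r

-- A centre without leaves becomes a leaf of the other star. If both centres have leaves, the path
-- `l x y m` is split off.
insertCenters : ∀ {x y C} ls ms C′ → Unique (verticesOf C) →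
  verticesOf C ↭ x ∷ ls ++ y ∷ ms ++ verticesOf C′ → dartsOf C ↭ star x ls ++ star y ms ++ dartsOf C′ → Inserted x y C
insertCenters {x} {y} {C} [] ms C′ u vs es =
  inserted (addStars ss C′) [] []
    (↭-trans (↭-reflexive (vertices-addStars ss C′))
      (↭-trans (solve 4 (λ x y ms r → (y ∙ (x ∙ ms) ∙ ε) ∙ r ⊜ x ∙ (y ∙ (ms ∙ r))) ↭-refl
        [ x ] [ y ] ms (verticesOf C′))
      (↭-sym vs)))
    (↭-trans (++⁺ʳ _ (↭-reflexive (darts-addStars ss C′)))
      (↭-trans (solve 4 (λ yx xy s r → (((yx ∙ (xy ∙ s)) ∙ ε) ∙ r) ∙ ε ⊜ xy ∙ (yx ∙ (s ∙ r))) ↭-refl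
        [ (y , x) ] [ (x , y) ] (star y ms) (dartsOf C′))
      (Perm.prep _ (Perm.prep _ (↭-sym es)))))
  where
  ss = (y , x ∷ ms) ∷ []
insertCenters {x} {y} {C} (l ∷ ls) [] C′ u vs es =
  inserted (addStars ss C′) [] []
    (↭-trans (↭-reflexive (vertices-addStars ss C′))
      (↭-trans (solve 5 (λ x y l ls r → (x ∙ (y ∙ (l ∙ ls)) ∙ ε) ∙ r ⊜ x ∙ (l ∙ (ls ∙ (y ∙ r)))) ↭-refl
        [ x ] [ y ] [ l ] ls (verticesOf C′))
      (↭-sym vs)))
    (↭-trans (++⁺ʳ _ (↭-reflexive (darts-addStars ss C′)))
      (↭-trans (solve 4 (λ xy yx s r → (((xy ∙ (yx ∙ s)) ∙ ε) ∙ r) ∙ ε ⊜ xy ∙ (yx ∙ (s ∙ r))) ↭-refl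
        [ (x , y) ] [ (y , x) ] (star x (l ∷ ls)) (dartsOf C′))
      (Perm.prep _ (Perm.prep _ (↭-sym es)))))
  where
  ss = (x , y ∷ l ∷ ls) ∷ []
insertCenters {x} {y} {C} (l ∷ ls) (m ∷ ms) C′ u vs es
  with (x≢l ∷ x≢y ∷ x≢m ∷ _) ∷ (l≢y ∷ l≢m ∷ _) ∷ (y≢m ∷ _) ∷ _ ← unique-↭ (↭-trans vs (bringLeavesForward x l ls y m ms (verticesOf C′))) u =
  inserted (addStars ss C′) ((l ∷ x ∷ y ∷ m ∷ []) ∷ [])
    (distinct₄ (≢-sym x≢l) l≢y l≢m x≢y x≢m y≢m ∷ [])
    (↭-trans (↭-reflexive (vertices-addStars ss C′))
      (↭-trans (solve 7 (λ x ls y ms l m r → (x ∙ (ls ∙ (y ∙ (ms ∙ (l ∙ m))))) ∙ r ⊜ x ∙ (l ∙ (y ∙ (m ∙ (ls ∙ (ms ∙ r)))))) ↭-refl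
        [ x ] ls [ y ] ms [ l ] [ m ] (verticesOf C′))
      (↭-sym (↭-trans vs (bringLeavesForward x l ls y m ms (verticesOf C′))))))
    (↭-trans (++⁺ʳ _ (↭-reflexive (darts-addStars ss C′)))
      (↭-trans (solve 7 (λ s s′ r lx xl xy ym →
          ((s ∙ (s′ ∙ ε)) ∙ r) ∙ ((lx ∙ xl) ∙ (xy ∙ ym))
          ⊜ xy ∙ ((xl ∙ (lx ∙ s)) ∙ ((ym ∙ s′) ∙ r))) ↭-refl
        (star x ls) (star y ms) (dartsOf C′)
        [ (l , x) ] [ (x , l) ] (darts (x ∷ y ∷ [])) (darts (y ∷ m ∷ [])))
      (Perm.prep _ (Perm.prep _ (↭-sym es)))))
  where
  ss = (x , ls) ∷ (y , ms) ∷ (l , []) ∷ (m , []) ∷ []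

-- When `y` is a leaf or a corner, `x` and `y` exchange roles and the star of `x` is put back among
-- the other components.
insertAtCenter : ∀ {x y C} ls C′ → x ≢ y → (y , x) ∉ dartsOf C → Unique (verticesOf C) →
  verticesOf C ↭ x ∷ ls ++ verticesOf C′ → dartsOf C ↭ star x ls ++ dartsOf C′ → View y C′ → Inserted x y C
insertAtCenter {x} {y} {C} ls C′ x≢y e∉ u vs es (center ms C″ vs′ es′) =
  insertCenters ls ms C″ u (↭-trans vs (Perm.prep x (++⁺ˡ ls vs′))) (↭-trans es (++⁺ˡ (star x ls) es′))
insertAtCenter {x} {y} {C} ls C′ x≢y e∉ u vs es (leaf c z ms C″ vs′ es′) =
  turn (insertAtLeaf c z ms (addStars [ (x , ls) ] C″) (≢-sym x≢y) e∉ u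
    (↭-trans vs (↭-trans (Perm.prep x (++⁺ˡ ls vs′)) (↭-trans
      (solve 4 (λ a b c d → a ∙ (b ∙ (c ∙ d)) ⊜ c ∙ ((a ∙ b ∙ ε) ∙ d)) ↭-refl [ x ] ls (c ∷ y ∷ z ∷ ms) (verticesOf C″))
      (↭-sym (++⁺ˡ (c ∷ y ∷ z ∷ ms) (↭-reflexive (vertices-addStars [ (x , ls) ] C″)))))))
    (↭-trans es (↭-trans (++⁺ˡ (star x ls) es′) (↭-trans
      (solve 3 (λ b c d → b ∙ (c ∙ d) ⊜ c ∙ ((b ∙ ε) ∙ d)) ↭-refl (star x ls) (star c (y ∷ z ∷ ms)) (dartsOf C″))
      (↭-sym (++⁺ˡ (star c (y ∷ z ∷ ms)) (↭-reflexive (darts-addStars [ (x , ls) ] C″))))))))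
insertAtCenter {x} {y} {C} ls C′ x≢y e∉ u vs es (corner p q C″ vs′ es′) =
  turn (insertAtCorner p q (addStars [ (x , ls) ] C″) (≢-sym x≢y) e∉ u
    (↭-trans vs (↭-trans (Perm.prep x (++⁺ˡ ls vs′)) (↭-trans
      (solve 4 (λ a b c d → a ∙ (b ∙ (c ∙ d)) ⊜ c ∙ ((a ∙ b ∙ ε) ∙ d)) ↭-refl [ x ] ls (y ∷ p ∷ q ∷ []) (verticesOf C″))
      (↭-sym (++⁺ˡ (y ∷ p ∷ q ∷ []) (↭-reflexive (vertices-addStars [ (x , ls) ] C″)))))))
    (↭-trans es (↭-trans (++⁺ˡ (star x ls) es′) (↭-trans
      (solve 3 (λ b c d → b ∙ (c ∙ d) ⊜ c ∙ ((b ∙ ε) ∙ d)) ↭-refl (star x ls) (complete (y ∷ p ∷ q ∷ [])) (dartsOf C″))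
      (↭-sym (++⁺ˡ (complete (y ∷ p ∷ q ∷ [])) (↭-reflexive (darts-addStars [ (x , ls) ] C″))))))))

insert : ∀ {x y} C → x ∈ verticesOf C → y ∈ verticesOf C → x ≢ y → (x , y) ∉ dartsOf C → (y , x) ∉ dartsOf C →
  Unique (verticesOf C) → Inserted x y C
insert {x} {y} C x∈ y∈ x≢y e∉ e∉′ u with view C x∈
... | corner p q C′ vs es = insertAtCorner p q C′ x≢y e∉ u vs es
... | leaf c z ls C′ vs es = insertAtLeaf c z ls C′ x≢y e∉ u vs es
... | center ls C′ vs es = insertAtCenter ls C′ x≢y e∉′ u vs es (view C′ (elsewhere (∈-resp-↭ vs y∈)))
  where
  elsewhere : y ∈ x ∷ ls ++ verticesOf C′ → y ∈ verticesOf C′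
  elsewhere (here refl) = ⊥-elim (x≢y refl)
  elsewhere (there y∈′) with ∈-++⁻ ls y∈′
  ... | inj₁ y∈ls = ⊥-elim (e∉ (∈-resp-↭ (↭-sym es) (∈-++⁺ˡ (proj₁ (∈-star⁺ y∈ls)))))
  ... | inj₂ y∈C′ = y∈C′

both : List Dart → List Dart
both []            = []
both ((x , y) ∷ L) = (x , y) ∷ (y , x) ∷ both L

record Leftover (U : List ℕ) (E : List Dart) : Set where
  constructor leftover
  field
    parts  : Components
    packed : List (Vec ℕ 4)
    packed-distinct : All Distinct packed
    spans  : verticesOf parts ↭ U
    joint  : dartsOf parts ++ concatMap darts packed ↭ E

pack : ∀ {U} L → Unique U → Unique (both L) → (∀ {x y} → (x , y) ∈ L → x ∈ U × y ∈ U) → Leftover U (both L)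
-- Before any edge is inserted, each vertex is a star without leaves.
pack {U} [] u _ _ = leftover (components (map (_, []) U) []) [] []
  (↭-reflexive (trans (++-identityʳ _) (vs U))) (↭-reflexive (trans (++-identityʳ _) (trans (++-identityʳ _) (es U))))
  where
  vs : ∀ U → concatMap starVertices (map (_, []) U) ≡ U
  vs [] = refl
  vs (x ∷ U) = cong (x ∷_) (vs U)
  es : ∀ U → concatMap starDarts (map (_, []) U) ≡ []
  es [] = refl
  es (x ∷ U) = es U
pack {U} ((x , y) ∷ L) u (e≢ ∷ e′≢ ∷ w) L⊆
  with leftover C ps ds vs es ← pack L u w (L⊆ ∘ there)
  with x∈ , y∈ ← L⊆ (here refl)
  with inserted C′ qs ds′ vs′ es′ ← insert C (∈-resp-↭ (↭-sym vs) x∈) (∈-resp-↭ (↭-sym vs) y∈)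
    (λ { refl → All¬⇒¬Any e≢ (here refl) })
    (λ e → All¬⇒¬Any e≢ (there (∈-resp-↭ es (∈-++⁺ˡ e))))
    (λ e → All¬⇒¬Any e′≢ (∈-resp-↭ es (∈-++⁺ˡ e)))
    (unique-↭ (↭-sym vs) u) =
  leftover C′ (qs ++ ps) (All.++⁺ ds′ ds) (↭-trans vs′ vs)
    (↭-trans (++⁺ˡ (dartsOf C′) (↭-reflexive (concatMap-++ darts qs ps)))
      (↭-trans (↭-reflexive (sym (++-assoc (dartsOf C′) _ _)))
        (↭-trans (++⁺ʳ _ es′) (Perm.prep _ (Perm.prep _ es)))))

-- Cones over stars and triangles

unique-++⁻ˡ : {A : Set} (xs : List A) {ys : List A} → Unique (xs ++ ys) → Unique xs
unique-++⁻ˡ []       _ = []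
unique-++⁻ˡ (x ∷ xs) (x∉ ∷ u) = All.++⁻ˡ xs x∉ ∷ unique-++⁻ˡ xs u

record Apexes (a b : ℕ) (S : List ℕ) : Set where
  constructor apexes
  field
    a≢b      : a ≢ b
    a∉       : a ∉ S
    b∉       : b ∉ S
    unique-S : Unique S

open Apexes

apexesˡ : ∀ {a b} S {T} → Apexes a b (S ++ T) → Apexes a b S
apexesˡ S (apexes n f g u) = apexes n (f ∘ ∈-++⁺ˡ) (g ∘ ∈-++⁺ˡ) (unique-++⁻ˡ S u)

apexesʳ : ∀ {a b} S {T} → Apexes a b (S ++ T) → Apexes a b T
apexesʳ S (apexes n f g u) = apexes n (f ∘ ∈-++⁺ʳ S) (g ∘ ∈-++⁺ʳ S) (proj₁ (unique-++⁻ S u))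

apexes-swap : ∀ {a b S} → Apexes a b S → Apexes b a S
apexes-swap (apexes n f g u) = apexes (≢-sym n) g f u

apexes-↭ : ∀ {a b S T} → S ↭ T → Apexes a b S → Apexes a b T
apexes-↭ p (apexes n f g u) = apexes n (f ∘ ∈-resp-↭ (↭-sym p)) (g ∘ ∈-resp-↭ (↭-sym p)) (unique-↭ p u)

apart : ∀ {x y : ℕ} S {T} → Unique (S ++ T) → x ∈ S → y ∈ T → x ≢ y
apart S u x∈ y∈ refl = proj₂ (unique-++⁻ S u) x∈ y∈

∉⇒≢ : ∀ {x y : ℕ} {S} → x ∉ S → y ∈ S → x ≢ y
∉⇒≢ x∉ y∈ refl = x∉ y∈

starCone : ℕ → ℕ → ℕ × List ℕ → List Dart
starCone a b s = starDarts s ++ bip (starVertices s) (a ∷ b ∷ [])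

triangleCone : ℕ → ℕ → ℕ × ℕ × ℕ → List Dart
triangleCone a b t = triangleDarts t ++ bip (triangleVertices t) (a ∷ b ∷ [])

-- Allows stars to be shortened by two leaves at a time, so that only stars with no leaf or one leaf
-- are treated by hand.
K₂₃ : ∀ {x y c a b} → Apexes a b (c ∷ x ∷ y ∷ []) →
  Decomposition 4 (bip (x ∷ y ∷ []) (c ∷ a ∷ b ∷ []))
K₂₃ {x} {y} {c} {a} {b} (apexes a≢b a∉ b∉ ((c≢x ∷ c≢y ∷ []) ∷ (x≢y ∷ []) ∷ _)) = decomposition
  ((x ∷ a ∷ y ∷ b ∷ []) ∷ (y ∷ c ∷ x ∷ b ∷ []) ∷ [])
  (distinct₄ (≢-sym (∉⇒≢ a∉ (there (here refl)))) x≢y (≢-sym (∉⇒≢ b∉ (there (here refl))))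
     (∉⇒≢ a∉ (there (there (here refl)))) a≢b (≢-sym (∉⇒≢ b∉ (there (there (here refl)))))
   ∷ distinct₄ (≢-sym c≢y) (≢-sym x≢y) (≢-sym (∉⇒≢ b∉ (there (there (here refl))))) c≢x
     (≢-sym (∉⇒≢ b∉ (here refl))) (≢-sym (∉⇒≢ b∉ (there (here refl)))) ∷ [])
  (relabel (x ∷ y ∷ c ∷ a ∷ b ∷ [])
    (concatMap darts ((0 ∷ 3 ∷ 1 ∷ 4 ∷ []) ∷ (1 ∷ 2 ∷ 0 ∷ 4 ∷ []) ∷ []))
    (bip (0 ∷ 1 ∷ []) (2 ∷ 3 ∷ 4 ∷ [])))

-- Splitting off two leaves of a star leaves K₂,₃ with parts {x , y} and {c , a , b}.
starCone-leaves : ∀ a b c x y ls →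
  bip (x ∷ y ∷ []) (c ∷ a ∷ b ∷ []) ++ starCone a b (c , ls) ↭ starCone a b (c , x ∷ y ∷ ls)
starCone-leaves a b c x y ls =
  solve 9 (λ cx xc cy yc S A X Y B →
      ((xc ∙ (cx ∙ X)) ∙ ((yc ∙ (cy ∙ Y)) ∙ ε)) ∙ (S ∙ (A ∙ B)) ⊜ (cx ∙ (xc ∙ (cy ∙ (yc ∙ S)))) ∙ (A ∙ (X ∙ (Y ∙ B))))
    ↭-refl [ (c , x) ] [ (x , c) ] [ (c , y) ] [ (y , c) ] (star c ls)
    (star c (a ∷ b ∷ [])) (star x (a ∷ b ∷ [])) (star y (a ∷ b ∷ [])) (bip ls (a ∷ b ∷ []))

-- The cone over a star with apexes a and b is decomposed up to two pendant edges, one at a and one at b (Middle), or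
-- up to a path with two edges that ends in b (Outer).
record Middle (a b : ℕ) (S : List ℕ) (E : List Dart) : Set where
  constructor middle
  field
    {z z′} : ℕ
    z∈     : z ∈ S
    z′∈    : z′ ∈ S
    {rest} : List Dart
    done   : Decomposition 4 rest
    total  : rest ++ darts (z ∷ a ∷ []) ++ darts (z′ ∷ b ∷ []) ↭ E

record Outer (a b : ℕ) (S : List ℕ) (E : List Dart) : Set where
  constructor outer
  field
    {p q}  : ℕ
    p∈     : p ∈ a ∷ S
    q∈     : q ∈ S
    p≢q    : p ≢ q
    {rest} : List Dart
    done   : Decomposition 4 rest
    total  : rest ++ darts (p ∷ q ∷ b ∷ []) ↭ E

leaves-K₂₃ : ∀ {a b c x y ls} → Apexes a b (c ∷ x ∷ y ∷ ls) → Decomposition 4 (bip (x ∷ y ∷ []) (c ∷ a ∷ b ∷ []))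
leaves-K₂₃ {c = c} {x} {y} A = K₂₃ (apexesˡ (c ∷ x ∷ y ∷ []) A)

apexes-tail : ∀ {a b c x y ls} → Apexes a b (c ∷ x ∷ y ∷ ls) → Apexes a b (c ∷ ls)
apexes-tail (apexes n f g ((_ ∷ _ ∷ c∉) ∷ _ ∷ _ ∷ u)) = apexes n
  (λ { (here e) → f (here e) ; (there e) → f (there (there (there e))) })
  (λ { (here e) → g (here e) ; (there e) → g (there (there (there e))) }) (c∉ ∷ u)

past : ∀ {w c x y : ℕ} {ls} → w ∈ c ∷ ls → w ∈ c ∷ x ∷ y ∷ ls
past (here e)  = here e
past (there e) = there (there (there e))

star-middle : ∀ {a b} c ls → Apexes a b (c ∷ ls) → Middle a b (c ∷ ls) (starCone a b (c , ls))
star-middle c [] A = middle (here refl) (here refl) empty ↭-refl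
-- The path `a c l b` is split off; `l a` and `c b` stay pendant.
star-middle {a} {b} c (l ∷ []) (apexes a≢b a∉ b∉ ((c≢l ∷ []) ∷ _)) = middle (there (here refl)) (here refl)
  (single (distinct₄ (∉⇒≢ a∉ (here refl)) (∉⇒≢ a∉ (there (here refl))) a≢b c≢l
    (≢-sym (∉⇒≢ b∉ (here refl))) (≢-sym (∉⇒≢ b∉ (there (here refl))))))
  (relabel (a ∷ b ∷ c ∷ l ∷ []) (darts (0 ∷ 2 ∷ 3 ∷ 1 ∷ []) ++ darts (3 ∷ 0 ∷ []) ++ darts (2 ∷ 1 ∷ []))
    (star 2 (3 ∷ []) ++ bip (2 ∷ 3 ∷ []) (0 ∷ 1 ∷ [])))
star-middle {a} {b} c (x ∷ y ∷ ls) A with middle z∈ z′∈ {R} D t ← star-middle c ls (apexes-tail A) =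
  middle (past z∈) (past z′∈) (leaves-K₂₃ A ⊕ D)
    (↭-trans (↭-reflexive (++-assoc (bip (x ∷ y ∷ []) (c ∷ a ∷ b ∷ [])) R _))
      (↭-trans (++⁺ˡ (bip (x ∷ y ∷ []) (c ∷ a ∷ b ∷ [])) t) (starCone-leaves a b c x y ls)))

star-outer : ∀ {a b} c ls → Apexes a b (c ∷ ls) → Outer a b (c ∷ ls) (starCone a b (c , ls))
star-outer {a} {b} c [] A = outer (here refl) (here refl) (∉⇒≢ (a∉ A) (here refl)) empty
  (Perm.swap (a , c) (c , a) ↭-refl)
-- The path `c a l b` is split off; `l c b` stays.
star-outer {a} {b} c (l ∷ []) (apexes a≢b a∉ b∉ ((c≢l ∷ []) ∷ _)) = outer (there (there (here refl))) (here refl) (≢-sym c≢l)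
  (single (distinct₄ (≢-sym (∉⇒≢ a∉ (here refl))) c≢l (≢-sym (∉⇒≢ b∉ (here refl)))
    (∉⇒≢ a∉ (there (here refl))) a≢b (≢-sym (∉⇒≢ b∉ (there (here refl))))))
  (relabel (a ∷ b ∷ c ∷ l ∷ []) (darts (2 ∷ 0 ∷ 3 ∷ 1 ∷ []) ++ darts (3 ∷ 2 ∷ 1 ∷ []))
    (star 2 (3 ∷ []) ++ bip (2 ∷ 3 ∷ []) (0 ∷ 1 ∷ [])))
star-outer {a} {b} c (x ∷ y ∷ ls) A with outer p∈ q∈ p≢q {R} D t ← star-outer c ls (apexes-tail A) =
  outer (past′ p∈) (past q∈) p≢q (leaves-K₂₃ A ⊕ D)
    (↭-trans (↭-reflexive (++-assoc (bip (x ∷ y ∷ []) (c ∷ a ∷ b ∷ [])) R _))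
      (↭-trans (++⁺ˡ (bip (x ∷ y ∷ []) (c ∷ a ∷ b ∷ [])) t) (starCone-leaves a b c x y ls)))
  where
  past′ : ∀ {w} → w ∈ a ∷ c ∷ ls → w ∈ a ∷ c ∷ x ∷ y ∷ ls
  past′ (here e)  = here e
  past′ (there e) = there (past e)

starCone-swap : ∀ a b s → starCone b a s ↭ starCone a b s
starCone-swap a b s = ++⁺ˡ (starDarts s) (bip-↭ʳ (starVertices s) (Perm.swap b a ↭-refl))

-- The foreign edge `w b` lengthens the two-edge path `p q b` left by `star-outer` to `p q b w`.
starCone-pendant : ∀ {a b w} s → Apexes a b (starVertices s) → w ∉ a ∷ b ∷ starVertices s →
  Decomposition 4 (darts (w ∷ b ∷ []) ++ starCone a b s)
starCone-pendant {a} {b} {w} (c , ls) A w∉ with outer {p} {q} p∈ q∈ p≢q {R} D t ← star-outer c ls A =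
  recover (↭-trans
    (solve 5 (λ R pq qb bw wb → R ∙ (pq ∙ (qb ∙ (bw ∙ wb))) ⊜ (wb ∙ bw) ∙ (R ∙ (pq ∙ qb))) ↭-refl
      R (darts (p ∷ q ∷ [])) (darts (q ∷ b ∷ [])) [ (b , w) ] [ (w , b) ])
    (++⁺ˡ (darts (w ∷ b ∷ [])) t))
  (D ⊕ single (distinct₄ p≢q (p≢b p∈) (p≢w p∈) (≢-sym (∉⇒≢ (b∉ A) q∈)) (≢-sym (∉⇒≢ w∉ (there (there q∈))))
    (≢-sym (∉⇒≢ w∉ (there (here refl))))))
  where
  p≢b : ∀ {p} → p ∈ a ∷ c ∷ ls → p ≢ b
  p≢b (here refl) = a≢b A
  p≢b (there p∈)  = ≢-sym (∉⇒≢ (b∉ A) p∈)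
  p≢w : ∀ {p} → p ∈ a ∷ c ∷ ls → p ≢ w
  p≢w (here refl) = ≢-sym (∉⇒≢ w∉ (here refl))
  p≢w (there p∈)  = ≢-sym (∉⇒≢ w∉ (there (there p∈)))

starCone-pendant′ : ∀ {a b w} s → Apexes a b (starVertices s) → w ∉ a ∷ b ∷ starVertices s →
  Decomposition 4 (darts (w ∷ a ∷ []) ++ starCone a b s)
starCone-pendant′ {a} {b} {w} s A w∉ = recover (++⁺ˡ (darts (w ∷ a ∷ [])) (starCone-swap a b s))
  (starCone-pendant s (apexes-swap A) λ
    { (here e) → w∉ (there (here e)) ; (there (here e)) → w∉ (here e) ; (there (there e)) → w∉ (there (there e)) })

outsideˡ : ∀ {a b w} S {T} → Apexes a b (S ++ T) → w ∈ T → w ∉ a ∷ b ∷ S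
outsideˡ S A w∈ (here refl)         = a∉ A (∈-++⁺ʳ S w∈)
outsideˡ S A w∈ (there (here refl)) = b∉ A (∈-++⁺ʳ S w∈)
outsideˡ S A w∈ (there (there e))   = apart S (unique-S A) e w∈ refl

outsideʳ : ∀ {a b w} S {T} → Apexes a b (S ++ T) → w ∈ S → w ∉ a ∷ b ∷ T
outsideʳ S A w∈ (here refl)         = a∉ A (∈-++⁺ˡ w∈)
outsideʳ S A w∈ (there (here refl)) = b∉ A (∈-++⁺ˡ w∈)
outsideʳ S A w∈ (there (there e))   = apart S (unique-S A) w∈ e refl

-- The two pendant edges left by the second star extend the paths left by the first and the third.
threeStars : ∀ {a b} s₁ s₂ s₃ → Apexes a b (starVertices s₁ ++ starVertices s₂ ++ starVertices s₃) →
  Decomposition 4 (starCone a b s₁ ++ starCone a b s₂ ++ starCone a b s₃)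
threeStars {a} {b} s₁ s₂ s₃ A
  with A₁ ← apexesˡ (starVertices s₁) A | A₂₃ ← apexesʳ (starVertices s₁) A
  with A₂ ← apexesˡ (starVertices s₂) A₂₃ | A₃ ← apexesʳ (starVertices s₂) A₂₃
  with middle {z} {z′} z∈ z′∈ {R} D t ← star-middle (proj₁ s₂) (proj₂ s₂) A₂ =
  recover (↭-trans
    (solve 5 (λ z′b C₁ R za C₃ → (z′b ∙ C₁) ∙ (R ∙ (za ∙ C₃)) ⊜ C₁ ∙ ((R ∙ (za ∙ z′b)) ∙ C₃)) ↭-refl
      (darts (z′ ∷ b ∷ [])) (starCone a b s₁) R (darts (z ∷ a ∷ [])) (starCone a b s₃))
    (++⁺ˡ (starCone a b s₁) (++⁺ʳ (starCone a b s₃) t)))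
  (starCone-pendant s₁ A₁ (outsideˡ (starVertices s₁) A (∈-++⁺ˡ z′∈))
    ⊕ D ⊕ starCone-pendant′ s₃ A₃ (outsideʳ (starVertices s₂) A₂₃ z∈))

-- Absorbs the edge `a b` when no triangle is at hand. The first two stars leave four pendant edges:
-- two of them enclose `a b` in the path `z₁ a b z₂′`, the other two are absorbed by the third and
-- the fourth star.
fourStars : ∀ {a b} s₁ s₂ s₃ s₄ → Apexes a b (starVertices s₁ ++ starVertices s₂ ++ starVertices s₃ ++ starVertices s₄) →
  Decomposition 4 (starCone a b s₁ ++ starCone a b s₂ ++ starCone a b s₃ ++ starCone a b s₄ ++ darts (a ∷ b ∷ []))
fourStars {a} {b} s₁ s₂ s₃ s₄ A
  with A₁ ← apexesˡ (starVertices s₁) A | A₂₃₄ ← apexesʳ (starVertices s₁) A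
  with A₂ ← apexesˡ (starVertices s₂) A₂₃₄ | A₃₄ ← apexesʳ (starVertices s₂) A₂₃₄
  with A₃ ← apexesˡ (starVertices s₃) A₃₄ | A₄ ← apexesʳ (starVertices s₃) A₃₄
  with middle {z₁} {z₁′} z₁∈ z₁′∈ {R₁} D₁ t₁ ← star-middle (proj₁ s₁) (proj₂ s₁) A₁
     | middle {z₂} {z₂′} z₂∈ z₂′∈ {R₂} D₂ t₂ ← star-middle (proj₁ s₂) (proj₂ s₂) A₂ =
  recover (↭-trans
    (solve 10 (λ R₁ R₂ za₁ ab bz₂ z₂b zb₁ C₃ za₂ C₄ →
        R₁ ∙ (R₂ ∙ ((za₁ ∙ (ab ∙ (bz₂ ∙ z₂b))) ∙ ((zb₁ ∙ C₃) ∙ (za₂ ∙ C₄))))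
        ⊜ (R₁ ∙ (za₁ ∙ zb₁)) ∙ ((R₂ ∙ (za₂ ∙ (z₂b ∙ bz₂))) ∙ (C₃ ∙ (C₄ ∙ ab)))) ↭-refl
      R₁ R₂ (darts (z₁ ∷ a ∷ [])) (darts (a ∷ b ∷ [])) [ (b , z₂′) ] [ (z₂′ , b) ] (darts (z₁′ ∷ b ∷ [])) (starCone a b s₃)
      (darts (z₂ ∷ a ∷ [])) (starCone a b s₄))
    (++⁺ t₁ (++⁺ʳ _ t₂)))
  (D₁ ⊕ D₂ ⊕ single (distinct₄ (≢-sym (∉⇒≢ (a∉ A₁) z₁∈)) (≢-sym (∉⇒≢ (b∉ A₁) z₁∈))
      (apart (starVertices s₁) (unique-S A) z₁∈ (∈-++⁺ˡ z₂′∈)) (a≢b A) (∉⇒≢ (a∉ A₂) z₂′∈) (∉⇒≢ (b∉ A₂) z₂′∈))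
    ⊕ starCone-pendant s₃ A₃ (λ e → outsideʳ (starVertices s₁) A z₁′∈ (extend e))
    ⊕ starCone-pendant′ s₄ A₄ (λ e → outsideʳ (starVertices s₂) A₂₃₄ z₂∈ (extend′ e)))
  where
  extend : ∀ {w} → w ∈ a ∷ b ∷ starVertices s₃ → w ∈ a ∷ b ∷ starVertices s₂ ++ starVertices s₃ ++ starVertices s₄
  extend (here e)          = here e
  extend (there (here e))  = there (here e)
  extend (there (there e)) = there (there (∈-++⁺ʳ (starVertices s₂) (∈-++⁺ˡ e)))
  extend′ : ∀ {w} → w ∈ a ∷ b ∷ starVertices s₄ → w ∈ a ∷ b ∷ starVertices s₃ ++ starVertices s₄
  extend′ (here e)          = here e
  extend′ (there (here e))  = there (here e)
  extend′ (there (there e)) = there (there (∈-++⁺ʳ (starVertices s₃) e))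

triangleCone-decomposition : ∀ {a b} t → Apexes a b (triangleVertices t) → Decomposition 4 (triangleCone a b t)
triangleCone-decomposition {a} {b} (p , q , r) (apexes a≢b a∉ b∉ ((p≢q ∷ p≢r ∷ []) ∷ (q≢r ∷ []) ∷ _)) = decomposition
  ((b ∷ r ∷ p ∷ q ∷ []) ∷ (q ∷ r ∷ a ∷ p ∷ []) ∷ (p ∷ b ∷ q ∷ a ∷ []) ∷ [])
  (distinct₄ b≢r b≢p b≢q (≢-sym p≢r) (≢-sym q≢r) p≢q
   ∷ distinct₄ q≢r (≢-sym a≢q) (≢-sym p≢q) (≢-sym a≢r) (≢-sym p≢r) a≢p
   ∷ distinct₄ (≢-sym b≢p) p≢q (≢-sym a≢p) b≢q (≢-sym a≢b) (≢-sym a≢q) ∷ [])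
  (relabel (p ∷ q ∷ r ∷ a ∷ b ∷ [])
    (concatMap darts ((4 ∷ 2 ∷ 0 ∷ 1 ∷ []) ∷ (1 ∷ 2 ∷ 3 ∷ 0 ∷ []) ∷ (0 ∷ 4 ∷ 1 ∷ 3 ∷ []) ∷ []))
    (complete (0 ∷ 1 ∷ 2 ∷ []) ++ bip (0 ∷ 1 ∷ 2 ∷ []) (3 ∷ 4 ∷ [])))
  where
  a≢p = ∉⇒≢ a∉ (here refl)
  a≢q = ∉⇒≢ a∉ (there (here refl))
  a≢r = ∉⇒≢ a∉ (there (there (here refl)))
  b≢p = ∉⇒≢ b∉ (here refl)
  b≢q = ∉⇒≢ b∉ (there (here refl))
  b≢r = ∉⇒≢ b∉ (there (there (here refl)))

-- Compared with `triangleCone-decomposition` only the path `p b q a` changes: its edges, the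
-- pendant edges `z a` and `z′ b` and the edge `a b` recombine into `z a b p` and `z′ b q a`.
starAndTriangle : ∀ {a b} s t → Apexes a b (starVertices s ++ triangleVertices t) →
  Decomposition 4 (starCone a b s ++ triangleCone a b t ++ darts (a ∷ b ∷ []))
starAndTriangle {a} {b} s t@(p , q , r) A
  with A₁ ← apexesˡ (starVertices s) A
  with middle {z} {z′} z∈ z′∈ {R} D e ← star-middle (proj₁ s) (proj₂ s) A₁
     | apexes a≢b a∉ b∉ ((p≢q ∷ p≢r ∷ []) ∷ (q≢r ∷ []) ∷ _) ← apexesʳ (starVertices s) A =
  recover (↭-trans (↭-reflexive (sym (++-assoc R _ _))) (++⁺ʳ _ e)) (D ⊕ decomposition
    ((z ∷ a ∷ b ∷ p ∷ []) ∷ (z′ ∷ b ∷ q ∷ a ∷ []) ∷ (b ∷ r ∷ p ∷ q ∷ []) ∷ (q ∷ r ∷ a ∷ p ∷ []) ∷ [])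
    (distinct₄ (≢-sym (∉⇒≢ (Apexes.a∉ A₁) z∈)) (≢-sym (∉⇒≢ (Apexes.b∉ A₁) z∈)) (apart (starVertices s) (unique-S A) z∈ (here refl))
       a≢b (∉⇒≢ a∉ (here refl)) (∉⇒≢ b∉ (here refl))
     ∷ distinct₄ (≢-sym (∉⇒≢ (Apexes.b∉ A₁) z′∈)) (apart (starVertices s) (unique-S A) z′∈ (there (here refl)))
       (≢-sym (∉⇒≢ (Apexes.a∉ A₁) z′∈)) (∉⇒≢ b∉ (there (here refl))) (≢-sym a≢b) (≢-sym (∉⇒≢ a∉ (there (here refl))))
     ∷ distinct₄ (∉⇒≢ b∉ (there (there (here refl)))) (∉⇒≢ b∉ (here refl)) (∉⇒≢ b∉ (there (here refl))) (≢-sym p≢r) (≢-sym q≢r) p≢q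
     ∷ distinct₄ q≢r (≢-sym (∉⇒≢ a∉ (there (here refl)))) (≢-sym p≢q) (≢-sym (∉⇒≢ a∉ (there (there (here refl))))) (≢-sym p≢r) (∉⇒≢ a∉ (here refl))
     ∷ [])
    (relabel (z ∷ z′ ∷ p ∷ q ∷ r ∷ a ∷ b ∷ [])
      (concatMap darts ((0 ∷ 5 ∷ 6 ∷ 2 ∷ []) ∷ (1 ∷ 6 ∷ 3 ∷ 5 ∷ []) ∷ (6 ∷ 4 ∷ 2 ∷ 3 ∷ []) ∷ (3 ∷ 4 ∷ 5 ∷ 2 ∷ []) ∷ []))
      ((darts (0 ∷ 5 ∷ []) ++ darts (1 ∷ 6 ∷ [])) ++
        (complete (2 ∷ 3 ∷ 4 ∷ []) ++ bip (2 ∷ 3 ∷ 4 ∷ []) (5 ∷ 6 ∷ [])) ++ darts (5 ∷ 6 ∷ []))))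

-- Two leaves are held back. The six edges between them and `c`, `a`, `b`, the two pendant edges of
-- the rest and the edge `a b` make up three paths.
loneStar : ∀ {a b} c x y ls → Apexes a b (c ∷ x ∷ y ∷ ls) →
  Decomposition 4 (starCone a b (c , x ∷ y ∷ ls) ++ darts (a ∷ b ∷ []))
loneStar {a} {b} c x y ls A@(apexes a≢b a∉ b∉ ((c≢x ∷ c≢y ∷ _) ∷ (x≢y ∷ x∉) ∷ y∉ ∷ _))
  with A′ ← apexes-tail A
  with middle {z} {z′} z∈ z′∈ {R} D e ← star-middle c ls A′ =
  recover (↭-trans
    (solve 4 (λ R P K ab → R ∙ (P ∙ (K ∙ ab)) ⊜ (K ∙ (R ∙ P)) ∙ ab) ↭-refl
      R (darts (z ∷ a ∷ []) ++ darts (z′ ∷ b ∷ [])) (bip (x ∷ y ∷ []) (c ∷ a ∷ b ∷ [])) (darts (a ∷ b ∷ [])))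
    (++⁺ʳ _ (↭-trans (++⁺ˡ (bip (x ∷ y ∷ []) (c ∷ a ∷ b ∷ [])) e) (starCone-leaves a b c x y ls))))
  (D ⊕ decomposition
    ((z ∷ a ∷ b ∷ x ∷ []) ∷ (z′ ∷ b ∷ y ∷ a ∷ []) ∷ (y ∷ c ∷ x ∷ a ∷ []) ∷ [])
    (distinct₄ (≢-sym (∉⇒≢ (Apexes.a∉ A′) z∈)) (≢-sym (∉⇒≢ (Apexes.b∉ A′) z∈)) (x∉′ z∈) a≢b (∉⇒≢ a∉ (there (here refl))) (∉⇒≢ b∉ (there (here refl)))
     ∷ distinct₄ (≢-sym (∉⇒≢ (Apexes.b∉ A′) z′∈)) (y∉′ z′∈) (≢-sym (∉⇒≢ (Apexes.a∉ A′) z′∈)) (∉⇒≢ b∉ (there (there (here refl))))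
       (≢-sym a≢b) (≢-sym (∉⇒≢ a∉ (there (there (here refl)))))
     ∷ distinct₄ (≢-sym c≢y) (≢-sym x≢y) (≢-sym (∉⇒≢ a∉ (there (there (here refl))))) c≢x (≢-sym (∉⇒≢ a∉ (here refl)))
       (≢-sym (∉⇒≢ a∉ (there (here refl))))
     ∷ [])
    (relabel (z ∷ z′ ∷ x ∷ y ∷ c ∷ a ∷ b ∷ [])
      (concatMap darts ((0 ∷ 5 ∷ 6 ∷ 2 ∷ []) ∷ (1 ∷ 6 ∷ 3 ∷ 5 ∷ []) ∷ (3 ∷ 4 ∷ 2 ∷ 5 ∷ []) ∷ []))
      ((darts (0 ∷ 5 ∷ []) ++ darts (1 ∷ 6 ∷ [])) ++ bip (2 ∷ 3 ∷ []) (4 ∷ 5 ∷ 6 ∷ []) ++ darts (5 ∷ 6 ∷ []))))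
  where
  x∉′ : ∀ {w} → w ∈ c ∷ ls → w ≢ x
  x∉′ (here refl) = c≢x
  x∉′ (there w∈)  = ≢-sym (All.lookup x∉ w∈)
  y∉′ : ∀ {w} → w ∈ c ∷ ls → w ≢ y
  y∉′ (here refl) = c≢y
  y∉′ (there w∈)  = ≢-sym (All.lookup y∉ w∈)

starTriples : ∀ {a b} ss → length ss % 3 ≡ 0 → Apexes a b (concatMap starVertices ss) →
  Decomposition 4 (concatMap (starCone a b) ss)
starTriples [] _ _ = empty
starTriples {a} {b} (s₁ ∷ s₂ ∷ s₃ ∷ ss) len A =
  recover (↭-trans (↭-reflexive (++-assoc (starCone a b s₁) _ _)) (++⁺ˡ (starCone a b s₁) (↭-reflexive (++-assoc (starCone a b s₂) _ _))))
    (threeStars s₁ s₂ s₃ (apexesˡ S₁₂₃ A′) ⊕ starTriples ss len (apexesʳ S₁₂₃ A′))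
  where
  S₁₂₃ = starVertices s₁ ++ starVertices s₂ ++ starVertices s₃
  A′ : Apexes a b (S₁₂₃ ++ concatMap starVertices ss)
  A′ = subst (Apexes a b) (sym (trans (++-assoc (starVertices s₁) _ _) (cong (starVertices s₁ ++_) (++-assoc (starVertices s₂) _ _)))) A

triangleCones : ∀ {a b} ts → Apexes a b (concatMap triangleVertices ts) → Decomposition 4 (concatMap (triangleCone a b) ts)
triangleCones [] _ = empty
triangleCones (t ∷ ts) A =
  triangleCone-decomposition t (apexesˡ (triangleVertices t) A) ⊕ triangleCones ts (apexesʳ (triangleVertices t) A)

suc-%-3 : ∀ n → suc n % 3 ≡ 1 → n % 3 ≡ 0
suc-%-3 zero                _ = refl
suc-%-3 (suc (suc (suc n))) e = suc-%-3 n e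

-- Some cones must absorb `a b`: a star with a triangle if there is one, else four stars, else the
-- only star. The remaining stars come in threes. The bound on the number of vertices gives an only
-- star the two leaves that `loneStar` asks for.
coneStars : ∀ {a b} ss ts → length ss % 3 ≡ 1 → 3 ≤ length (concatMap starVertices ss ++ concatMap triangleVertices ts) →
  Apexes a b (concatMap starVertices ss ++ concatMap triangleVertices ts) →
  Decomposition 4 (concatMap (starCone a b) ss ++ concatMap (triangleCone a b) ts ++ darts (a ∷ b ∷ []))
coneStars {a} {b} (s ∷ ss) (t ∷ ts) len _ A =
  recover (solve 5 (λ s t ab ss ts → (s ∙ (t ∙ ab)) ∙ (ss ∙ ts) ⊜ (s ∙ ss) ∙ ((t ∙ ts) ∙ ab)) ↭-refl
    (starCone a b s) (triangleCone a b t) (darts (a ∷ b ∷ [])) (concatMap (starCone a b) ss) (concatMap (triangleCone a b) ts))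
  (starAndTriangle s t (apexesˡ (starVertices s ++ triangleVertices t) A′)
    ⊕ starTriples ss (suc-%-3 (length ss) len) (apexesˡ (concatMap starVertices ss) (apexesʳ (starVertices s ++ triangleVertices t) A′))
    ⊕ triangleCones ts (apexesʳ (concatMap starVertices ss) (apexesʳ (starVertices s ++ triangleVertices t) A′)))
  where
  A′ : Apexes a b ((starVertices s ++ triangleVertices t) ++ concatMap starVertices ss ++ concatMap triangleVertices ts)
  A′ = apexes-↭ (↭-sym (solve 4 (λ s t ss ts → (s ∙ t) ∙ (ss ∙ ts) ⊜ (s ∙ ss) ∙ (t ∙ ts)) ↭-refl
      (starVertices s) (triangleVertices t) (concatMap starVertices ss) (concatMap triangleVertices ts))) A
coneStars {a} {b} (s₁ ∷ s₂ ∷ s₃ ∷ s₄ ∷ ss) [] len _ A =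
  recover (solve 6 (λ s₁ s₂ s₃ s₄ ab ss → (s₁ ∙ (s₂ ∙ (s₃ ∙ (s₄ ∙ ab)))) ∙ ss ⊜ (s₁ ∙ (s₂ ∙ (s₃ ∙ (s₄ ∙ ss)))) ∙ ab) ↭-refl
    (starCone a b s₁) (starCone a b s₂) (starCone a b s₃) (starCone a b s₄) (darts (a ∷ b ∷ [])) (concatMap (starCone a b) ss))
  (fourStars s₁ s₂ s₃ s₄ (apexesˡ S₁₂₃₄ A′) ⊕ starTriples ss (suc-%-3 (length ss) len) (apexesʳ S₁₂₃₄ A′))
  where
  S₁₂₃₄ = starVertices s₁ ++ starVertices s₂ ++ starVertices s₃ ++ starVertices s₄
  A′ : Apexes a b (S₁₂₃₄ ++ concatMap starVertices ss)
  A′ = apexes-↭ (↭-sym (solve 5 (λ s₁ s₂ s₃ s₄ ss → (s₁ ∙ (s₂ ∙ (s₃ ∙ s₄))) ∙ ss ⊜ (s₁ ∙ (s₂ ∙ (s₃ ∙ (s₄ ∙ ss)))) ∙ ε) ↭-refl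
      (starVertices s₁) (starVertices s₂) (starVertices s₃) (starVertices s₄) (concatMap starVertices ss))) A
coneStars ((c , x ∷ y ∷ ls) ∷ []) [] _ _ A =
  recover (++⁺ʳ _ (↭-reflexive (sym (++-identityʳ (starCone _ _ (c , x ∷ y ∷ ls)))))) (loneStar c x y ls (apexesˡ (c ∷ x ∷ y ∷ ls) (apexesˡ _ A)))
coneStars ((c , [])     ∷ []) [] _ (s≤s ()) _
coneStars ((c , l ∷ []) ∷ []) [] _ (s≤s (s≤s ())) _

concatMap-zip : {A B : Set} (f g : A → List B) (xs : List A) →
  concatMap f xs ++ concatMap g xs ↭ concatMap (λ x → f x ++ g x) xs
concatMap-zip f g []       = ↭-refl
concatMap-zip f g (x ∷ xs) = ↭-trans
  (solve 4 (λ a b c d → (a ∙ b) ∙ (c ∙ d) ⊜ (a ∙ c) ∙ (b ∙ d)) ↭-refl (f x) (concatMap f xs) (g x) (concatMap g xs))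
  (++⁺ˡ (f x ++ g x) (concatMap-zip f g xs))

bip-concatMap : {A B : Set} (f : A → List B) (xs : List A) (W : List B) →
  bip (concatMap f xs) W ↭ concatMap (λ x → bip (f x) W) xs
bip-concatMap f []       W = ↭-refl
bip-concatMap f (x ∷ xs) W = ↭-trans (bip-++ˡ (f x) (concatMap f xs) W) (++⁺ˡ (bip (f x) W) (bip-concatMap f xs W))

cones-↭ : ∀ a b C →
  concatMap (starCone a b) (stars C) ++ concatMap (triangleCone a b) (triangles C) ++ darts (a ∷ b ∷ [])
  ↭ dartsOf C ++ bip (verticesOf C) (a ∷ b ∷ []) ++ darts (a ∷ b ∷ [])
cones-↭ a b C = ↭-sym (↭-trans
  (++⁺ˡ (dartsOf C) (++⁺ʳ _ (↭-trans (bip-++ˡ (concatMap starVertices (stars C)) _ _)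
    (++⁺ (bip-concatMap starVertices (stars C) _) (bip-concatMap triangleVertices (triangles C) _)))))
  (↭-trans
    (solve 5 (λ s t S T ab → (s ∙ t) ∙ ((S ∙ T) ∙ ab) ⊜ (s ∙ S) ∙ ((t ∙ T) ∙ ab)) ↭-refl
      (concatMap starDarts (stars C)) (concatMap triangleDarts (triangles C)) (concatMap (λ s → bip (starVertices s) (a ∷ b ∷ [])) (stars C))
      (concatMap (λ t → bip (triangleVertices t) (a ∷ b ∷ [])) (triangles C)) (darts (a ∷ b ∷ [])))
    (++⁺ (concatMap-zip starDarts _ (stars C)) (++⁺ʳ _ (concatMap-zip triangleDarts _ (triangles C))))))

length-bip : {A : Set} (xs ys : List A) → length (bip xs ys) ≡ 2 * (length xs * length ys)
length-bip []       ys = refl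
length-bip (x ∷ xs) ys = trans (length-++ (star x ys)) (trans (cong₂ _+_ (length-star x ys) (length-bip xs ys)) (lemma (length xs) (length ys)))
  where
  lemma : ∀ m n → 2 * n + 2 * (m * n) ≡ 2 * (suc m * n)
  lemma = solve-∀

-- In darts, the cone over a star with l leaves counts 2l + 4(l + 1) = 3(2l + 1) + 1, so modulo 3
-- the total is the number of stars.
length-starCones : ∀ a b ss → ∃ λ k → length (concatMap (starCone a b) ss) ≡ 3 * k + length ss
length-starCones a b [] = 0 , refl
length-starCones a b (s@(c , ls) ∷ ss) with k , eq ← length-starCones a b ss =
  2 * length ls + 1 + k , (begin
    length (starCone a b s ++ concatMap (starCone a b) ss)   ≡⟨ length-++ (starCone a b s) ⟩
    length (starCone a b s) + length (concatMap (starCone a b) ss)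
      ≡⟨ cong₂ _+_ (trans (length-++ (star c ls)) (cong₂ _+_ (length-star c ls) (length-bip (c ∷ ls) (a ∷ b ∷ [])))) eq ⟩
    (2 * length ls + 2 * (suc (length ls) * 2)) + (3 * k + length ss)  ≡⟨ lemma (length ls) k (length ss) ⟩
    3 * (2 * length ls + 1 + k) + suc (length ss)  ∎)
  where
  open ≡-Reasoning
  lemma : ∀ l k n → (2 * l + 2 * (suc l * 2)) + (3 * k + n) ≡ 3 * (2 * l + 1 + k) + suc n
  lemma = solve-∀

length-triangleCones : ∀ a b ts → length (concatMap (triangleCone a b) ts) ≡ 3 * (6 * length ts)
length-triangleCones a b [] = refl
length-triangleCones a b (t ∷ ts) = trans (cong (18 +_) (length-triangleCones a b ts)) (lemma (length ts))
  where
  lemma : ∀ n → 18 + 3 * (6 * n) ≡ 3 * (6 * suc n)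
  lemma = solve-∀

cone-decomposition : ∀ {a b U} L → Apexes a b U → 3 ≤ length U → Unique (both L) → (∀ {x y} → (x , y) ∈ L → x ∈ U × y ∈ U) →
  3 ∣ length (both L ++ bip U (a ∷ b ∷ []) ++ darts (a ∷ b ∷ [])) →
  Decomposition 4 (both L ++ bip U (a ∷ b ∷ []) ++ darts (a ∷ b ∷ []))
cone-decomposition {a} {b} {U} L A 3≤ w L⊆ 3∣ with leftover C ps ds vs es ← pack L (unique-S A) w L⊆ =
  recover total (coneStars (stars C) (triangles C) (one-mod-3 (length (stars C)) 3∣stars)
      (subst (3 ≤_) (sym (↭-length vs)) 3≤)
      (apexes-↭ (↭-sym vs) A)
    ⊕ decomposition ps ds ↭-refl)
  where
  S = concatMap (starCone a b) (stars C)
  T = concatMap (triangleCone a b) (triangles C)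
  P = concatMap darts ps
  total : (S ++ T ++ darts (a ∷ b ∷ [])) ++ P ↭ both L ++ bip U (a ∷ b ∷ []) ++ darts (a ∷ b ∷ [])
  total = ↭-trans (++⁺ʳ P (cones-↭ a b C)) (↭-trans
    (solve 4 (λ d B ab p → (d ∙ (B ∙ ab)) ∙ p ⊜ (d ∙ p) ∙ (B ∙ ab)) ↭-refl
      (dartsOf C) (bip (verticesOf C) (a ∷ b ∷ [])) (darts (a ∷ b ∷ [])) P)
    (++⁺ es (++⁺ʳ _ (bip-↭ˡ (a ∷ b ∷ []) vs))))
  k = proj₁ (length-starCones a b (stars C))
  counted : length (both L ++ bip U (a ∷ b ∷ []) ++ darts (a ∷ b ∷ []))
    ≡ 3 * (k + 6 * length (triangles C) + 2 * length ps) + (2 + length (stars C))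
  counted = trans (sym (↭-length total)) (trans (length-++ (S ++ T ++ darts (a ∷ b ∷ []))) (trans
    (cong₂ _+_ (trans (length-++ S) (cong₂ _+_ (proj₂ (length-starCones a b (stars C)))
      (trans (length-++ T) (cong (_+ 2) (length-triangleCones a b (triangles C)))))) (length-concatMap-darts ps))
    (lemma k (length (stars C)) (length (triangles C)) (length ps))))
    where
    lemma : ∀ k s t p → (3 * k + s + (3 * (6 * t) + 2)) + p * 6 ≡ 3 * (k + 6 * t + 2 * p) + (2 + s)
    lemma = solve-∀
  -- The summand 2 stands for the two darts of `a b`; cones over triangles and packed paths
  -- contribute multiples of 3.
  3∣stars : 3 ∣ 2 + length (stars C)
  3∣stars = ∣m+n∣m⇒∣n (subst (3 ∣_) counted 3∣) (m∣m*n (k + 6 * length (triangles C) + 2 * length ps))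
  one-mod-3 : ∀ n → 3 ∣ 2 + n → n % 3 ≡ 1
  one-mod-3 n 3∣n = go n (n∣m⇒m%n≡0 (2 + n) 3 3∣n)
    where
    go : ∀ n → (2 + n) % 3 ≡ 0 → n % 3 ≡ 1
    go (suc zero) _ = refl
    go (suc (suc (suc n))) e = go n e

-- Bounds on the order of the target

order-equation : ∀ {v k} (𝓑 : DesignOfOrder v (path (suc k))) → let open Extract 𝓑 in
  length (paths decomposed) * (2 * k) + v ≡ v * v
order-equation 𝓑 = begin
  length (paths decomposed) * _ + _   ≡⟨ cong₂ _+_ (trans (sym (length-concatMap-darts (paths decomposed))) (↭-length (covers decomposed))) (sym K-order) ⟩
  length (complete V) + length V      ≡⟨ length-complete V ⟩
  length V * length V                 ≡⟨ cong₂ _*_ K-order K-order ⟩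
  _                                   ∎
  where
  open Extract 𝓑
  open ≡-Reasoning

-- Counting darts makes `n` idempotent modulo `d`. The only idempotent residues modulo 3 and modulo
-- 8 are 0 and 1.
square-mod : ∀ m d {n} .{{_ : NonZero d}} → m * d + n ≡ n * n → ((n % d) * (n % d)) % d ≡ n % d
square-mod m d {n} eq = begin
  ((n % d) * (n % d)) % d  ≡⟨ %-distribˡ-* n n d ⟨
  (n * n) % d              ≡⟨ cong (_% d) eq ⟨
  (m * d + n) % d          ≡⟨ cong (_% d) (+-comm (m * d) n) ⟩
  (n + m * d) % d          ≡⟨ [m+kn]%n≡m%n n m d ⟩
  n % d                    ∎
  where open ≡-Reasoning

P₄-order : ∀ {n} → DesignOfOrder n (path 4) → n % 3 ≡ 0 ⊎ n % 3 ≡ 1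
P₄-order {n} 𝓑 = residue (n % 3) (m%n<n n 3)
  (square-mod (m * 2) 3 {n} (trans (cong (_+ n) (lemma m)) (order-equation 𝓑)))
  where
  m = length (paths (Extract.decomposed 𝓑))
  lemma : ∀ m → m * 2 * 3 ≡ m * (2 * 3)
  lemma = solve-∀
  residue : ∀ r → r < 3 → (r * r) % 3 ≡ r → r ≡ 0 ⊎ r ≡ 1
  residue 0 _ _ = inj₁ refl
  residue 1 _ _ = inj₂ refl
  residue 2 _ ()
  residue (suc (suc (suc r))) (s≤s (s≤s (s≤s ()))) _

P₅-order : ∀ {v} → DesignOfOrder v (path 5) → v % 8 ≡ 0 ⊎ v % 8 ≡ 1
P₅-order {v} 𝓑 = residue (v % 8) (m%n<n v 8) (square-mod (length (paths (Extract.decomposed 𝓑))) 8 {v} (order-equation 𝓑))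
  where
  residue : ∀ r → r < 8 → (r * r) % 8 ≡ r → r ≡ 0 ⊎ r ≡ 1
  residue 0 _ _ = inj₁ refl
  residue 1 _ _ = inj₂ refl
  residue 2 _ ()
  residue 3 _ ()
  residue 4 _ ()
  residue 5 _ ()
  residue 6 _ ()
  residue 7 _ ()
  residue (suc (suc (suc (suc (suc (suc (suc (suc r)))))))) (s≤s (s≤s (s≤s (s≤s (s≤s (s≤s (s≤s (s≤s ())))))))) _

⊆-or-missing : (V N : List ℕ) → V ⊆ₗ N ⊎ ∃ λ u → u ∈ V × u ∉ N
⊆-or-missing [] N = inj₁ λ ()
⊆-or-missing (x ∷ V) N with decide-∈ _≟_ x N | ⊆-or-missing V N
... | no x∉  | _ = inj₂ (x , here refl , x∉)
... | yes x∈ | inj₂ (u , u∈ , u∉) = inj₂ (u , there u∈ , u∉)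
... | yes x∈ | inj₁ V⊆ = inj₁ λ { (here refl) → x∈ ; (there y∈) → V⊆ y∈ }

module _ {v n : ℕ} (𝓑 : DesignOfOrder v (path 5)) (linked : DownLinkedTo-P₄ 𝓑 n) where
  private
    module S = Extract 𝓑
    module T = Extract (proj₁ linked)
    f = proj₁ (proj₂ linked)
    sub = proj₂ (proj₂ linked)

  target∈ : ∀ i {x} → x ∈ toList (walk (T.pathOf (f i))) → x ∈ T.V
  target∈ i x∈ = proj₁ (T.block-⊑ (f i)) (vertices⁺ (T.pathOf (f i)) x∈)

  -- The block through a missing edge x y would have to contain x, y and the four vertices of its image.
  missing-≤1 : ∀ {x y} → x ∈ S.V → y ∈ S.V → x ∉ T.V → y ∉ T.V → ¬ (x ≢ y)
  missing-≤1 {x} {y} x∈ y∈ x∉ y∉ x≢y with i , e , _ ← S.partition (S.K-complete x∈ y∈ x≢y) =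
    6≰5 (≤-trans (≤-reflexive (cong (2 +_) (sym (length-toList w)))) (≤-trans
      (unique-⊆-length {xs = x ∷ y ∷ toList w}
        ((x≢y ∷ ¬Any⇒All¬ _ (x∉ ∘ target∈ i)) ∷ ¬Any⇒All¬ _ (y∉ ∘ target∈ i) ∷ distinct⇒unique (walk-distinct (T.pathOf (f i))))
        λ { (here refl) → vertices⁻ (S.pathOf i) (Graph.~⇒∈ (S.block i) e)
          ; (there (here refl)) → vertices⁻ (S.pathOf i) (Graph.~⇒∈ (S.block i) (Graph.~-sym (S.block i) e))
          ; (there (there z∈)) → vertices⁻ (S.pathOf i) (proj₁ (sub i) (vertices⁺ (T.pathOf (f i)) z∈)) })
      (≤-reflexive (length-toList (walk (S.pathOf i))))))
    where
    w = walk (T.pathOf (f i))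
    6≰5 : ¬ (6 ≤ 5)
    6≰5 (s≤s (s≤s (s≤s (s≤s (s≤s ())))))

  -- By `missing-≤1`, once a missing vertex `u` is set aside all other source vertices lie in the
  -- target.
  target-order : v ∸ 1 ≤ n
  target-order with ⊆-or-missing S.V T.V
  ... | inj₁ V⊆ = ≤-trans (m∸n≤m v 1) (subst₂ _≤_ S.K-order T.K-order (unique-⊆-length (Graph.unique S.K) V⊆))
  ... | inj₂ (u , u∈ , u∉) with V′ , p ← ∈⇒↭ u∈ with (u∉V′ ∷ w) ← unique-↭ p (Graph.unique S.K) =
    subst₂ (λ l m → l ∸ 1 ≤ m) (trans (sym (↭-length p)) S.K-order) T.K-order (unique-⊆-length w inside)
    where
    inside : V′ ⊆ₗ T.V
    inside {x} x∈ with decide-∈ _≟_ x T.V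
    ... | yes x∈N = x∈N
    ... | no x∉N = ⊥-elim (missing-≤1 u∈ (∈-resp-↭ (↭-sym p) (there x∈)) u∉ x∉N (All.lookup u∉V′ x∈))

  -- A vertex of degree two in a block is on every path with three edges inside that block.
  target-order-internal : (∀ {x} → x ∈ S.V → ∃ λ i → ∃₂ λ y z → y ≢ z × S.block i ⊢ x ~ y × S.block i ⊢ x ~ z) → v ≤ n
  target-order-internal internal with ⊆-or-missing S.V T.V
  ... | inj₁ V⊆ = subst₂ _≤_ S.K-order T.K-order (unique-⊆-length (Graph.unique S.K) V⊆)
  ... | inj₂ (u , u∈ , u∉) with i , y , z , y≢z , uy , uz ← internal u∈ = ⊥-elim (10≰8
      (≤-trans (≤-reflexive (cong (4 +_) (sym (length-darts w)))) (≤-trans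
        (unique-⊆-length {xs = (u , y) ∷ (y , u) ∷ (u , z) ∷ (z , u) ∷ darts w}
          (((λ { refl → Graph.~-irrefl (S.block i) refl uy }) ∷ (λ { refl → y≢z refl }) ∷ (λ { refl → Graph.~-irrefl (S.block i) refl uz }) ∷ ¬Any⇒All¬ _ source∉)
            ∷ ((λ { refl → Graph.~-irrefl (S.block i) refl uy }) ∷ (λ { refl → y≢z refl }) ∷ ¬Any⇒All¬ _ target∉)
            ∷ ((λ { refl → Graph.~-irrefl (S.block i) refl uz }) ∷ ¬Any⇒All¬ _ source∉)
            ∷ ¬Any⇒All¬ _ target∉ ∷ darts-unique (walk-distinct (T.pathOf (f i))))
          λ { (here refl) → edges⁻ (S.pathOf i) uy
            ; (there (here refl)) → edges⁻ (S.pathOf i) (Graph.~-sym (S.block i) uy)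
            ; (there (there (here refl))) → edges⁻ (S.pathOf i) uz
            ; (there (there (there (here refl)))) → edges⁻ (S.pathOf i) (Graph.~-sym (S.block i) uz)
            ; {_ , _} (there (there (there (there e)))) → edges⁻ (S.pathOf i) (proj₂ (sub i) (edges⁺ (T.pathOf (f i)) e)) })
        (≤-reflexive (length-darts (walk (S.pathOf i)))))))
    where
    w = walk (T.pathOf (f i))
    10≰8 : ¬ (10 ≤ 8)
    10≰8 (s≤s (s≤s (s≤s (s≤s (s≤s (s≤s (s≤s (s≤s ()))))))))
    source∉ : ∀ {x} → (u , x) ∉ darts w
    source∉ e = u∉ (target∈ i (darts⇒∈ w e))
    target∉ : ∀ {x} → (x , u) ∉ darts w
    target∉ e = source∉ (darts-sym w e)

-- Extending a packing by two apexes; targets of order at least v + 2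

Undirected : List Dart → Set
Undirected E = ∃ λ L → both L ↭ E

both-++ : ∀ L M → both (L ++ M) ≡ both L ++ both M
both-++ []            M = refl
both-++ ((x , y) ∷ L) M = cong (λ E → _ ∷ _ ∷ E) (both-++ L M)

undirected-++ : ∀ {E F} → Undirected E → Undirected F → Undirected (E ++ F)
undirected-++ (L , p) (M , q) = L ++ M , ↭-trans (↭-reflexive (both-++ L M)) (++⁺ p q)

undirected-star : ∀ x ys → Undirected (star x ys)
undirected-star x []       = [] , ↭-refl
undirected-star x (y ∷ ys) with L , p ← undirected-star x ys = (x , y) ∷ L , Perm.prep _ (Perm.prep _ p)

undirected-bip : ∀ xs ys → Undirected (bip xs ys)
undirected-bip []       ys = [] , ↭-refl
undirected-bip (x ∷ xs) ys = undirected-++ (undirected-star x ys) (undirected-bip xs ys)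

undirected-complete : ∀ xs → Undirected (complete xs)
undirected-complete []       = [] , ↭-refl
undirected-complete (x ∷ xs) = undirected-++ (undirected-star x xs) (undirected-complete xs)

3∣complete : (N : List ℕ) → length N % 3 ≡ 0 ⊎ length N % 3 ≡ 1 → 3 ∣ length (complete N)
3∣complete []       _ = divides 0 refl
3∣complete (x ∷ xs) r = subst (3 ∣_) (sym product) (factor r)
  where
  m = length xs
  product : length (complete (x ∷ xs)) ≡ m * suc m
  product = +-cancelʳ-≡ (suc m) _ _ (trans (length-complete (x ∷ xs)) (lemma m))
    where
    lemma : ∀ m → suc m * suc m ≡ m * suc m + suc m
    lemma = solve-∀
  factor : suc m % 3 ≡ 0 ⊎ suc m % 3 ≡ 1 → 3 ∣ m * suc m
  factor (inj₁ e) = ∣n⇒∣m*n m (m%n≡0⇒n∣m (suc m) 3 e)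
  factor (inj₂ e) = ∣m⇒∣m*n (suc m) (m%n≡0⇒n∣m m 3 (suc-%-3 m e))

-- The prescribed paths `ts` are kept as they are, and the cone construction is applied to the edges
-- `E` outside them. It has the required divisibility because the whole complete graph has it and
-- each prescribed path takes six darts.
extend-packing : ∀ {a b U E} (ts : List (Vec ℕ 4)) → All Distinct ts → Undirected E →
  E ++ concatMap darts ts ↭ complete U → Unique (a ∷ b ∷ U) → 3 ≤ length U →
  (2 + length U) % 3 ≡ 0 ⊎ (2 + length U) % 3 ≡ 1 →
  ∃ λ (D : Decomposition 4 (complete (a ∷ b ∷ U))) → ts ⊆ₗ paths D
extend-packing {a} {b} {U} {E} ts ds (L , p) eq u@((a≢b ∷ a∉) ∷ b∉ ∷ w) 3≤ mod =
  recover total (decomposition ts ds ↭-refl ⊕ cone-decomposition L (apexes a≢b (All¬⇒¬Any a∉) (All¬⇒¬Any b∉) w) 3≤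
    (unique-++⁻ˡ (both L) (unique-↭ (↭-sym within) (complete-unique w)))
    (λ e → ∈-complete⁻ U (∈-resp-↭ within (∈-++⁺ˡ (∈-both e))))
    (∣m+n∣m⇒∣n {m = length ts * 6} (subst (3 ∣_) counted (3∣complete (a ∷ b ∷ U) mod)) (∣n⇒∣m*n (length ts) 3∣6)))
  , ∈-++⁺ˡ
  where
  C = both L ++ bip U (a ∷ b ∷ []) ++ darts (a ∷ b ∷ [])
  within : both L ++ concatMap darts ts ↭ complete U
  within = ↭-trans (++⁺ʳ _ p) eq
  ∈-both : ∀ {L e} → e ∈ L → e ∈ both L
  ∈-both (here refl) = here refl
  ∈-both (there e∈)  = there (there (∈-both e∈))
  total : concatMap darts ts ++ C ↭ complete (a ∷ b ∷ U)
  total = ↭-trans (solve 4 (λ t l B ab → t ∙ (l ∙ (B ∙ ab)) ⊜ ab ∙ (B ∙ (l ∙ t))) ↭-refl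
      (concatMap darts ts) (both L) (bip U (a ∷ b ∷ [])) (darts (a ∷ b ∷ [])))
    (↭-trans (++⁺ˡ (darts (a ∷ b ∷ [])) (++⁺ (bip-comm U (a ∷ b ∷ [])) within))
      (solve 4 (λ ab A B K → ab ∙ ((A ∙ (B ∙ ε)) ∙ K) ⊜ (ab ∙ A) ∙ (B ∙ K)) ↭-refl
        (darts (a ∷ b ∷ [])) (star a U) (star b U) (complete U)))
  3∣6 : 3 ∣ 6
  3∣6 = divides 2 refl
  counted : length (complete (a ∷ b ∷ U)) ≡ length ts * 6 + length C
  counted = trans (sym (↭-length total)) (trans (length-++ (concatMap darts ts)) (cong (_+ length C) (length-concatMap-darts ts)))

-- Blocks are listed in the direction in which the edge to be removed comes first.
removedEdge : Vec ℕ 5 → Dart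
removedEdge (x ∷ y ∷ _) = x , y

split-blocks : (bs : List (Vec ℕ 5)) →
  concatMap darts bs ↭ both (map removedEdge bs) ++ concatMap darts (map Vec.tail bs)
split-blocks [] = ↭-refl
split-blocks (b@(x ∷ y ∷ p) ∷ bs) = ↭-trans (++⁺ˡ (darts b) (split-blocks bs))
  (solve 4 (λ xy t R T → (xy ∙ t) ∙ (R ∙ T) ⊜ (xy ∙ R) ∙ (t ∙ T)) ↭-refl
    (darts (x ∷ y ∷ [])) (darts (y ∷ p)) (both (map removedEdge bs)) (concatMap darts (map Vec.tail bs)))

tail-distinct : {bs : List (Vec ℕ 5)} → All Distinct bs → All Distinct (map Vec.tail bs)
tail-distinct [] = []
tail-distinct {(x ∷ p) ∷ bs} ((_ VecAllPairs.∷ d) ∷ ds) = d ∷ tail-distinct ds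

tail-⊆ : (p : Vec ℕ 5) → toList (Vec.tail p) ⊆ₗ toList p
tail-⊆ (x ∷ p) = there

tail-darts : (p : Vec ℕ 5) → darts (Vec.tail p) ⊆ₗ darts p
tail-darts (x ∷ y ∷ p) e = there (there e)

≤-sum : ∀ {x} {xs : List ℕ} → x ∈ xs → x ≤ sum xs
≤-sum {xs = x ∷ xs} (here refl) = m≤m+n x (sum xs)
≤-sum {xs = y ∷ xs} (there x∈)  = ≤-trans (≤-sum x∈) (m≤n+m (sum xs) y)

fresh : ∀ {V} k → Unique V → ∃ λ W → length W ≡ k × Unique (W ++ V)
fresh zero    u = [] , refl , u
fresh {V} (suc k) u with W , len , w ← fresh k u =
  suc (sum (W ++ V)) ∷ W , cong suc len , ¬Any⇒All¬ _ (λ x∈ → <-irrefl refl (≤-sum x∈)) ∷ w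

-- Of the n - v new vertices two become the apexes; the others form `W` and join the vertices among
-- which the greedy packing takes place. The tail of a block is its image.
links-to-large : ∀ {v n} (𝓑 : DesignOfOrder v (path 5)) → v > 1 → n ≥ v + 2 → n % 3 ≡ 0 ⊎ n % 3 ≡ 1 → DownLinkedTo-P₄ 𝓑 n
links-to-large {v} {n} 𝓑 v>1 n≥ mod with fresh (2 + (n ∸ (v + 2))) (Graph.unique (DesignOfOrder.K 𝓑))
... | a ∷ b ∷ W , len , u =
  downLinked 𝓑 |N| u (proj₁ extended) λ i →
    Vec.tail (walk (pathOf i)) , proj₂ extended (∈-map⁺ Vec.tail (∈-tabulate⁺ i))
    , vertices⁺ (pathOf i) ∘ tail-⊆ (walk (pathOf i)) , λ e → edges⁺ (pathOf i) (tail-darts (walk (pathOf i)) e)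
  where
  open Extract 𝓑
  bs = paths decomposed
  |N| : 2 + length (W ++ V) ≡ n
  |N| = begin
    2 + length (W ++ V)            ≡⟨ cong (2 +_) (length-++ W) ⟩
    2 + length W + length V        ≡⟨ cong₂ _+_ len K-order ⟩
    2 + (n ∸ (v + 2)) + v          ≡⟨ lemma (n ∸ (v + 2)) v ⟩
    v + 2 + (n ∸ (v + 2))          ≡⟨ m+[n∸m]≡n n≥ ⟩
    n                              ∎
    where
    open ≡-Reasoning
    lemma : ∀ m v → 2 + m + v ≡ v + 2 + m
    lemma = solve-∀
  -- The order 2 is neither 0 nor 1 modulo 8.
  3≤v : 3 ≤ v
  3≤v = big v>1 (P₅-order 𝓑)
    where
    big : ∀ {v} → v > 1 → v % 8 ≡ 0 ⊎ v % 8 ≡ 1 → 3 ≤ v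
    big {suc zero} (s≤s ()) _
    big {suc (suc zero)} _ (inj₁ ())
    big {suc (suc zero)} _ (inj₂ ())
    big {suc (suc (suc v))} _ _ = s≤s (s≤s (s≤s z≤n))
  total : (both (map removedEdge bs) ++ bip W V ++ complete W) ++ concatMap darts (map Vec.tail bs) ↭ complete (W ++ V)
  total = ↭-trans (solve 4 (λ R B K T → (R ∙ (B ∙ K)) ∙ T ⊜ K ∙ (B ∙ (R ∙ T))) ↭-refl
      (both (map removedEdge bs)) (bip W V) (complete W) (concatMap darts (map Vec.tail bs)))
    (↭-trans (++⁺ˡ (complete W) (++⁺ˡ (bip W V) (↭-trans (↭-sym (split-blocks bs)) (covers decomposed))))
      (↭-sym (complete-++ W V)))
  extended = extend-packing (map Vec.tail bs) (tail-distinct (distinct decomposed))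
    (undirected-++ (map removedEdge bs , ↭-refl) (undirected-++ (undirected-bip W V) (undirected-complete W)))
    total u (≤-trans (subst (3 ≤_) (sym K-order) 3≤v) (≤-trans (m≤n+m (length V) (length W)) (≤-reflexive (sym (length-++ W)))))
    (subst (λ m → m % 3 ≡ 0 ⊎ m % 3 ≡ 1) (sym |N|) mod)

-- Gluing partial designs

pick : Bool → List ℕ → List ℕ
pick true  S = S
pick false S = []

pick-++ : ∀ b S T → pick b (S ++ T) ≡ pick b S ++ pick b T
pick-++ true  S T = refl
pick-++ false S T = refl

pick-↭ : ∀ b {S T} → S ↭ T → pick b S ↭ pick b T
pick-↭ true  p = p
pick-↭ false p = ↭-refl

map-pick : ∀ b (φ : ℕ → ℕ) S → map φ (pick b S) ≡ pick b (map φ S)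
map-pick true  φ S = refl
map-pick false φ S = refl

middleOf : Vec ℕ 5 → List ℕ
middleOf (_ ∷ x ∷ y ∷ z ∷ _ ∷ []) = x ∷ y ∷ z ∷ []

Internal : List (Vec ℕ 5) → ℕ → Set
Internal bs x = Any (λ b → x ∈ middleOf b) bs

-- A piece of a P₅-design: the tails are to be lengthened at their heads by one and the same further
-- vertex. With the first flag, the heads of the tails run once through S; without it there are no
-- tails. With the second flag, every vertex of S is an inner vertex of some block.
record Kit (b b′ : Bool) (S : List ℕ) (E : List Dart) : Set where
  constructor kit
  field
    tails           : List (Vec ℕ 4)
    blocks          : List (Vec ℕ 5)
    tails-distinct : All Distinct tails
    blocks-distinct : All Distinct blocks
    exhausts        : concatMap darts tails ++ concatMap darts blocks ↭ E
    heads           : map Vec.head tails ↭ pick b S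
    internal        : All (Internal blocks) (pick b′ S)

open Kit public

-- The condition for a target without spare vertices: tails and shortened blocks are already copies
-- of `P₄`, and the removed edges must form further copies among themselves.
Linked : ∀ {b b′ S E} → Kit b b′ S E → Set
Linked k = Decomposition 4 (both (map removedEdge (blocks k)))

kit-↭ : ∀ {b b′ S T E F} → S ↭ T → E ↭ F → Kit b b′ S E → Kit b b′ T F
kit-↭ {b} {b′} p q (kit ts bs dt db ex hs int) = kit ts bs dt db (↭-trans ex q) (↭-trans hs (pick-↭ b p))
  (All-resp-↭ (pick-↭ b′ p) int)

pick-[] : ∀ b → pick b [] ≡ []
pick-[] true  = refl
pick-[] false = refl

kit-∅ : ∀ {b b′} → Kit b b′ [] []
kit-∅ {b} {b′} = kit [] [] [] [] ↭-refl (↭-reflexive (sym (pick-[] b))) (subst (All _) (sym (pick-[] b′)) [])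

infixr 5 _⊞_
_⊞_ : ∀ {b b′ S T E F} → Kit b b′ S E → Kit b b′ T F → Kit b b′ (S ++ T) (E ++ F)
_⊞_ {b} {b′} {S} {T} (kit ts bs dt db ex hs int) (kit ts′ bs′ dt′ db′ ex′ hs′ int′) =
  kit (ts ++ ts′) (bs ++ bs′) (All.++⁺ dt dt′) (All.++⁺ db db′)
    (↭-trans (↭-reflexive (cong₂ _++_ (concatMap-++ darts ts ts′) (concatMap-++ darts bs bs′)))
      (↭-trans (solve 4 (λ a b c d → (a ∙ b) ∙ (c ∙ d) ⊜ (a ∙ c) ∙ (b ∙ d)) ↭-refl
        (concatMap darts ts) (concatMap darts ts′) (concatMap darts bs) (concatMap darts bs′)) (++⁺ ex ex′)))
    (↭-trans (↭-reflexive (map-++ Vec.head ts ts′)) (↭-trans (++⁺ hs hs′) (↭-reflexive (sym (pick-++ b S T)))))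
    (subst (All _) (sym (pick-++ b′ S T)) (All.++⁺ (All.map any-++⁺ˡ int) (All.map (any-++⁺ʳ bs) int′)))

linked-⊞ : ∀ {b b′ S T E F} (k : Kit b b′ S E) (l : Kit b b′ T F) → Linked k → Linked l → Linked (k ⊞ l)
linked-⊞ k l D D′ = recover (↭-reflexive (sym (trans (cong both (map-++ removedEdge (blocks k) (blocks l))) (both-++ (map removedEdge (blocks k)) _)))) (D ⊕ D′)

-- Relabelling of vertices

mapDart : (ℕ → ℕ) → Dart → Dart
mapDart φ (x , y) = φ x , φ y

module Relabelling (φ : ℕ → ℕ) where

  map-star : ∀ x ys → map (mapDart φ) (star x ys) ≡ star (φ x) (map φ ys)
  map-star x []       = refl
  map-star x (y ∷ ys) = cong (λ E → _ ∷ _ ∷ E) (map-star x ys)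

  map-bip : ∀ xs ys → map (mapDart φ) (bip xs ys) ≡ bip (map φ xs) (map φ ys)
  map-bip []       ys = refl
  map-bip (x ∷ xs) ys = trans (map-++ _ (star x ys) (bip xs ys)) (cong₂ _++_ (map-star x ys) (map-bip xs ys))

  map-complete : ∀ xs → map (mapDart φ) (complete xs) ≡ complete (map φ xs)
  map-complete []       = refl
  map-complete (x ∷ xs) = trans (map-++ _ (star x xs) (complete xs)) (cong₂ _++_ (map-star x xs) (map-complete xs))

  map-both : ∀ L → map (mapDart φ) (both L) ≡ both (map (mapDart φ) L)
  map-both []      = refl
  map-both (_ ∷ L) = cong (λ E → _ ∷ _ ∷ E) (map-both L)

  map-darts : ∀ {n} (p : Vec ℕ n) → map (mapDart φ) (darts p) ≡ darts (Vec.map φ p)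
  map-darts []          = refl
  map-darts (x ∷ [])    = refl
  map-darts (x ∷ y ∷ p) = cong (λ E → _ ∷ _ ∷ E) (map-darts (y ∷ p))

  map-concatMap-darts : ∀ {n} (ps : List (Vec ℕ n)) → map (mapDart φ) (concatMap darts ps) ≡ concatMap darts (map (Vec.map φ) ps)
  map-concatMap-darts []       = refl
  map-concatMap-darts (p ∷ ps) = trans (map-++ _ (darts p) _) (cong₂ _++_ (map-darts p) (map-concatMap-darts ps))

  module _ (injective : ∀ {x y} → φ x ≡ φ y → x ≡ y) where

    map-distinct : ∀ {n} {ps : List (Vec ℕ n)} → All Distinct ps → All Distinct (map (Vec.map φ) ps)
    map-distinct []       = []
    map-distinct (d ∷ ds) = Distinct.map⁺ injective d ∷ map-distinct ds

    relabelDecomposition : ∀ {k E} → Decomposition k E → Decomposition k (map (mapDart φ) E)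
    relabelDecomposition (decomposition ps ds eq) = decomposition (map (Vec.map φ) ps) (map-distinct ds)
      (↭-trans (↭-reflexive (sym (map-concatMap-darts ps))) (map⁺ (mapDart φ) eq))

    relabelKit : ∀ {b b′ S E} → Kit b b′ S E → Kit b b′ (map φ S) (map (mapDart φ) E)
    relabelKit {b} {b′} {S} (kit ts bs dt db ex hs int) = kit (map (Vec.map φ) ts) (map (Vec.map φ) bs) (map-distinct dt) (map-distinct db)
      (↭-trans (↭-reflexive (sym (trans (map-++ _ (concatMap darts ts) _) (cong₂ _++_ (map-concatMap-darts ts) (map-concatMap-darts bs)))))
        (map⁺ (mapDart φ) ex))
      (↭-trans (↭-reflexive (map-heads ts)) (↭-trans (map⁺ φ hs) (↭-reflexive (map-pick b φ S))))
      (subst (All _) (map-pick b′ φ S) (All.map⁺ (All.map (λ i → any-map⁺ (Any.map (λ {p} → map-middle p) i)) int)))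
      where
      map-heads : (ts : List (Vec ℕ 4)) → map Vec.head (map (Vec.map φ) ts) ≡ map φ (map Vec.head ts)
      map-heads []             = refl
      map-heads ((x ∷ _) ∷ ts) = cong (φ x ∷_) (map-heads ts)
      map-middle : ∀ {x} (p : Vec ℕ 5) → x ∈ middleOf p → φ x ∈ middleOf (Vec.map φ p)
      map-middle (_ ∷ x ∷ y ∷ z ∷ _ ∷ []) = ∈-map⁺ φ

    relabelLinked : ∀ {b b′ S E} (k : Kit b b′ S E) → Linked k → Linked (relabelKit k)
    relabelLinked k D = recover (↭-reflexive (trans (map-both (map removedEdge (blocks k))) (cong both (map-removed (blocks k))))) (relabelDecomposition D)
      where
      map-removed : (bs : List (Vec ℕ 5)) → map (mapDart φ) (map removedEdge bs) ≡ map removedEdge (map (Vec.map φ) bs)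
      map-removed []                 = refl
      map-removed ((x ∷ y ∷ _) ∷ bs) = cong (_ ∷_) (map-removed bs)

-- Labels beyond the list are sent to fresh vertices, which makes the relabelling injective everywhere.
label : ℕ → List ℕ → ℕ → ℕ
label d []       i       = suc (d + i)
label d (v ∷ vs) zero    = v
label d (v ∷ vs) (suc i) = label d vs i

-- The sum bounds every entry of `vs`, so labels past the end of the list are new.
labelling : List ℕ → ℕ → ℕ
labelling vs = label (sum vs) vs

labelling-injective : ∀ {vs} → Unique vs → ∀ {i j} → labelling vs i ≡ labelling vs j → i ≡ j
labelling-injective {vs} u = go vs u ≤-sum _ _
  where
  hit : ∀ {d v} vs i → v ∉ vs → v ≤ d → v ≢ label d vs i
  hit {d} []       i v∉ v≤ refl = <-irrefl refl (≤-trans (s≤s (m≤m+n d i)) v≤)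
  hit     (w ∷ vs) zero v∉ v≤ refl = v∉ (here refl)
  hit     (w ∷ vs) (suc i) v∉ v≤ eq = hit vs i (v∉ ∘ there) v≤ eq
  go : ∀ {d} vs → Unique vs → (∀ {x} → x ∈ vs → x ≤ d) → ∀ i j → label d vs i ≡ label d vs j → i ≡ j
  go {d} [] u ≤d i j eq = +-cancelˡ-≡ d i j (suc-injective eq)
  go (v ∷ vs) (v∉ ∷ u) ≤d zero    zero    eq = refl
  go (v ∷ vs) (v∉ ∷ u) ≤d zero    (suc j) eq = ⊥-elim (hit vs j (All¬⇒¬Any v∉) (≤d (here refl)) eq)
  go (v ∷ vs) (v∉ ∷ u) ≤d (suc i) zero    eq = ⊥-elim (hit vs i (All¬⇒¬Any v∉) (≤d (here refl)) (sym eq))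
  go (v ∷ vs) (v∉ ∷ u) ≤d (suc i) (suc j) eq = cong suc (go vs u (≤d ∘ there) i j eq)

applyUpTo-label : ∀ d vs → applyUpTo (label d vs) (length vs) ≡ vs
applyUpTo-label d []       = refl
applyUpTo-label d (v ∷ vs) = cong (v ∷_) (applyUpTo-label d vs)

check : (es fs : List Dart) → {Holds (is-just (permutation? es fs))} → es ↭ fs
check es fs {t} with just p ← permutation? es fs = p

allDistinct? : ∀ {n} (ps : List (Vec ℕ n)) → Dec (All Distinct ps)
allDistinct? = All.all? (λ p → map′ unique⇒distinct distinct⇒unique (unique? (toList p)))

internal? : ∀ bs S → Dec (All (Internal bs) S)
internal? bs = All.all? (λ x → any? (λ b → decide-∈ _≟_ x (middleOf b)) bs)

-- All side conditions on the explicit lists are settled by evaluation. The direction of the paths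
-- matters: a tail is lengthened at its first vertex and a block loses its first edge.
table : (b b′ : Bool) (ts : List (Vec ℕ 4)) (bs : List (Vec ℕ 5)) (S : List ℕ) (E : List Dart) →
  {True (allDistinct? ts)} → {True (allDistinct? bs)} → {True (internal? bs (pick b′ S))} →
  {Holds (is-just (permutation? (concatMap darts ts ++ concatMap darts bs) E))} → map Vec.head ts ≡ pick b S → Kit b b′ S E
table b b′ ts bs S E {dt} {db} {int} {ex} hs =
  kit ts bs (toWitness dt) (toWitness db) (check _ _ {ex}) (↭-reflexive hs) (toWitness int)

tableDecomposition : ∀ {k} (ps : List (Vec ℕ k)) (E : List Dart) → {True (allDistinct? ps)} →
  {Holds (is-just (permutation? (concatMap darts ps) E))} → Decomposition k E
tableDecomposition ps E {d} {c} = decomposition ps (toWitness d) (check _ _ {c})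

-- K₇-ends and K₉-internal develop a single path cyclically; the other tables were found by a computer search.
K₇-ends : Kit true false (upTo 7) (complete (upTo 7))
K₇-ends = table true false
  ((0 ∷ 1 ∷ 3 ∷ 6 ∷ []) ∷ (1 ∷ 2 ∷ 4 ∷ 0 ∷ []) ∷ (2 ∷ 3 ∷ 5 ∷ 1 ∷ []) ∷ (3 ∷ 4 ∷ 6 ∷ 2 ∷ []) ∷ (4 ∷ 5 ∷ 0 ∷ 3 ∷ [])
   ∷ (5 ∷ 6 ∷ 1 ∷ 4 ∷ []) ∷ (6 ∷ 0 ∷ 2 ∷ 5 ∷ []) ∷ [])
  []
  _ _ refl

-- All seven paths are tails, so no edge is removed.
K₇-ends-linked : Linked K₇-ends
K₇-ends-linked = tableDecomposition [] _

K₈-ends : Kit true false (upTo 8) (complete (upTo 8))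
K₈-ends = table true false
  ((0 ∷ 7 ∷ 2 ∷ 6 ∷ []) ∷ (1 ∷ 0 ∷ 6 ∷ 7 ∷ []) ∷ (2 ∷ 0 ∷ 4 ∷ 3 ∷ []) ∷ (3 ∷ 7 ∷ 5 ∷ 6 ∷ []) ∷ (4 ∷ 5 ∷ 1 ∷ 6 ∷ [])
   ∷ (5 ∷ 2 ∷ 1 ∷ 7 ∷ []) ∷ (6 ∷ 3 ∷ 5 ∷ 0 ∷ []) ∷ (7 ∷ 4 ∷ 2 ∷ 3 ∷ []) ∷ [])
  ((6 ∷ 4 ∷ 1 ∷ 3 ∷ 0 ∷ []) ∷ [])
  _ _ refl

K₈-internal : Kit false true (upTo 8) (complete (upTo 8))
K₈-internal = table false true
  []
  ((0 ∷ 1 ∷ 4 ∷ 5 ∷ 6 ∷ []) ∷ (1 ∷ 2 ∷ 3 ∷ 0 ∷ 5 ∷ []) ∷ (2 ∷ 7 ∷ 6 ∷ 3 ∷ 5 ∷ []) ∷ (3 ∷ 7 ∷ 0 ∷ 6 ∷ 4 ∷ [])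
   ∷ (4 ∷ 2 ∷ 6 ∷ 1 ∷ 7 ∷ []) ∷ (4 ∷ 3 ∷ 1 ∷ 5 ∷ 7 ∷ []) ∷ (5 ∷ 2 ∷ 0 ∷ 4 ∷ 7 ∷ []) ∷ [])
  _ _ refl

-- The steps of the base path 0 1 8 2 7 are 1, -2, 3, -4 modulo 9: every nonzero difference occurs
-- once up to sign, so the nine translates share no edge.
K₉-internal : Kit false true (upTo 9) (complete (upTo 9))
K₉-internal = table false true
  []
  ((0 ∷ 1 ∷ 8 ∷ 2 ∷ 7 ∷ []) ∷ (1 ∷ 2 ∷ 0 ∷ 3 ∷ 8 ∷ []) ∷ (2 ∷ 3 ∷ 1 ∷ 4 ∷ 0 ∷ []) ∷ (3 ∷ 4 ∷ 2 ∷ 5 ∷ 1 ∷ [])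
   ∷ (4 ∷ 5 ∷ 3 ∷ 6 ∷ 2 ∷ []) ∷ (5 ∷ 6 ∷ 4 ∷ 7 ∷ 3 ∷ []) ∷ (6 ∷ 7 ∷ 5 ∷ 8 ∷ 4 ∷ []) ∷ (7 ∷ 8 ∷ 6 ∷ 0 ∷ 5 ∷ [])
   ∷ (8 ∷ 0 ∷ 7 ∷ 1 ∷ 6 ∷ []) ∷ [])
  _ _ refl

-- The removed edges join `i` to `i + 1` modulo 9; this nine-cycle is cut into three paths.
K₉-internal-linked : Linked K₉-internal
K₉-internal-linked = tableDecomposition ((0 ∷ 1 ∷ 2 ∷ 3 ∷ []) ∷ (3 ∷ 4 ∷ 5 ∷ 6 ∷ []) ∷ (6 ∷ 7 ∷ 8 ∷ 0 ∷ []) ∷ []) _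

K₉-ends : Kit true false (map suc (upTo 8)) (complete (upTo 9))
K₉-ends = table true false
  ((1 ∷ 3 ∷ 2 ∷ 5 ∷ []) ∷ (2 ∷ 7 ∷ 5 ∷ 3 ∷ []) ∷ (3 ∷ 6 ∷ 2 ∷ 1 ∷ []) ∷ (4 ∷ 5 ∷ 0 ∷ 7 ∷ []) ∷ (5 ∷ 1 ∷ 8 ∷ 6 ∷ [])
   ∷ (6 ∷ 4 ∷ 8 ∷ 7 ∷ []) ∷ (7 ∷ 4 ∷ 0 ∷ 2 ∷ []) ∷ (8 ∷ 3 ∷ 0 ∷ 1 ∷ []) ∷ [])
  ((2 ∷ 4 ∷ 3 ∷ 7 ∷ 1 ∷ []) ∷ (2 ∷ 8 ∷ 5 ∷ 6 ∷ 7 ∷ []) ∷ (4 ∷ 1 ∷ 6 ∷ 0 ∷ 8 ∷ []) ∷ [])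
  _ _ refl

K₉-ends-linked : Linked K₉-ends
K₉-ends-linked = tableDecomposition ((8 ∷ 2 ∷ 4 ∷ 1 ∷ []) ∷ []) _

K₁₆-plain : Kit false false [] (complete (upTo 16))
K₁₆-plain = table false false
  []
  ((1 ∷ 11 ∷ 10 ∷ 4 ∷ 14 ∷ []) ∷ (2 ∷ 6 ∷ 3 ∷ 10 ∷ 9 ∷ []) ∷ (2 ∷ 11 ∷ 5 ∷ 4 ∷ 15 ∷ []) ∷ (2 ∷ 13 ∷ 3 ∷ 11 ∷ 4 ∷ [])
   ∷ (2 ∷ 14 ∷ 11 ∷ 12 ∷ 4 ∷ []) ∷ (3 ∷ 0 ∷ 1 ∷ 4 ∷ 13 ∷ []) ∷ (3 ∷ 2 ∷ 0 ∷ 12 ∷ 10 ∷ []) ∷ (3 ∷ 4 ∷ 9 ∷ 14 ∷ 10 ∷ [])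
   ∷ (3 ∷ 12 ∷ 2 ∷ 10 ∷ 0 ∷ []) ∷ (3 ∷ 14 ∷ 0 ∷ 4 ∷ 6 ∷ []) ∷ (3 ∷ 15 ∷ 14 ∷ 7 ∷ 9 ∷ []) ∷ (4 ∷ 2 ∷ 7 ∷ 6 ∷ 1 ∷ [])
   ∷ (5 ∷ 1 ∷ 8 ∷ 14 ∷ 6 ∷ []) ∷ (5 ∷ 3 ∷ 1 ∷ 13 ∷ 15 ∷ []) ∷ (5 ∷ 8 ∷ 0 ∷ 7 ∷ 12 ∷ []) ∷ (5 ∷ 10 ∷ 1 ∷ 7 ∷ 8 ∷ [])
   ∷ (5 ∷ 12 ∷ 15 ∷ 1 ∷ 14 ∷ []) ∷ (6 ∷ 15 ∷ 2 ∷ 8 ∷ 3 ∷ []) ∷ (7 ∷ 3 ∷ 9 ∷ 12 ∷ 1 ∷ []) ∷ (7 ∷ 4 ∷ 8 ∷ 13 ∷ 12 ∷ [])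
   ∷ (10 ∷ 6 ∷ 5 ∷ 15 ∷ 9 ∷ []) ∷ (10 ∷ 7 ∷ 11 ∷ 0 ∷ 13 ∷ []) ∷ (10 ∷ 8 ∷ 6 ∷ 9 ∷ 11 ∷ []) ∷ (10 ∷ 15 ∷ 11 ∷ 13 ∷ 14 ∷ [])
   ∷ (12 ∷ 6 ∷ 0 ∷ 15 ∷ 7 ∷ []) ∷ (13 ∷ 5 ∷ 0 ∷ 9 ∷ 1 ∷ []) ∷ (13 ∷ 7 ∷ 5 ∷ 2 ∷ 1 ∷ []) ∷ (14 ∷ 5 ∷ 9 ∷ 13 ∷ 10 ∷ [])
   ∷ (14 ∷ 12 ∷ 8 ∷ 9 ∷ 2 ∷ []) ∷ (15 ∷ 8 ∷ 11 ∷ 6 ∷ 13 ∷ []) ∷ [])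
  _ _ refl

K₁₆-plain-linked : Linked K₁₆-plain
K₁₆-plain-linked = tableDecomposition ((1 ∷ 11 ∷ 2 ∷ 6 ∷ []) ∷ (4 ∷ 2 ∷ 14 ∷ 5 ∷ []) ∷ (7 ∷ 3 ∷ 5 ∷ 12 ∷ []) ∷ (7 ∷ 4 ∷ 3 ∷ 2 ∷ []) ∷ (8 ∷ 5 ∷ 13 ∷ 2 ∷ [])
   ∷ (8 ∷ 10 ∷ 5 ∷ 1 ∷ []) ∷ (8 ∷ 15 ∷ 3 ∷ 14 ∷ []) ∷ (12 ∷ 6 ∷ 15 ∷ 10 ∷ []) ∷ (13 ∷ 7 ∷ 10 ∷ 6 ∷ []) ∷ (14 ∷ 12 ∷ 3 ∷ 0 ∷ []) ∷ []) _

K₁₆-ends : Kit true false (upTo 16) (complete (upTo 16))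
K₁₆-ends = table true false
  ((0 ∷ 7 ∷ 6 ∷ 1 ∷ []) ∷ (1 ∷ 0 ∷ 12 ∷ 7 ∷ []) ∷ (2 ∷ 7 ∷ 10 ∷ 9 ∷ []) ∷ (3 ∷ 8 ∷ 9 ∷ 2 ∷ []) ∷ (4 ∷ 8 ∷ 0 ∷ 14 ∷ [])
   ∷ (5 ∷ 8 ∷ 2 ∷ 14 ∷ []) ∷ (6 ∷ 3 ∷ 12 ∷ 4 ∷ []) ∷ (7 ∷ 3 ∷ 1 ∷ 5 ∷ []) ∷ (8 ∷ 13 ∷ 1 ∷ 10 ∷ []) ∷ (9 ∷ 4 ∷ 10 ∷ 11 ∷ [])
   ∷ (10 ∷ 14 ∷ 9 ∷ 13 ∷ []) ∷ (11 ∷ 13 ∷ 10 ∷ 5 ∷ []) ∷ (12 ∷ 9 ∷ 6 ∷ 0 ∷ []) ∷ (13 ∷ 3 ∷ 15 ∷ 4 ∷ []) ∷ (14 ∷ 11 ∷ 4 ∷ 13 ∷ [])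
   ∷ (15 ∷ 12 ∷ 13 ∷ 7 ∷ []) ∷ [])
  ((0 ∷ 9 ∷ 1 ∷ 8 ∷ 15 ∷ []) ∷ (0 ∷ 11 ∷ 8 ∷ 12 ∷ 2 ∷ []) ∷ (1 ∷ 15 ∷ 10 ∷ 6 ∷ 14 ∷ []) ∷ (5 ∷ 0 ∷ 2 ∷ 10 ∷ 12 ∷ [])
   ∷ (9 ∷ 3 ∷ 4 ∷ 0 ∷ 10 ∷ []) ∷ (9 ∷ 5 ∷ 6 ∷ 2 ∷ 4 ∷ []) ∷ (9 ∷ 7 ∷ 8 ∷ 14 ∷ 12 ∷ []) ∷ (9 ∷ 11 ∷ 6 ∷ 13 ∷ 0 ∷ [])
   ∷ (9 ∷ 15 ∷ 0 ∷ 3 ∷ 5 ∷ []) ∷ (10 ∷ 3 ∷ 2 ∷ 1 ∷ 4 ∷ []) ∷ (11 ∷ 2 ∷ 5 ∷ 7 ∷ 15 ∷ []) ∷ (11 ∷ 12 ∷ 6 ∷ 4 ∷ 7 ∷ [])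
   ∷ (11 ∷ 15 ∷ 6 ∷ 8 ∷ 10 ∷ []) ∷ (14 ∷ 7 ∷ 1 ∷ 12 ∷ 5 ∷ []) ∷ (15 ∷ 2 ∷ 13 ∷ 5 ∷ 14 ∷ []) ∷ (15 ∷ 5 ∷ 11 ∷ 1 ∷ 14 ∷ [])
   ∷ (15 ∷ 13 ∷ 14 ∷ 4 ∷ 5 ∷ []) ∷ (15 ∷ 14 ∷ 3 ∷ 11 ∷ 7 ∷ []) ∷ [])
  _ _ refl

K₁₆-ends-linked : Linked K₁₆-ends
K₁₆-ends-linked = tableDecomposition ((1 ∷ 15 ∷ 11 ∷ 12 ∷ []) ∷ (5 ∷ 9 ∷ 0 ∷ 11 ∷ []) ∷ (10 ∷ 3 ∷ 9 ∷ 15 ∷ []) ∷ (13 ∷ 15 ∷ 5 ∷ 0 ∷ []) ∷ (15 ∷ 2 ∷ 11 ∷ 9 ∷ [])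
   ∷ (15 ∷ 14 ∷ 7 ∷ 9 ∷ []) ∷ []) _

-- The part of size three is the smallest possible with linking: K(m,8) has 2m blocks, and their 2m
-- removed edges must be divisible into threes.
K₃₈ : Kit false false [] (bip (0 ∷ 1 ∷ 2 ∷ []) (map (3 +_) (upTo 8)))
K₃₈ = table false false
  []
  ((4 ∷ 2 ∷ 7 ∷ 0 ∷ 3 ∷ []) ∷ (5 ∷ 0 ∷ 4 ∷ 1 ∷ 7 ∷ []) ∷ (5 ∷ 2 ∷ 6 ∷ 1 ∷ 8 ∷ []) ∷ (6 ∷ 0 ∷ 9 ∷ 2 ∷ 10 ∷ [])
   ∷ (8 ∷ 0 ∷ 10 ∷ 1 ∷ 5 ∷ []) ∷ (8 ∷ 2 ∷ 3 ∷ 1 ∷ 9 ∷ []) ∷ [])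
  _ _ refl

K₃₈-linked : Linked K₃₈
K₃₈-linked = tableDecomposition ((0 ∷ 5 ∷ 2 ∷ 4 ∷ []) ∷ (6 ∷ 0 ∷ 8 ∷ 2 ∷ []) ∷ []) _

K₂₄ : Kit false false [] (bip (0 ∷ 1 ∷ []) (map (2 +_) (upTo 4)))
K₂₄ = table false false
  []
  ((2 ∷ 0 ∷ 3 ∷ 1 ∷ 4 ∷ []) ∷ (4 ∷ 0 ∷ 5 ∷ 1 ∷ 2 ∷ []) ∷ [])
  _ _ refl

-- The removed edges must be packable for targets of order v ∸ 1 and v only. Making this a flag lets
-- one set of gluing lemmas serve all constructions.
LinkedIf : ∀ {b b′ S E} → Bool → Kit b b′ S E → Set
LinkedIf true  k = Linked k
LinkedIf false k = ⊤

Piece : Bool → Bool → Bool → List ℕ → List Dart → Set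
Piece l b b′ S E = ∃ λ (k : Kit b b′ S E) → LinkedIf l k

piece-↭ : ∀ {l b b′ S T E F} → S ↭ T → E ↭ F → Piece l b b′ S E → Piece l b b′ T F
piece-↭ {true}  p q (k , D) = kit-↭ p q k , D
piece-↭ {false} p q (k , _) = kit-↭ p q k , tt

infixr 5 _⊎ₚ_
_⊎ₚ_ : ∀ {l b b′ S T E F} → Piece l b b′ S E → Piece l b b′ T F → Piece l b b′ (S ++ T) (E ++ F)
_⊎ₚ_ {true}  (k , D) (k′ , D′) = k ⊞ k′ , linked-⊞ k k′ D D′
_⊎ₚ_ {false} (k , _) (k′ , _)  = k ⊞ k′ , tt

piece-∅ : ∀ {l b b′} → Piece l b b′ [] []
piece-∅ {true}  = kit-∅ , empty
piece-∅ {false} = kit-∅ , tt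

unlink : ∀ {b b′ S E} → Piece true b b′ S E → Piece false b b′ S E
unlink (k , _) = k , tt

blocks-only : ∀ {l b′ S E} T → Piece l false b′ S E → Piece l false false T E
blocks-only {true}  T (kit ts bs dt db ex hs _ , D) = kit ts bs dt db ex hs [] , D
blocks-only {false} T (kit ts bs dt db ex hs _ , _) = kit ts bs dt db ex hs [] , tt

kit-[] : ∀ {b b′ E} → Kit false false [] E → Kit b b′ [] E
kit-[] {b} {b′} (kit ts bs dt db ex hs int) =
  kit ts bs dt db ex (↭-trans hs (↭-reflexive (sym (pick-[] b)))) (subst (All _) (sym (pick-[] b′)) int)

piece-[] : ∀ {l b b′ E} → Piece l false false [] E → Piece l b b′ [] E
piece-[] {true}  (k , D) = kit-[] k , D
piece-[] {false} (k , _) = kit-[] k , tt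

module _ {vs : List ℕ} (u : Unique vs) where
  open Relabelling (labelling vs)

  relabelPiece : ∀ {l b b′ S E} → Piece l b b′ S E → Piece l b b′ (map (labelling vs) S) (map (mapDart (labelling vs)) E)
  relabelPiece {true}  (k , D) = relabelKit (labelling-injective u) k , relabelLinked (labelling-injective u) k D
  relabelPiece {false} (k , _) = relabelKit (labelling-injective u) k , tt

label-upTo : ∀ d vs {n} → length vs ≡ n → map (label d vs) (upTo n) ≡ vs
label-upTo d vs refl = trans (map-upTo (label d vs) (length vs)) (applyUpTo-label d vs)

-- Complete graphs assembled from pieces

Complete : Bool → Bool → Bool → ℕ → Set
Complete l b b′ n = (V : List ℕ) → Unique V → length V ≡ n → Piece l b b′ V (complete V)

spread : ∀ {l b b′ n} → Piece l b b′ (upTo n) (complete (upTo n)) → Complete l b b′ n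
spread {n = n} k V u len = piece-↭ (↭-reflexive (label-upTo (sum V) V len))
  (↭-reflexive (trans (map-complete (upTo n)) (cong complete (label-upTo (sum V) V len)))) (relabelPiece u k)
  where
  open Relabelling (labelling V)

-- The vertex `z` is shared with another piece. Its tail, or its position inside a block, is
-- supplied there, so here the conditions concern `T` alone.
Attached : Bool → Bool → Bool → Set
Attached l b b′ = (z : ℕ) (T : List ℕ) → Unique (z ∷ T) → length T ≡ 8 → Piece l b b′ T (complete (z ∷ T))

attach : ∀ {l b b′} → Piece l b b′ (map suc (upTo 8)) (complete (upTo 9)) → Attached l b b′
attach k z T u len = piece-↭ (↭-reflexive (label-upTo (sum (z ∷ T)) T len))
  (↭-reflexive (trans (map-complete (upTo 9)) (cong complete (label-upTo (sum (z ∷ T)) (z ∷ T) (cong suc len))))) (relabelPiece u k)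
  where
  open Relabelling (labelling (z ∷ T))

split : ∀ k {m} (V : List ℕ) → length V ≡ k + m → ∃₂ λ S T → V ≡ S ++ T × length S ≡ k × length T ≡ m
split zero    V       len = [] , V , refl , refl , len
split (suc k) (x ∷ V) len with S , T , refl , lenS , lenT ← split k V (suc-injective len) =
  x ∷ S , T , refl , cong suc lenS , lenT

unique-++ˡʳ : ∀ {A : Set} (xs ys {zs} : List A) → Unique (xs ++ ys ++ zs) → Unique (xs ++ ys) × Unique (xs ++ zs)
unique-++ˡʳ xs ys {zs} u = unique-++⁻ˡ (xs ++ ys) (subst Unique (sym (++-assoc xs ys zs)) u) ,
  unique-++⁻ˡ (xs ++ zs) (unique-↭ (solve 3 (λ x y z → x ∙ (y ∙ z) ⊜ (x ∙ z) ∙ y) ↭-refl xs ys zs) u)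

K₃₈-copies : ∀ {b b′} V T → Unique (V ++ T) → length T ≡ 8 → length V % 3 ≡ 0 → Piece true b b′ [] (bip V T)
K₃₈-copies [] T _ _ _ = piece-∅
K₃₈-copies (x ∷ y ∷ z ∷ V) T u len mod =
  piece-↭ ↭-refl (↭-sym (bip-++ˡ (x ∷ y ∷ z ∷ []) V T))
    (piece-[] (piece-↭ ↭-refl
        (↭-reflexive (trans (map-bip (0 ∷ 1 ∷ 2 ∷ []) (map (3 +_) (upTo 8)))
          (cong (bip (x ∷ y ∷ z ∷ [])) (label-upTo (sum (x ∷ y ∷ z ∷ T)) T len))))
        (relabelPiece w (K₃₈ , K₃₈-linked)))
      ⊎ₚ K₃₈-copies V T (proj₁ (unique-++⁻ (x ∷ y ∷ z ∷ []) u)) len mod)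
  where
  open Relabelling (labelling (x ∷ y ∷ z ∷ T))
  w : Unique (x ∷ y ∷ z ∷ T)
  w = proj₂ (unique-++ˡʳ (x ∷ y ∷ z ∷ []) V u)

K₂₄-copies : ∀ {b b′} V T → Unique (V ++ T) → length T ≡ 4 → length V % 2 ≡ 0 → Piece false b b′ [] (bip V T)
K₂₄-copies [] T _ _ _ = piece-∅
K₂₄-copies (x ∷ y ∷ V) T u len mod =
  piece-↭ ↭-refl (↭-sym (bip-++ˡ (x ∷ y ∷ []) V T))
    (piece-[] (piece-↭ ↭-refl
        (↭-reflexive (trans (map-bip (0 ∷ 1 ∷ []) (map (2 +_) (upTo 4)))
          (cong (bip (x ∷ y ∷ [])) (label-upTo (sum (x ∷ y ∷ T)) T len))))
        (relabelPiece w (K₂₄ , tt)))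
      ⊎ₚ K₂₄-copies V T (proj₁ (unique-++⁻ (x ∷ y ∷ []) u)) len mod)
  where
  open Relabelling (labelling (x ∷ y ∷ T))
  w : Unique (x ∷ y ∷ T)
  w = proj₂ (unique-++ˡʳ (x ∷ y ∷ []) V u)

CompleteBipartite : Bool → Bool → Bool → ℕ → ℕ → Set
CompleteBipartite l b b′ m n = (V T : List ℕ) → Unique (V ++ T) → length V ≡ m → length T ≡ n → Piece l b b′ [] (bip V T)

bipartite-+ʳ : ∀ {l b b′ m} k {n} → CompleteBipartite l b b′ m k → CompleteBipartite l b b′ m n → CompleteBipartite l b b′ m (k + n)
bipartite-+ʳ k p q V T u lenV lenT with S , T′ , refl , lenS , lenT′ ← split k T lenT with uS , uT ← unique-++ˡʳ V S u =
  piece-↭ ↭-refl (↭-sym (bip-++ʳ V S T′)) (p V S uS lenV lenS ⊎ₚ q V T′ uT lenV lenT′)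

bipartite-3-8 : ∀ {b b′ m} → m % 3 ≡ 0 → CompleteBipartite true b b′ m 8
bipartite-3-8 mod V T u refl len = K₃₈-copies V T u len mod

bipartite-2-4 : ∀ {b b′ m} → m % 2 ≡ 0 → CompleteBipartite false b b′ m 4
bipartite-2-4 mod V T u refl len = K₂₄-copies V T u len mod

addDisjoint : ∀ {l b b′} k {m} → Complete l b b′ k → CompleteBipartite l b b′ m k → Complete l b b′ m → Complete l b b′ (k + m)
addDisjoint k C B C′ V u len with T , V′ , refl , lenT , lenV ← split k V len =
  piece-↭ ↭-refl (↭-trans (++⁺ˡ (complete T) (++⁺ʳ (complete V′) (bip-comm V′ T))) (↭-sym (complete-++ T V′)))
    (C T (unique-++⁻ˡ T u) lenT
      ⊎ₚ B V′ T (unique-↭ (++-comm T V′) u) lenV lenT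
      ⊎ₚ C′ V′ (proj₁ (unique-++⁻ T u)) lenV)

-- Sharing `z` leaves just the `m` vertices of `V′` to be joined to `T`. Orders that exceed an even
-- number, or a multiple of 3, by one thus become accessible to the bipartite pieces.
addSharing : ∀ {l b b′ m} → Attached l b b′ → CompleteBipartite l b b′ m 8 → Complete l b b′ (suc m) → Complete l b b′ (8 + suc m)
addSharing A B C V u len with T , z ∷ V′ , refl , lenT , lenV ← split 8 V len =
  piece-↭ ↭-refl (↭-trans
      (↭-trans (solve 4 (λ s t B K → (s ∙ t) ∙ (B ∙ K) ⊜ t ∙ ((s ∙ B) ∙ K)) ↭-refl (star z T) (complete T) (bip V′ T) (complete (z ∷ V′)))
        (++⁺ˡ (complete T) (++⁺ʳ (complete (z ∷ V′)) (bip-comm (z ∷ V′) T))))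
      (↭-sym (complete-++ T (z ∷ V′))))
    (A z T (unique-++⁻ˡ (z ∷ T) shuffled) lenT
      ⊎ₚ B V′ T (proj₁ (unique-++⁻ (z ∷ []) (unique-↭ (++-comm T (z ∷ V′)) u))) (suc-injective lenV) lenT
      ⊎ₚ C (z ∷ V′) (proj₁ (unique-++⁻ T u)) lenV)
  where
  shuffled : Unique ((z ∷ T) ++ V′)
  shuffled = unique-↭ (shift z T V′) u

residue-+ : ∀ r q d .{{_ : NonZero d}} → (q * d + r) % d ≡ r % d
residue-+ r q d = trans (cong (_% d) (+-comm (q * d) r)) ([m+kn]%n≡m%n r q d)

K₉-attached : ∀ b → Attached true b false
K₉-attached true  = attach (K₉-ends , K₉-ends-linked)
K₉-attached false = attach (blocks-only (map suc (upTo 8)) (K₉-internal , K₉-internal-linked))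

K₁₆-complete : ∀ b → Complete true b false 16
K₁₆-complete true  = spread (K₁₆-ends , K₁₆-ends-linked)
K₁₆-complete false = spread (blocks-only (upTo 16) (K₁₆-plain , K₁₆-plain-linked))

linked-+8 : ∀ {b} m → m % 3 ≡ 0 → Complete true b false (suc m) → Complete true b false (8 + suc m)
linked-+8 {b} m mod = addSharing (K₉-attached b) (bipartite-3-8 mod)

linked-+16 : ∀ {b} m → m % 3 ≡ 0 → Complete true b false m → Complete true b false (16 + m)
linked-+16 {b} m mod = addDisjoint 16 (K₁₆-complete b) (bipartite-+ʳ 8 (bipartite-3-8 mod) (bipartite-3-8 mod))

-- Eight vertices can be added to orders 1 modulo 3 and sixteen to orders 0 modulo 3. Each step
-- leads to the residue at which the other applies, so the two alternate.
linked-+24 : ∀ {b} n → n % 3 ≡ 0 ⊎ n % 3 ≡ 1 → Complete true b false n → Complete true b false (24 + n)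
linked-+24 n       (inj₁ e) C = linked-+8 (15 + n) e (linked-+16 n e C)
linked-+24 (suc m) (inj₂ e) C = linked-+16 (8 + suc m) (suc-%-3 m e) (linked-+8 m (suc-%-3 m e) C)

linked-complete : ∀ {b r} → r % 3 ≡ 0 ⊎ r % 3 ≡ 1 → Complete true b false r → ∀ q → Complete true b false (q * 24 + r)
linked-complete mod C zero = C
linked-complete {r = r} mod C (suc q) =
  linked-+24 (q * 24 + r) (subst (λ s → s ≡ 0 ⊎ s ≡ 1) (sym (lemma q)) mod) (linked-complete mod C q)
  where
  lemma : ∀ q → (q * 24 + r) % 3 ≡ r % 3
  lemma q = trans (cong (λ k → (k + r) % 3) (ring q)) (residue-+ r (q * 8) 3)
    where
    ring : ∀ q → q * 24 ≡ q * 8 * 3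
    ring = solve-∀

bipartite-2-8 : ∀ {b b′ m} → m % 2 ≡ 0 → CompleteBipartite false b b′ m 8
bipartite-2-8 mod = bipartite-+ʳ 4 (bipartite-2-4 mod) (bipartite-2-4 mod)

even-8 : ∀ q r → (q * 8 + r) % 2 ≡ r % 2
even-8 q r = trans (cong (λ k → (k + r) % 2) (ring q)) (residue-+ r (q * 4) 2)
  where
  ring : ∀ q → q * 8 ≡ q * 4 * 2
  ring = solve-∀

even-complete : ∀ {b b′} → Complete false b b′ 8 → ∀ q → Complete false b b′ (q * 8 + 8)
even-complete C zero    = C
even-complete C (suc q) = addDisjoint 8 C (bipartite-2-8 (even-8 q 8)) (even-complete C q)

odd-complete : ∀ {b b′} r → r % 2 ≡ 0 → Attached false b b′ → Complete false b b′ (suc r) → ∀ q → Complete false b b′ (q * 8 + suc r)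
odd-complete r mod A C zero    = C
odd-complete {b} {b′} r mod A C (suc q) = subst (Complete false b b′) (lemma₁ q r)
  (addSharing A (bipartite-2-8 (trans (even-8 q r) mod)) (subst (Complete false b b′) (lemma₂ q r) (odd-complete r mod A C q)))
  where
  lemma₁ : ∀ q r → 8 + suc (q * 8 + r) ≡ suc q * 8 + suc r
  lemma₁ = solve-∀
  lemma₂ : ∀ q r → q * 8 + suc r ≡ suc (q * 8 + r)
  lemma₂ = solve-∀

LinkedResidue : Bool → ℕ → Set
LinkedResidue b r = (r % 3 ≡ 0 ⊎ r % 3 ≡ 1) × Complete true b false r

complete-small : ∀ {n} → n ≤ 1 → Complete true false false n
complete-small z≤n [] u len = piece-∅
complete-small (s≤s z≤n) (x ∷ []) u len = blocks-only (x ∷ []) (piece-∅ {true} {false} {false})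

-- Exhaustion leaves 0, 1, 9 and 16 as the residues modulo 24 compatible with both conditions.
plain-residue : ∀ {r} → r < 24 → r % 8 ≡ 0 ⊎ r % 8 ≡ 1 → r % 3 ≡ 0 ⊎ r % 3 ≡ 1 → LinkedResidue false r
plain-residue {r} r<24 mod8 mod3 = mod3 , go (from-yes (allUpTo? (λ r → ((r % 8 ≟ 0) ⊎-dec (r % 8 ≟ 1)) →-dec (((r % 3 ≟ 0) ⊎-dec (r % 3 ≟ 1)) →-dec
    ((r ≟ 0) ⊎-dec ((r ≟ 1) ⊎-dec ((r ≟ 9) ⊎-dec (r ≟ 16)))))) 24) r<24 mod8 mod3)
  where
  go : r ≡ 0 ⊎ r ≡ 1 ⊎ r ≡ 9 ⊎ r ≡ 16 → Complete true false false r
  go (inj₁ refl)                      = complete-small z≤n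
  go (inj₂ (inj₁ refl))               = complete-small (s≤s z≤n)
  go (inj₂ (inj₂ (inj₁ refl)))        = spread (blocks-only (upTo 9) (K₉-internal , K₉-internal-linked))
  go (inj₂ (inj₂ (inj₂ refl)))        = K₁₆-complete false

-- Here `r` stands for the order v ∸ 1 of the target, hence the condition modulo 8 on `suc r`. The
-- residue 15 is reached from 7 by adding eight vertices.
ends-residue : ∀ {r} → r < 24 → suc r % 8 ≡ 0 ⊎ suc r % 8 ≡ 1 → r % 3 ≡ 0 ⊎ r % 3 ≡ 1 → LinkedResidue true r
ends-residue {r} r<24 mod8 mod3 = mod3 , go (from-yes (allUpTo? (λ r → ((suc r % 8 ≟ 0) ⊎-dec (suc r % 8 ≟ 1)) →-dec (((r % 3 ≟ 0) ⊎-dec (r % 3 ≟ 1)) →-dec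
    ((r ≟ 0) ⊎-dec ((r ≟ 7) ⊎-dec ((r ≟ 15) ⊎-dec (r ≟ 16)))))) 24) r<24 mod8 mod3)
  where
  K₇-complete : Complete true true false 7
  K₇-complete = spread (K₇-ends , K₇-ends-linked)
  go : r ≡ 0 ⊎ r ≡ 7 ⊎ r ≡ 15 ⊎ r ≡ 16 → Complete true true false r
  go (inj₁ refl)               = λ { [] _ _ → piece-∅ }
  go (inj₂ (inj₁ refl))        = K₇-complete
  go (inj₂ (inj₂ (inj₁ refl))) = linked-+8 6 refl K₇-complete
  go (inj₂ (inj₂ (inj₂ refl))) = K₁₆-complete true

-- The down-links

no-tails : ∀ {b′ S E} (k : Kit false b′ S E) → tails k ≡ []
no-tails (kit [] _ _ _ _ _ _)      = refl
no-tails (kit (_ ∷ _) _ _ _ _ hs _) = ⊥-elim (¬x∷xs↭[] hs)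

blocksDecomposition : ∀ {b′ S E} → Kit false b′ S E → Decomposition 5 E
blocksDecomposition k = decomposition (blocks k) (blocks-distinct k)
  (subst (λ ts → concatMap darts ts ++ concatMap darts (blocks k) ↭ _) (no-tails k) (exhausts k))

-- Every tail is lengthened by `u`. As the heads run once through `V`, the added edges are exactly
-- those at `u`.
coneDecomposition : ∀ {b′ u V} → Kit true b′ V (complete V) → Unique (u ∷ V) → Decomposition 5 (complete (u ∷ V))
coneDecomposition {u = u} {V} k w = decomposition (map (u Vec.∷_) (tails k) ++ blocks k)
  (All.++⁺ (All.map⁺ (All.tabulate λ {t} t∈ →
      unique⇒distinct (¬Any⇒All¬ _ (λ u∈ → Unique.Unique[x∷xs]⇒x∉xs w (within t∈ u∈)) ∷ distinct⇒unique (All.lookup (tails-distinct k) t∈))))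
    (blocks-distinct k))
  (↭-trans (↭-reflexive (concatMap-++ darts (map (u Vec.∷_) (tails k)) (blocks k)))
    (↭-trans (++⁺ʳ _ (lengthen (tails k)))
      (↭-trans (↭-reflexive (++-assoc (star u (map Vec.head (tails k))) _ _))
        (++⁺ (star-↭ u (heads k)) (exhausts k)))))
  where
  within : ∀ {t} → t ∈ tails k → toList t ⊆ₗ V
  within {t} t∈ x∈ with y , e ← darts-total t x∈ =
    proj₁ (∈-complete⁻ V (∈-resp-↭ (exhausts k) (∈-++⁺ˡ (∈-concatMap darts t∈ e))))
  lengthen : (ts : List (Vec ℕ 4)) → concatMap darts (map (u Vec.∷_) ts) ↭ star u (map Vec.head ts) ++ concatMap darts ts
  lengthen []             = ↭-refl
  lengthen (t@(x ∷ p) ∷ ts) = ↭-trans (++⁺ˡ (darts (u ∷ t)) (lengthen ts))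
    (solve 4 (λ ux d s D → (ux ∙ d) ∙ (s ∙ D) ⊜ (ux ∙ s) ∙ (d ∙ D)) ↭-refl
      (darts (u ∷ x ∷ [])) (darts t) (star u (map Vec.head ts)) (concatMap darts ts))

-- The images of the down-links. A tail arises from a block of the cone by removing the edge at the
-- apex, so no trunk of such a kit meets the apex.
trunks : ∀ {b b′ S E} → Kit b b′ S E → List (Vec ℕ 4)
trunks k = tails k ++ map Vec.tail (blocks k)

trunks-distinct : ∀ {b b′ S E} (k : Kit b b′ S E) → All Distinct (trunks k)
trunks-distinct k = All.++⁺ (tails-distinct k) (tail-distinct (blocks-distinct k))

trunk-of-cone : ∀ {b′ u V p} (k : Kit true b′ V (complete V)) (w : Unique (u ∷ V)) →
  p ∈ paths (coneDecomposition k w) → Vec.tail p ∈ trunks k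
trunk-of-cone {u = u} k w p∈ with ∈-++⁻ (map (u Vec.∷_) (tails k)) p∈
... | inj₂ p∈b = ∈-++⁺ʳ (tails k) (∈-map⁺ Vec.tail p∈b)
... | inj₁ p∈t with t , t∈ , refl ← ∈-map⁻ (u Vec.∷_) p∈t = ∈-++⁺ˡ t∈

rest-of-kit : ∀ {b b′ S E} (k : Kit b b′ S E) → both (map removedEdge (blocks k)) ++ concatMap darts (trunks k) ↭ E
rest-of-kit k = ↭-trans (++⁺ˡ _ (↭-reflexive (concatMap-++ darts (tails k) _)))
  (↭-trans (solve 3 (λ R t b → R ∙ (t ∙ b) ⊜ t ∙ (R ∙ b)) ↭-refl
      (both (map removedEdge (blocks k))) (concatMap darts (tails k)) (concatMap darts (map Vec.tail (blocks k))))
    (↭-trans (++⁺ˡ (concatMap darts (tails k)) (↭-sym (split-blocks (blocks k)))) (exhausts k)))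

linkedDecomposition : ∀ {b b′ S E} (k : Kit b b′ S E) → Linked k → Decomposition 4 E
linkedDecomposition k D = recover (rest-of-kit k) (D ⊕ decomposition (trunks k) (trunks-distinct k) ↭-refl)

linkDesigns : ∀ {V N} (u : Unique V) (D : Decomposition 5 (complete V)) (w : Unique N) (D′ : Decomposition 4 (complete N)) →
  (∀ {p} → p ∈ paths D → Vec.tail p ∈ paths D′) → DownLinkedTo-P₄ (designOf u D) (length N)
linkDesigns u D w D′ links = downLinked (designOf u D) refl w D′ λ i →
  Vec.tail (lookup (paths D) i) , links (∈-lookup i) , tail-⊆ (lookup (paths D) i) , tail-darts (lookup (paths D) i)

link-same : ∀ {V} → Unique V → Piece true false false V (complete V) → 𝓛₁ (path 5) (length V) (length V)
link-same u (k , D) = designOf u (blocksDecomposition k) ,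
  linkDesigns u (blocksDecomposition k) u (linkedDecomposition k D) λ p∈ → ∈-++⁺ʳ (paths D) (∈-++⁺ʳ (tails k) (∈-map⁺ Vec.tail p∈))

link-below : ∀ {u V} → Unique (u ∷ V) → Unique V → Piece true true false V (complete V) → 𝓛₁ (path 5) (suc (length V)) (length V)
link-below w u (k , D) = designOf w (coneDecomposition k w) ,
  linkDesigns w (coneDecomposition k w) u (linkedDecomposition k D) λ p∈ → ∈-++⁺ʳ (paths D) (trunk-of-cone k w p∈)

-- The apex of a cone of tails is an end of every block through it, so it can serve, together with one
-- new vertex, as the pair of apexes in extend-packing.
link-above : ∀ {b′ a u V} → Unique (a ∷ u ∷ V) → Unique (u ∷ V) → 3 ≤ length V →
  (2 + length V) % 3 ≡ 0 ⊎ (2 + length V) % 3 ≡ 1 → Piece false true b′ V (complete V) → 𝓛₁ (path 5) (suc (length V)) (2 + length V)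
link-above {a = a} {u} {V} w′ w 3≤ mod (k , _) = designOf w (coneDecomposition k w) ,
  linkDesigns w (coneDecomposition k w) w′ (proj₁ extended) λ p∈ → proj₂ extended (trunk-of-cone k w p∈)
  where
  extended = extend-packing (trunks k) (trunks-distinct k) (map removedEdge (blocks k) , ↭-refl) (rest-of-kit k) w′ 3≤ mod

-- Since `𝓛₂` speaks of all designs, one design in which every vertex is an inner vertex of some
-- block gives the bound.
internal-bound : ∀ {v n} → Complete false false true v → 𝓛₂ (path 5) v n → v ≤ n
internal-bound {v} {n} C h = bound (length-downFrom v) h
  where
  V = downFrom v
  k = proj₁ (C V (Unique.downFrom⁺ v) (length-downFrom v))
  𝓑 = designOf (Unique.downFrom⁺ v) (blocksDecomposition k)
  neighbours : ∀ {x} (p : Vec ℕ 5) → Distinct p → x ∈ middleOf p → ∃₂ λ y z → y ≢ z × (x , y) ∈ darts p × (x , z) ∈ darts p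
  neighbours (a ∷ b ∷ c ∷ d ∷ e ∷ []) ((_ VecAll.∷ a≢c VecAll.∷ _) VecAllPairs.∷ _) (here refl) =
    a , c , a≢c , there (here refl) , there (there (here refl))
  neighbours (a ∷ b ∷ c ∷ d ∷ e ∷ []) (_ VecAllPairs.∷ (_ VecAll.∷ b≢d VecAll.∷ _) VecAllPairs.∷ _) (there (here refl)) =
    b , d , b≢d , there (there (there (here refl))) , there (there (there (there (here refl))))
  neighbours (a ∷ b ∷ c ∷ d ∷ e ∷ []) (_ VecAllPairs.∷ _ VecAllPairs.∷ (_ VecAll.∷ c≢e VecAll.∷ _) VecAllPairs.∷ _) (there (there (here refl))) =
    c , e , c≢e , there (there (there (there (there (here refl))))) , there (there (there (there (there (there (here refl))))))
  through : ∀ {x} → x ∈ V → ∃ λ i → ∃₂ λ y z → y ≢ z × (x , y) ∈ darts (lookup (blocks k) i) × (x , z) ∈ darts (lookup (blocks k) i)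
  through x∈ with i ← All.lookup (internal k) x∈ =
    Any.index i , neighbours (lookup (blocks k) (Any.index i)) (All.lookup (blocks-distinct k) (∈-lookup (Any.index i))) (lookup-index i)
  bound : ∀ {w} → length V ≡ w → 𝓛₂ (path 5) w n → w ≤ n
  bound refl h = target-order-internal 𝓑 (h 𝓑) through

-- Admissible orders and the final case distinction

data Admissible₈ : ℕ → Set where
  multiple : ∀ q → Admissible₈ (suc q * 8)
  plus-one : ∀ q → Admissible₈ (suc (suc q * 8))

admissible₈ : ∀ {v} → v > 1 → v % 8 ≡ 0 ⊎ v % 8 ≡ 1 → Admissible₈ v
admissible₈ {v} v>1 (inj₁ e) with q ← v / 8 | eq ← m≡m%n+[m/n]*n v 8 rewrite e with q
... | zero  rewrite eq with () ← v>1
... | suc q rewrite eq = multiple q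
admissible₈ {v} v>1 (inj₂ e) with q ← v / 8 | eq ← m≡m%n+[m/n]*n v 8 rewrite e with q
... | zero  rewrite eq with s≤s () ← v>1
... | suc q rewrite eq = plus-one q

-- With v = m + 1 the order of the kit is 7 or 8 more than a multiple of 8. The first case starts
-- from `K₇-ends` and attaches nine-vertex pieces at a shared vertex, the second combines disjoint
-- copies of `K₈-ends`.
ends-complete : ∀ {m} → Admissible₈ (suc m) → Complete false true false m × 3 ≤ m
ends-complete (multiple q) = subst (Complete false true false) (+-comm (q * 8) 7)
  (odd-complete 6 refl (λ z T u len → unlink (K₉-attached true z T u len)) (λ V u len → unlink (spread (K₇-ends , K₇-ends-linked) V u len)) q)
  , s≤s (s≤s (s≤s z≤n))
ends-complete (plus-one q) = subst (Complete false true false) (+-comm (q * 8) 8) (even-complete (spread (K₈-ends , tt)) q)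
  , s≤s (s≤s (s≤s z≤n))

internal-complete : ∀ {v} → Admissible₈ v → Complete false false true v
internal-complete (multiple q) = subst (Complete false false true) (+-comm (q * 8) 8) (even-complete (spread (K₈-internal , tt)) q)
internal-complete (plus-one q) = subst (Complete false false true) (+-comm (q * 8) 9)
  -- `All.tail` drops vertex 0, the shared one, which is already an inner vertex in the piece it is
  -- shared with.
  (odd-complete 8 refl (attach (kit [] (blocks K₉-internal) [] (blocks-distinct K₉-internal) (exhausts K₉-internal) ↭-refl
      (All.tail (internal K₉-internal)) , tt))
    (spread (K₉-internal , tt)) q)

residue₃ : ∀ n → n % 3 ≡ (n % 24) % 3
residue₃ n = trans (cong (_% 3) (trans (m≡m%n+[m/n]*n n 24) (ring (n % 24) (n / 24))))
  (residue-+ (n % 24) (n / 24 * 8) 3)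
  where
  ring : ∀ r q → r + q * 24 ≡ q * 8 * 3 + r
  ring = solve-∀

by-residue : ∀ {b} n → (n % 24 < 24 → (n % 24) % 3 ≡ 0 ⊎ (n % 24) % 3 ≡ 1 → LinkedResidue b (n % 24)) →
  n % 3 ≡ 0 ⊎ n % 3 ≡ 1 → Complete true b false n
by-residue {b} n residue mod =
  subst (Complete true b false) (sym n≡) (linked-complete {b} {n % 24} (proj₁ small) (proj₂ small) (n / 24))
  where
  n≡ : n ≡ n / 24 * 24 + n % 24
  n≡ = trans (m≡m%n+[m/n]*n n 24) (+-comm (n % 24) (n / 24 * 24))
  small : LinkedResidue b (n % 24)
  small = residue (m%n<n n 24) (subst (λ r → r ≡ 0 ⊎ r ≡ 1) (residue₃ n) mod)

residue₈ : ∀ c n → (c + n) % 8 ≡ (c + n % 24) % 8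
residue₈ c n = trans (cong (λ m → (c + m) % 8) (m≡m%n+[m/n]*n n 24)) (trans (cong (_% 8) (ring c (n % 24) (n / 24)))
  (residue-+ (c + n % 24) (n / 24 * 3) 8))
  where
  ring : ∀ c r q → c + (r + q * 24) ≡ q * 3 * 8 + (c + r)
  ring = solve-∀

-- With `m` = v ∸ 1, the cases are n = v ∸ 1, v, v + 1 and n ≥ v + 2.
data Gap (m : ℕ) : ℕ → Set where
  below : Gap m m
  same  : Gap m (1 + m)
  above : Gap m (2 + m)
  large : ∀ {n} → 3 + m ≤ n → Gap m n

gap : ∀ {m n} → m ≤ n → Gap m n
gap m≤n with m≤n⇒m<n∨m≡n m≤n
... | inj₂ refl = below
... | inj₁ m<n with m≤n⇒m<n∨m≡n m<n
...   | inj₂ refl = same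
...   | inj₁ 1+m<n with m≤n⇒m<n∨m≡n 1+m<n
...     | inj₂ refl  = above
...     | inj₁ 2+m<n = large 2+m<n

𝓛₁-complete : ∀ {m n} → suc m > 1 → DesignOfOrder (suc m) (path 5) → n % 3 ≡ 0 ⊎ n % 3 ≡ 1 → Gap m n → 𝓛₁ (path 5) (suc m) n
𝓛₁-complete {m} v>1 𝓑 mod below = subst (λ l → 𝓛₁ (path 5) (suc l) l) (length-downFrom m)
  (link-below (Unique.downFrom⁺ (suc m)) (Unique.downFrom⁺ m) (complete-m (downFrom m) (Unique.downFrom⁺ m) (length-downFrom m)))
  where
  complete-m : Complete true true false m
  complete-m = by-residue m (λ r<24 → ends-residue r<24 (subst (λ r → r ≡ 0 ⊎ r ≡ 1) (residue₈ 1 m) (P₅-order 𝓑))) mod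
𝓛₁-complete {m} v>1 𝓑 mod same = subst (λ l → 𝓛₁ (path 5) l l) (length-downFrom (suc m))
  (link-same (Unique.downFrom⁺ (suc m)) (complete-v (downFrom (suc m)) (Unique.downFrom⁺ (suc m)) (length-downFrom (suc m))))
  where
  complete-v : Complete true false false (suc m)
  complete-v = by-residue (suc m) (λ r<24 → plain-residue r<24 (subst (λ r → r ≡ 0 ⊎ r ≡ 1) (residue₈ 0 (suc m)) (P₅-order 𝓑))) mod
𝓛₁-complete {m} v>1 𝓑 mod above = subst (λ l → 𝓛₁ (path 5) (suc l) (2 + l)) (length-downFrom m)
  (link-above (Unique.downFrom⁺ (2 + m)) (Unique.downFrom⁺ (suc m)) (subst (3 ≤_) (sym (length-downFrom m)) (proj₂ ends))
    (subst (λ l → (2 + l) % 3 ≡ 0 ⊎ (2 + l) % 3 ≡ 1) (sym (length-downFrom m)) mod)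
    (proj₁ ends (downFrom m) (Unique.downFrom⁺ m) (length-downFrom m)))
  where
  ends : Complete false true false m × 3 ≤ m
  ends = ends-complete (admissible₈ v>1 (P₅-order 𝓑))
-- In this range every design can be down-linked, so the one that witnesses admissibility will do.
𝓛₁-complete {m} {n} v>1 𝓑 mod (large n≥) = 𝓑 , links-to-large 𝓑 v>1 (subst (_≤ n) (+-comm 2 (suc m)) n≥) mod

theorem4p5 : (v : ℕ) → v > 1 → Admissible (path 5) v →
    (𝓛₁ (path 5) v ≐ (λ n → n ≥ v ∸ 1 × (n % 3 ≡ 0 ⊎ n % 3 ≡ 1))) ×
    ((λ n → n ≥ v + 2 × (n % 3 ≡ 0 ⊎ n % 3 ≡ 1)) ⊆ 𝓛₂ (path 5) v) ×
    (𝓛₂ (path 5) v ⊆ (λ n → n ≥ v × (n % 3 ≡ 0 ⊎ n % 3 ≡ 1)))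
theorem4p5 v@(suc _) v>1 𝓑 =
  ( (λ (𝓑′ , linked) → target-order 𝓑′ linked , P₄-order (proj₁ linked))
  , (λ (n≥ , mod) → 𝓛₁-complete v>1 𝓑 mod (gap n≥))) ,
  (λ (n≥ , mod) 𝓑′ → links-to-large 𝓑′ v>1 n≥ mod) ,
  -- Admissibility provides a design to which `h` applies; this yields a `P₄`-design of order `n`
  -- and hence the congruence.
  (λ h → internal-bound (internal-complete (admissible₈ v>1 (P₅-order 𝓑))) h , P₄-order (proj₁ (h 𝓑)))
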